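{- For any $\epsilon>0$, there is an algorithm that, given any instance of the day-dependent fair repetitive scheduling problem with $n$ clients and $m$ days, computes a schedule $\pi$ with $K(\pi)\le(1+\epsilon)K^*$, where $K^*$ is the optimal objective value of the instance. The algorithm can be implemented in $O(n^{\tilde O(m/\epsilon^2)})$ time.
   Context: Notation: $[k]=\{1,\dots,k\}$; $\tilde O$ suppresses polylogarithmic factors, i.e., $\tilde O(f)=O(f\cdot\log^{O(1)}f)$. An instance of the day-dependent fair repetitive scheduling problem consists of $n$ clients, $m$ days, and for each day $i\in[m]$ and client $j\in[n]$ a job $(i,j)$ with positive integer processing time $p_{i,j}$. On each day all $n$ jobs of that day are available at time $0$ and are processed non-preemptively on a single machine. A schedule is a sequence $\pi=(\pi_1,\dots,\pi_m)$ of permutations of $[n]$, where $\pi_i(j)$ is the position of job $(i,j)$ in the processing order of day $i$. The completion time of job $(i,j)$ is $C_{i,j}(\pi)=\sum_{\ell\in[n]:\,\pi_i(\ell)\le\pi_i(j)}p_{i,\ell}$, the total completion time of client $j$ is $C_j(\pi)=\sum_{i\in[m]}C_{i,j}(\pi)$, and the objective is to minimize $K(\pi)=\max_{j\in[n]}C_j(\pi)$. The optimal value is $K^*=\min_\pi K(\pi)$. -}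

module Defs where

open import Data.Bool.Base using (if_then_else_)
open import Data.Fin.Base using (Fin; toℕ; fromℕ<; combine; remQuot)
import Data.Fin.Properties as Fin
open import Data.Fin.Permutation using (Permutation′; _⟨$⟩ʳ_)
import Data.Integer.Base as ℤ
open import Data.List.Base using (map; filter; allFin)
open import Data.List.Extrema.Nat using (max)
open import Data.Nat.Base
  using (ℕ; suc; _+_; _*_; _∸_; _^_; _⊔_; _≤_; _<_; _≡ᵇ_)
open import Data.Nat.ListAction using (sum)
open import Data.Nat.Logarithm using (⌈log₂_⌉)
open import Data.Nat.Properties using (_<?_)
open import Data.Product.Base using (_×_; ∃; uncurry)
open import Data.Rational.Base as ℚ using (ℚ; Positive)
open import Data.Rational.Properties using (pos*pos⇒pos; pos⇒nonZero)
open import Relation.Binary.PropositionalEquality.Core using (_≡_; _≢_)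
open import Relation.Nullary.Decidable.Core using (yes; no)

------------------------------------------------------------------------
-- Day-dependent fair repetitive scheduling: n clients, m days

record Instance (n m : ℕ) : Set where
  field
    p   : Fin m → Fin n → ℕ
    p>0 : ∀ i j → 0 < p i j

open Instance public

-- π i ⟨$⟩ʳ j is the position of job (i , j) on day i; positions count from 0.
Schedule : ℕ → ℕ → Set
Schedule n m = Fin m → Permutation′ n

module _ {n m : ℕ} (I : Instance n m) where

  jobCompletion : Schedule n m → Fin m → Fin n → ℕ
  jobCompletion π i j =
    sum (map (p I i) (filter (λ ℓ → (π i ⟨$⟩ʳ ℓ) Fin.≤? (π i ⟨$⟩ʳ j)) (allFin n)))

  clientCompletion : Schedule n m → Fin n → ℕ
  clientCompletion π j = sum (map (λ i → jobCompletion π i j) (allFin m))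

  K : Schedule n m → ℕ
  K π = max 0 (map (clientCompletion π) (allFin n))

  IsOptimalValue : ℕ → Set
  IsOptimalValue K* = (∃ λ π → K π ≡ K*) × (∀ π → K* ≤ K π)

------------------------------------------------------------------------
-- Unit-cost random-access machine

-- Registers and arrays are named by literals in the program text, so a program
-- uses finitely many of each; array cells are addressed indirectly through a
-- register.  Cells hold natural numbers and the only arithmetic is addition and
-- truncated subtraction.  Multiplication is deliberately absent: at unit cost on
-- unbounded numbers it would make the machine unreasonably powerful, whereas
-- here a step lengthens the largest number present by at most one bit, apart
-- from loading literals.

Reg Arr : Set
Reg = ℕ
Arr = ℕ

infixr 4 _⨾_

data Program : Set where
  skip      : Program
  const     : Reg → ℕ → Program
  add sub   : Reg → Reg → Reg → Program
  load      : Reg → Arr → Reg → Program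
  store     : Arr → Reg → Reg → Program
  _⨾_       : Program → Program → Program
  ifNonZero : Reg → Program → Program → Program
  while     : Reg → Program → Program

record Memory : Set where
  constructor ⟪_,_⟫
  field
    reg : Reg → ℕ
    arr : Arr → ℕ → ℕ

open Memory public

infix 9 _[_↦_]

_[_↦_] : {A : Set} → (ℕ → A) → ℕ → A → ℕ → A
(f [ k ↦ v ]) x = if x ≡ᵇ k then v else f x

setReg : Memory → Reg → ℕ → Memory
setReg s r v = ⟪ reg s [ r ↦ v ] , arr s ⟫

setCell : Memory → Arr → ℕ → ℕ → Memory
setCell s a k v = ⟪ reg s , arr s [ a ↦ arr s a [ k ↦ v ] ] ⟫

infix 3 ⟨_,_⟩⇓[_]_

-- ⟨ P , s ⟩⇓[ t ] s′ : started in s, P halts in s′ after exactly t steps, where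
-- every instruction and every evaluation of a test is one step.
data ⟨_,_⟩⇓[_]_ : Program → Memory → ℕ → Memory → Set where
  ⇓skip  : ∀ {s} → ⟨ skip , s ⟩⇓[ 1 ] s
  ⇓const : ∀ {s r k} → ⟨ const r k , s ⟩⇓[ 1 ] setReg s r k
  ⇓add   : ∀ {s r x y} → ⟨ add r x y , s ⟩⇓[ 1 ] setReg s r (reg s x + reg s y)
  ⇓sub   : ∀ {s r x y} → ⟨ sub r x y , s ⟩⇓[ 1 ] setReg s r (reg s x ∸ reg s y)
  ⇓load  : ∀ {s r a x} → ⟨ load r a x , s ⟩⇓[ 1 ] setReg s r (arr s a (reg s x))
  ⇓store : ∀ {s a x y} → ⟨ store a x y , s ⟩⇓[ 1 ] setCell s a (reg s x) (reg s y)
  ⇓seq   : ∀ {P Q s s′ s″ t u} →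
           ⟨ P , s ⟩⇓[ t ] s′ → ⟨ Q , s′ ⟩⇓[ u ] s″ → ⟨ P ⨾ Q , s ⟩⇓[ t + u ] s″
  ⇓then  : ∀ {r P Q s s′ t} → reg s r ≢ 0 →
           ⟨ P , s ⟩⇓[ t ] s′ → ⟨ ifNonZero r P Q , s ⟩⇓[ suc t ] s′
  ⇓else  : ∀ {r P Q s s′ t} → reg s r ≡ 0 →
           ⟨ Q , s ⟩⇓[ t ] s′ → ⟨ ifNonZero r P Q , s ⟩⇓[ suc t ] s′
  ⇓done  : ∀ {r P s} → reg s r ≡ 0 → ⟨ while r P , s ⟩⇓[ 1 ] s
  ⇓loop  : ∀ {r P s s′ s″ t u} → reg s r ≢ 0 →
           ⟨ P , s ⟩⇓[ t ] s′ → ⟨ while r P , s′ ⟩⇓[ u ] s″ →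
           ⟨ while r P , s ⟩⇓[ suc (t + u) ] s″

-- Input: n in register 0, m in register 1, and the processing times in array 0,
-- day by day (toℕ (combine i j) is n * toℕ i + toℕ j); all else is 0.
initial : ∀ {n m} → Instance n m → Memory
initial {n} {m} I =
  ⟪ (λ _ → 0) [ 0 ↦ n ] [ 1 ↦ m ] , (λ _ _ → 0) [ 0 ↦ times ] ⟫
  where
  times : ℕ → ℕ
  times k with k <? m * n
  ... | yes k<mn = uncurry (p I) (remQuot n (fromℕ< k<mn))
  ... | no  _    = 0

-- Output: the positions in array 1, in the same layout.
Outputs : ∀ {n m} → Memory → Schedule n m → Set
Outputs s π = ∀ i j → arr s 1 (toℕ (combine i j)) ≡ toℕ (π i ⟨$⟩ʳ j)

------------------------------------------------------------------------
-- Approximation ratio and running time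

ℕ→ℚ : ℕ → ℚ
ℕ→ℚ k = (ℤ.+ k) ℚ./ 1

_/_² : ℕ → (ε : ℚ) → .{{Positive ε}} → ℚ
m / ε ² = (ℕ→ℚ m ℚ.÷ (ε ℚ.* ε)) {{pos⇒nonZero (ε ℚ.* ε) {{pos*pos⇒pos ε ε}}}}

-- c · f · (log f)ᵈ, with f rounded up and raised to at least 2, as the
-- logarithm is not positive for f ≤ 1.
softO : (c d : ℕ) → ℚ → ℕ
softO c d f = c * g * ⌈log₂ g ⌉ ^ d
  where
  g : ℕ
  g = 2 ⊔ ℤ.∣ ℚ.⌈ f ⌉ ∣

-- C · n ^ softO(m/ε²).  The base is at least 2 since for n = 1 the power would be
-- constant while the output still has m entries.
timeBound : (C c d n m : ℕ) (ε : ℚ) → .{{Positive ε}} → ℕ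
timeBound C c d n m ε = C * (2 ⊔ n) ^ softO c d (m / ε ²)

-- A hidden constant may depend on ε only monotonically: it is bounded uniformly
-- on (0 , ε₀] for every ε₀, so nothing that grows as ε → 0 is hidden in it.
-- For large ε some dependence is unavoidable, since writing the n * m output
-- entries exceeds n ^ Õ(m/ε²) once ε² outgrows m.
record HiddenConstant : Set where
  field
    at   : ℚ → ℕ
    mono : ∀ {ε ε′} → ε ℚ.≤ ε′ → at ε ≤ at ε′

open HiddenConstant public

-- On day i, round every completion time up to one of Õ(1/ε) thresholds between ε/m and
-- 1 times the total work of the day, each at most 1 + ε times its predecessor.  A client
-- then has a threshold for each day, and an assignment of thresholds is feasible (serving
-- the earliest threshold first) iff, for each day and threshold, the jobs due by it fit
-- before it.  These Õ(m/ε) loads, each known up to a multiple of ε/n of its threshold, are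
-- the state of a dynamic program over the clients that minimises the largest sum of
-- thresholds given to a client.  The optimum is a path of that program, and a cheapest
-- path yields a schedule within a factor 1 + O(ε) of the optimum.  Processing times are
-- never divided: a transition compares exact, suitably scaled loads and may err by one
-- unit.  States are numbers below n ^ Õ(m/ε), written in a base that gives every load a
-- digit.  All loops are bounded by global variables, so the running time is polynomial in
-- the largest of these, with a polynomial that does not depend on ε.

module Submission where

open import Defs
open import Data.Empty.Irrelevant using (⊥-elim)
import Data.Integer.Base as ℤ
open import Data.Nat.Base
open import Data.Nat.Properties
open import Data.Product.Base using (Σ-syntax; _×_; _,_)
open import Data.Rational.Base as ℚ using (ℚ; mkℚ; 1ℚ; Positive)
open import Relation.Binary.PropositionalEquality

-- Level 0 may cost ε/m of a day's total because that total never exceeds the optimum: over m days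
-- the waste sums to ε times the optimum. With precision e, rounding the completion times costs a
-- factor 1 + 2/e and rounding the loads a factor 1 + 1/e; the product is at most 1 + 5/e, which is
-- why e is chosen to be at least 5/ε.
--
-- The obstacle is the machine. It has no multiplication, processing times may be huge, and the time
-- bound must not depend on them. A product is therefore a loop of `cap` rounds in which only the
-- first factor must be at most `cap`; processing times and everything derived from them occur only
-- as second factors. For the same reason the loads of a state are guessed, not computed: a
-- transition merely checks an inequality between products, so nothing large is ever divided.
--
-- The program depends on ε through a single literal, and loading a literal takes one step whatever
-- its value. This makes one polynomial serve all ε.

-- An expression language with bounded loops and its verified compiler

module Language where

  open import Data.Bool.Base using (true; false)
  open import Data.Fin.Base using (Fin; zero; suc; toℕ)
  open import Data.Fin.Properties using (toℕ<n)
  open import Data.Product.Base using (∃; ∃₂; _×_; _,_; proj₁; proj₂)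
  open import Data.Vec.Base using (Vec; []; _∷_; lookup)
  open import Function.Base using (_∘_)
  open import Relation.Nullary.Negation.Core using (contradiction)

  iter : {A : Set} → ℕ → (ℕ → A → A) → A → A
  iter zero    f a = a
  iter (suc k) f a = f k (iter k f a)

  -- A loop runs as often as a global variable says, never on a computed bound, so every expression
  -- terminates and has a cost polynomial in the largest global. In the body of a `loop`, variable 0
  -- is the accumulator and variable 1 the index; the body of a `call` has no local variables except
  -- its arguments.
  data Expr (G : ℕ) : ℕ → Set where
    lit     : ∀ {k} → ℕ → Expr G k
    glob    : ∀ {k} → Fin G → Expr G k
    var     : ∀ {k} → Fin k → Expr G k
    _⊕_ _⊖_ : ∀ {k} → Expr G k → Expr G k → Expr G k
    read    : ∀ {k} → Arr → Expr G k → Expr G k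
    ifnz    : ∀ {k} → Expr G k → Expr G k → Expr G k → Expr G k
    loop    : ∀ {k} → Fin G → Expr G k → Expr G (2 + k) → Expr G k
    call    : ∀ {k r} → Expr G r → Vec (Expr G k) r → Expr G k

  infixl 6 _⊕_ _⊖_

  choose : {A : Set} → ℕ → A → A → A
  choose zero    a b = b
  choose (suc _) a b = a

  Arrays : Set
  Arrays = Arr → ℕ → ℕ

  module _ {G : ℕ} (γ : Vec ℕ G) (A : Arrays) where

    eval  : ∀ {k} → Expr G k → Vec ℕ k → ℕ
    evals : ∀ {k r} → Vec (Expr G k) r → Vec ℕ k → Vec ℕ r

    eval (lit v)      ρ = v
    eval (glob g)     ρ = lookup γ g
    eval (var x)      ρ = lookup ρ x
    eval (a ⊕ b)      ρ = eval a ρ + eval b ρ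
    eval (a ⊖ b)      ρ = eval a ρ ∸ eval b ρ
    eval (read r a)   ρ = A r (eval a ρ)
    eval (ifnz c a b) ρ = choose (eval c ρ) (eval a ρ) (eval b ρ)
    eval (loop g a b) ρ = iter (lookup γ g) (λ i v → eval b (v ∷ i ∷ ρ)) (eval a ρ)
    eval (call f es)  ρ = eval f (evals es ρ)

    evals []       ρ = []
    evals (e ∷ es) ρ = eval e ρ ∷ evals es ρ

  copy : Reg → Reg → Reg → Program
  copy d r z = const z 0 ⨾ add d r z

  range : Reg → ∀ r → Vec Reg r
  range t zero    = []
  range t (suc r) = t ∷ range (suc t) r

  -- The result goes to register t; registers below t and all arrays are left alone.
  compile  : ∀ {G k} → Expr G k → Reg → Vec Reg k → Program
  compiles : ∀ {G k r} → Vec (Expr G k) r → Reg → Vec Reg k → Program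

  -- Register `t` holds the accumulator, `1 + t` the index and `2 + t` the number of rounds left.
  -- Register `3 + t` receives the new accumulator and afterwards the constant 1 for both counters.
  loopBody : ∀ {G k} → Expr G (2 + k) → Reg → Vec Reg k → Program
  loopBody b t σ =
    compile b (3 + t) (t ∷ suc t ∷ σ) ⨾ copy t (3 + t) (4 + t) ⨾
    const (3 + t) 1 ⨾ add (1 + t) (1 + t) (3 + t) ⨾ sub (2 + t) (2 + t) (3 + t)

  compile (lit v)      t σ = const t v
  compile (glob g)     t σ = copy t (toℕ g) (suc t)
  compile (var x)      t σ = copy t (lookup σ x) (suc t)
  compile (a ⊕ b)      t σ = compile a t σ ⨾ compile b (suc t) σ ⨾ add t t (suc t)
  compile (a ⊖ b)      t σ = compile a t σ ⨾ compile b (suc t) σ ⨾ sub t t (suc t)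
  compile (read r a)   t σ = compile a t σ ⨾ load t r t
  compile (ifnz c a b) t σ = compile c t σ ⨾ ifNonZero t (compile a t σ) (compile b t σ)
  compile (loop g a b) t σ =
    compile a t σ ⨾ const (1 + t) 0 ⨾ copy (2 + t) (toℕ g) (3 + t) ⨾
    while (2 + t) (loopBody b t σ)
  compile (call {r = r} f es) t σ =
    compiles es t σ ⨾ compile f (r + t) (range t r) ⨾ copy t (r + t) (suc (r + t))

  compiles []       t σ = skip
  compiles (e ∷ es) t σ = compile e t σ ⨾ compiles es (suc t) σ

  -- An upper bound on the running time when all global variables are at most X.
  cost  : ∀ {G k} → Expr G k → ℕ → ℕ
  costs : ∀ {G k r} → Vec (Expr G k) r → ℕ → ℕ

  cost (lit v)      X = 1
  cost (glob g)     X = 2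
  cost (var x)      X = 2
  cost (a ⊕ b)      X = cost a X + (cost b X + 1)
  cost (a ⊖ b)      X = cost a X + (cost b X + 1)
  cost (read r a)   X = cost a X + 1
  cost (ifnz c a b) X = cost c X + suc (cost a X + cost b X)
  cost (loop g a b) X = cost a X + (1 + (2 + suc (X * suc (cost b X + 5))))
  cost (call f es)  X = costs es X + (cost f X + 2)

  costs []       X = 1
  costs (e ∷ es) X = cost e X + costs es X

  ≡ᵇ-refl : ∀ x → (x ≡ᵇ x) ≡ true
  ≡ᵇ-refl zero    = refl
  ≡ᵇ-refl (suc x) = ≡ᵇ-refl x

  ≢⇒≡ᵇ-false : ∀ {x y} → x ≢ y → (x ≡ᵇ y) ≡ false
  ≢⇒≡ᵇ-false {zero}  {zero}  x≢y = contradiction refl x≢y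
  ≢⇒≡ᵇ-false {zero}  {suc y} x≢y = refl
  ≢⇒≡ᵇ-false {suc x} {zero}  x≢y = refl
  ≢⇒≡ᵇ-false {suc x} {suc y} x≢y = ≢⇒≡ᵇ-false (x≢y ∘ cong suc)

  module _ {A : Set} (f : ℕ → A) where

    update-at : ∀ k v → (f [ k ↦ v ]) k ≡ v
    update-at k v rewrite ≡ᵇ-refl k = refl

    update-other : ∀ {x k} v → x ≢ k → (f [ k ↦ v ]) x ≡ f x
    update-other v x≢k rewrite ≢⇒≡ᵇ-false x≢k = refl

    update-below : ∀ {x k} v → x < k → (f [ k ↦ v ]) x ≡ f x
    update-below v x<k = update-other v (<⇒≢ x<k)

    update-above : ∀ {x k} v → k < x → (f [ k ↦ v ]) x ≡ f x
    update-above v k<x = update-other v (≢-sym (<⇒≢ k<x))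

  record Frame (t : ℕ) (s s′ : Memory) : Set where
    constructor frame
    field
      below : ∀ {r} → r < t → reg s′ r ≡ reg s r
      same  : arr s′ ≡ arr s

  open Frame

  Frame-refl : ∀ {t s} → Frame t s s
  Frame-refl = frame (λ _ → refl) refl

  Frame-trans : ∀ {t t′ s s′ s″} → t ≤ t′ → Frame t s s′ → Frame t′ s′ s″ → Frame t s s″
  Frame-trans t≤t′ p q = frame
    (λ r<t → trans (below q (<-≤-trans r<t t≤t′)) (below p r<t))
    (trans (same q) (same p))

  Frame-set : ∀ {t r v} s → t ≤ r → Frame t s (setReg s r v)
  Frame-set {v = v} s t≤r = frame (λ r<t → update-below (reg s) v (<-≤-trans r<t t≤r)) refl

  record Computes (P : Program) (s : Memory) (b t v : ℕ) : Set where
    constructor computes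
    field
      {final} : Memory
      {steps} : ℕ
      run     : ⟨ P , s ⟩⇓[ steps ] final
      fast    : steps ≤ b
      value   : reg final t ≡ v
      framed  : Frame t s final

  open Computes

  copied : ∀ {s b t} d r z → r ≢ z → b ≤ d → b ≤ z → reg s r ≡ t →
           ∃ λ s′ → (⟨ copy d r z , s ⟩⇓[ 2 ] s′) × reg s′ d ≡ t × Frame b s s′ ×
           (∀ {x} → x ≢ d → x ≢ z → reg s′ x ≡ reg s x)
  copied {s} d r z r≢z b≤d b≤z eq =
    s₂ , ⇓seq ⇓const ⇓add ,
    trans (update-at (reg s₁) d _)
      (trans (cong₂ _+_ (update-other (reg s) 0 r≢z) (update-at (reg s) z 0))
        (trans (+-identityʳ _) eq)) ,
    Frame-trans ≤-refl (Frame-set s b≤z) (Frame-set s₁ b≤d) ,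
    λ x≢d x≢z → trans (update-other (reg s₁) _ x≢d) (update-other (reg s) 0 x≢z)
    where
    s₁ = setReg s z 0
    s₂ = setReg s₁ d (reg s₁ r + reg s₁ z)

  -- Globals occupy the lowest `G` registers and locals lie anywhere below `t`, so code that writes
  -- only from `t` on preserves all of this.
  record Holds {G k} (γ : Vec ℕ G) (t : ℕ) (σ : Vec Reg k) (ρ : Vec ℕ k) (s : Memory) : Set where
    constructor holds
    field
      room    : G ≤ t
      globals : ∀ g → reg s (toℕ g) ≡ lookup γ g
      scoped  : ∀ x → lookup σ x < t
      locals  : ∀ x → reg s (lookup σ x) ≡ lookup ρ x

  open Holds

  global< : ∀ {G k t γ} {σ : Vec Reg k} {ρ s} → Holds {G} γ t σ ρ s → ∀ g → toℕ g < t
  global< h g = <-≤-trans (toℕ<n g) (room h)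

  Holds-frame : ∀ {G k t t′ γ} {σ : Vec Reg k} {ρ s s′} → t ≤ t′ → Holds {G} γ t σ ρ s →
                Frame t s s′ → Holds γ t′ σ ρ s′
  Holds-frame t≤t′ h f = holds
    (≤-trans (room h) t≤t′)
    (λ g → trans (below f (global< h g)) (globals h g))
    (λ x → <-≤-trans (scoped h x) t≤t′)
    (λ x → trans (below f (scoped h x)) (locals h x))

  module _ {G} (γ : Vec ℕ G) (X : ℕ) (γ≤X : ∀ g → lookup γ g ≤ X) where

    -- Correctness of the loop body is a parameter; `compile-correct` supplies it by its own
    -- recursive call on the subterm `b`.
    module Loop (A : Arrays) {k} (σ : Vec Reg k) (ρ : Vec ℕ k) (b : Expr G (2 + k)) (t : ℕ)
      (a₀ : ℕ)
      (body : ∀ s i v → Holds γ (3 + t) (t ∷ suc t ∷ σ) (v ∷ i ∷ ρ) s → arr s ≡ A →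
              Computes (compile b (3 + t) (t ∷ suc t ∷ σ)) s (cost b X) (3 + t)
                       (eval γ A b (v ∷ i ∷ ρ)))
      where

      result : ℕ → ℕ
      result i = iter i (λ i v → eval γ A b (v ∷ i ∷ ρ)) a₀

      record At (i : ℕ) (s : Memory) : Set where
        constructor atStep
        field
          acc   : reg s t ≡ result i
          index : reg s (suc t) ≡ i
          inv   : Holds γ t σ ρ s
          arrs  : arr s ≡ A

      open At

      once : ∀ s i r → At i s → reg s (2 + t) ≡ suc r →
             ∃₂ λ s′ τ → (⟨ loopBody b t σ , s ⟩⇓[ τ ] s′) × τ ≤ cost b X + 5 ×
             At (suc i) s′ × reg s′ (2 + t) ≡ r × Frame t s s′
      once s i r a rem = s₅ , _ ,
        ⇓seq (run c) (⇓seq cp (⇓seq ⇓const (⇓seq ⇓add ⇓sub))) ,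
        +-monoˡ-≤ 5 (fast c) ,
        atStep accEq ixEq (Holds-frame ≤-refl (inv a) f₅) (trans (same f₅) (arrs a)) ,
        remEq , f₅
        where
        h₀ : Holds γ (3 + t) (t ∷ suc t ∷ σ) (result i ∷ i ∷ ρ) s
        h₀ = holds (≤-trans (room (inv a)) (m≤n+m t 3)) (globals (inv a))
          (λ { zero → m≤n+m (suc t) 2
             ; (suc zero) → m≤n+m (2 + t) 1
             ; (suc (suc x)) → <-≤-trans (scoped (inv a) x) (m≤n+m t 3) })
          (λ { zero → acc a ; (suc zero) → index a ; (suc (suc x)) → locals (inv a) x })
        c  = body s i (result i) h₀ (arrs a)
        s₁ = final c
        cpd = copied {s₁} {t} t (3 + t) (4 + t) (<⇒≢ ≤-refl) ≤-refl (m≤n+m t 4) (value c)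
        s₂ = proj₁ cpd
        cp = proj₁ (proj₂ cpd)
        val₂ = proj₁ (proj₂ (proj₂ cpd))
        fr₂ = proj₁ (proj₂ (proj₂ (proj₂ cpd)))
        oth₂ = proj₂ (proj₂ (proj₂ (proj₂ cpd)))
        s₃ = setReg s₂ (3 + t) 1
        s₄ = setReg s₃ (1 + t) (reg s₃ (1 + t) + reg s₃ (3 + t))
        s₅ = setReg s₄ (2 + t) (reg s₄ (2 + t) ∸ reg s₄ (3 + t))
        f₅ : Frame t s s₅
        f₅ = Frame-trans ≤-refl
          (Frame-trans ≤-refl (Frame-trans (m≤n+m t 3) Frame-refl (framed c)) fr₂)
          (Frame-trans ≤-refl (Frame-set s₂ (m≤n+m t 3))
            (Frame-trans ≤-refl (Frame-set s₃ (m≤n+m t 1)) (Frame-set s₄ (m≤n+m t 2))))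
        accEq : reg s₅ t ≡ result (suc i)
        accEq = trans (update-below (reg s₄) _ (m≤n+m (suc t) 1))
          (trans (update-below (reg s₃) _ (n<1+n t))
          (trans (update-below (reg s₂) _ (m≤n+m (suc t) 2)) val₂))
        one₃ : reg s₃ (3 + t) ≡ 1
        one₃ = update-at (reg s₂) (3 + t) 1
        old : ∀ x → x < 3 + t → x ≢ t → reg s₃ x ≡ reg s x
        old x x< x≢t = trans (update-below (reg s₂) _ x<)
          (trans (oth₂ x≢t (<⇒≢ (m≤n⇒m≤1+n x<))) (below (framed c) x<))
        ixEq : reg s₅ (suc t) ≡ suc i
        ixEq = trans (update-below (reg s₄) _ (n<1+n (suc t)))
          (trans (update-at (reg s₃) (1 + t) _)
          (trans (cong₂ _+_ (trans (old (1 + t) (m≤n+m (2 + t) 1) (≢-sym (<⇒≢ ≤-refl))) (index a)) one₃)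
                 (+-comm i 1)))
        remEq : reg s₅ (2 + t) ≡ r
        remEq = trans (update-at (reg s₄) (2 + t) _)
          (cong₂ _∸_
            (trans (update-above (reg s₃) _ (n<1+n (suc t)))
              (trans (old (2 + t) ≤-refl (≢-sym (<⇒≢ (m≤n+m (suc t) 1)))) rem))
            (trans (update-above (reg s₃) _ (m≤n+m (2 + t) 1)) one₃))

      many : ∀ r i s → At i s → reg s (2 + t) ≡ r →
             ∃₂ λ s′ τ → (⟨ while (2 + t) (loopBody b t σ) , s ⟩⇓[ τ ] s′) ×
             τ ≤ suc (r * suc (cost b X + 5)) × At (r + i) s′ × Frame t s s′
      many zero    i s a rem = s , 1 , ⇓done rem , ≤-refl , a , Frame-refl
      many (suc r) i s a rem =
        let s₁ , τ₁ , run₁ , fast₁ , a₁ , rem₁ , f₁ = once s i r a rem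
            s₂ , τ₂ , run₂ , fast₂ , a₂ , f₂ = many r (suc i) s₁ a₁ rem₁
        in s₂ , _ , ⇓loop (λ eq → contradiction (trans (sym rem) eq) λ ()) run₁ run₂ ,
           s≤s (≤-trans (+-mono-≤ fast₁ fast₂) (≤-reflexive (+-suc (cost b X + 5) _))) ,
           subst (λ j → At j s₂) (+-suc r i) a₂ ,
           Frame-trans ≤-refl f₁ f₂

    record Evaluates {r} (P : Program) (s : Memory) (b t : ℕ) (vs : Vec ℕ r) : Set where
      constructor evaluates
      field
        {final′} : Memory
        {steps′} : ℕ
        run′     : ⟨ P , s ⟩⇓[ steps′ ] final′
        fast′    : steps′ ≤ b
        values   : ∀ x → reg final′ (lookup (range t r) x) ≡ lookup vs x
        framed′  : Frame t s final′

    range< : ∀ t r x → lookup (range t r) x < r + t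
    range< t (suc r) zero    = s≤s (m≤n+m t r)
    range< t (suc r) (suc x) = subst (lookup (range (suc t) r) x <_) (+-suc r t) (range< (suc t) r x)

    -- Induction on the expression. A first operand left in `t` survives the second, which is
    -- compiled at `suc t`; and since expressions never store, both are evaluated on the same
    -- arrays.
    compile-correct : ∀ {k} (e : Expr G k) t σ ρ s → Holds γ t σ ρ s →
      Computes (compile e t σ) s (cost e X) t (eval γ (arr s) e ρ)
    compiles-correct : ∀ {k r} (es : Vec (Expr G k) r) t σ ρ s → Holds γ t σ ρ s →
      Evaluates (compiles es t σ) s (costs es X) t (evals γ (arr s) es ρ)

    compile-correct (lit v) t σ ρ s h =
      computes ⇓const ≤-refl (update-at (reg s) t v) (Frame-set s ≤-refl)
    compile-correct (glob g) t σ ρ s h =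
      let _ , run , val , fr , _ = copied {s} {t} t (toℕ g) (suc t)
            (<⇒≢ (m≤n⇒m≤1+n (global< h g))) ≤-refl (n≤1+n t) (globals h g)
      in computes run ≤-refl val fr
    compile-correct (var x) t σ ρ s h =
      let _ , run , val , fr , _ = copied {s} {t} t (lookup σ x) (suc t)
            (<⇒≢ (m≤n⇒m≤1+n (scoped h x))) ≤-refl (n≤1+n t) (locals h x)
      in computes run ≤-refl val fr
    compile-correct (a ⊕ b) t σ ρ s h with compile-correct a t σ ρ s h
    ... | computes {s₁} run₁ fast₁ val₁ fr₁
      with compile-correct b (suc t) σ ρ s₁ (Holds-frame (n≤1+n t) h fr₁)
    ... | computes {s₂} run₂ fast₂ val₂ fr₂ = computes
      (⇓seq run₁ (⇓seq run₂ ⇓add))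
      (+-mono-≤ fast₁ (+-monoˡ-≤ 1 fast₂))
      (trans (update-at (reg s₂) t _)
        (cong₂ _+_ (trans (below fr₂ ≤-refl) val₁)
          (trans val₂ (cong (λ A → eval γ A b ρ) (same fr₁)))))
      (Frame-trans (n≤1+n t) fr₁ fr₂ ▹ Frame-set s₂ ≤-refl)
      where _▹_ = Frame-trans ≤-refl
    compile-correct (a ⊖ b) t σ ρ s h with compile-correct a t σ ρ s h
    ... | computes {s₁} run₁ fast₁ val₁ fr₁
      with compile-correct b (suc t) σ ρ s₁ (Holds-frame (n≤1+n t) h fr₁)
    ... | computes {s₂} run₂ fast₂ val₂ fr₂ = computes
      (⇓seq run₁ (⇓seq run₂ ⇓sub))
      (+-mono-≤ fast₁ (+-monoˡ-≤ 1 fast₂))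
      (trans (update-at (reg s₂) t _)
        (cong₂ _∸_ (trans (below fr₂ ≤-refl) val₁)
          (trans val₂ (cong (λ A → eval γ A b ρ) (same fr₁)))))
      (Frame-trans (n≤1+n t) fr₁ fr₂ ▹ Frame-set s₂ ≤-refl)
      where _▹_ = Frame-trans ≤-refl
    compile-correct (read r a) t σ ρ s h with compile-correct a t σ ρ s h
    ... | computes {s₁} run₁ fast₁ val₁ fr₁ = computes
      (⇓seq run₁ ⇓load)
      (+-monoˡ-≤ 1 fast₁)
      (trans (update-at (reg s₁) t _) (cong₂ (λ A i → A r i) (same fr₁) val₁))
      (Frame-trans ≤-refl fr₁ (Frame-set s₁ ≤-refl))
    compile-correct (ifnz c a b) t σ ρ s h with compile-correct c t σ ρ s h
    ... | computes {s₁} run₁ fast₁ val₁ fr₁ with eval γ (arr s) c ρ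
    ... | zero with compile-correct b t σ ρ s₁ (Holds-frame ≤-refl h fr₁)
    ...   | computes run₂ fast₂ val₂ fr₂ = computes
      (⇓seq run₁ (⇓else val₁ run₂))
      (+-mono-≤ fast₁ (s≤s (≤-trans fast₂ (m≤n+m _ _))))
      (trans val₂ (cong (λ A → eval γ A b ρ) (same fr₁)))
      (Frame-trans ≤-refl fr₁ fr₂)
    compile-correct (ifnz c a b) t σ ρ s h | computes {s₁} run₁ fast₁ val₁ fr₁ | suc w
      with compile-correct a t σ ρ s₁ (Holds-frame ≤-refl h fr₁)
    ...   | computes run₂ fast₂ val₂ fr₂ = computes
      (⇓seq run₁ (⇓then (λ eq → contradiction (trans (sym val₁) eq) λ ()) run₂))
      (+-mono-≤ fast₁ (s≤s (≤-trans fast₂ (m≤m+n _ _))))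
      (trans val₂ (cong (λ A → eval γ A a ρ) (same fr₁)))
      (Frame-trans ≤-refl fr₁ fr₂)
    compile-correct (loop g a b) t σ ρ s h with compile-correct a t σ ρ s h
    ... | computes {s₁} run₁ fast₁ val₁ fr₁ =
      let s₂ = setReg s₁ (1 + t) 0
          h₂ = Holds-frame (n≤1+n t) h (Frame-trans ≤-refl fr₁ (Frame-set s₁ (n≤1+n t)))
          s₃ , run₃ , val₃ , fr₃ , oth₃ = copied {s₂} {t} (2 + t) (toℕ g) (3 + t)
            (<⇒≢ (<-≤-trans (global< h g) (m≤n+m t 3))) (m≤n+m t 2) (m≤n+m t 3) (globals h₂ g)
          a₃ : L.At 0 s₃
          a₃ = L.atStep
            (trans (oth₃ (<⇒≢ (m≤n+m (suc t) 1)) (<⇒≢ (m≤n+m (suc t) 2)))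
              (trans (update-below (reg s₁) 0 ≤-refl) val₁))
            (trans (oth₃ (<⇒≢ ≤-refl) (<⇒≢ (m≤n+m (2 + t) 1))) (update-at (reg s₁) (1 + t) 0))
            (Holds-frame ≤-refl h
              (Frame-trans ≤-refl (Frame-trans ≤-refl fr₁ (Frame-set s₁ (n≤1+n t))) fr₃))
            (trans (same fr₃) (same fr₁))
          s₄ , _ , run₄ , fast₄ , a₄ , fr₄ = L.many (lookup γ g) 0 s₃ a₃ val₃
      in computes
        (⇓seq run₁ (⇓seq ⇓const (⇓seq run₃ run₄)))
        (+-mono-≤ fast₁ (+-monoʳ-≤ 3 (≤-trans fast₄ (s≤s (*-monoˡ-≤ _ (γ≤X g))))))
        (trans (L.At.acc a₄) (cong L.result (+-identityʳ (lookup γ g))))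
        (Frame-trans ≤-refl (Frame-trans ≤-refl (Frame-trans ≤-refl fr₁ (Frame-set s₁ (n≤1+n t))) fr₃) fr₄)
      where
      body : ∀ s′ i v → Holds γ (3 + t) (t ∷ suc t ∷ σ) (v ∷ i ∷ ρ) s′ → arr s′ ≡ arr s →
             Computes (compile b (3 + t) (t ∷ suc t ∷ σ)) s′ (cost b X) (3 + t)
                      (eval γ (arr s) b (v ∷ i ∷ ρ))
      body s′ i v h′ refl = compile-correct b (3 + t) (t ∷ suc t ∷ σ) (v ∷ i ∷ ρ) s′ h′
      module L = Loop (arr s) σ ρ b t (eval γ (arr s) a ρ) body
    compile-correct (call {r = r} f es) t σ ρ s h with compiles-correct es t σ ρ s h
    ... | evaluates {s₁} run₁ fast₁ vals₁ fr₁
      with compile-correct f (r + t) (range t r) (evals γ (arr s) es ρ) s₁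
        (holds (≤-trans (room h) (m≤n+m t r)) (globals (Holds-frame ≤-refl h fr₁)) (range< t r) vals₁)
    ... | computes {s₂} run₂ fast₂ val₂ fr₂ =
      let s₃ , run₃ , val₃ , fr₃ , _ = copied {s₂} {t} t (r + t) (suc (r + t)) (<⇒≢ ≤-refl)
            ≤-refl (m≤n+m t (suc r)) val₂
      in computes (⇓seq run₁ (⇓seq run₂ run₃))
        (+-mono-≤ fast₁ (+-monoˡ-≤ 2 fast₂))
        (trans val₃ (cong (λ A → eval γ A f (evals γ (arr s) es ρ)) (same fr₁)))
        (Frame-trans ≤-refl (Frame-trans (m≤n+m t r) fr₁ fr₂) fr₃)

    compiles-correct [] t σ ρ s h = evaluates ⇓skip ≤-refl (λ ()) Frame-refl
    compiles-correct (e ∷ es) t σ ρ s h with compile-correct e t σ ρ s h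
    ... | computes {s₁} run₁ fast₁ val₁ fr₁
      with compiles-correct es (suc t) σ ρ s₁ (Holds-frame (n≤1+n t) h fr₁)
    ... | evaluates run₂ fast₂ vals₂ fr₂ = evaluates
      (⇓seq run₁ run₂)
      (+-mono-≤ fast₁ fast₂)
      (λ { zero → trans (below fr₂ ≤-refl) val₁
         ; (suc x) → trans (vals₂ x) (cong (λ A → lookup (evals γ A es ρ) x) (same fr₁)) })
      (Frame-trans (n≤1+n t) fr₁ fr₂)

-- Assignments, table filling and polynomial cost

module Statements where

  open Language
  open import Data.Fin.Base using (Fin; zero; suc; toℕ)
  open import Data.Fin.Properties using (toℕ<n; toℕ-injective)
  import Data.Fin.Properties as Fin
  open import Data.List.Base using ([]; _∷_)
  open import Data.Product.Base using (∃; ∃₂; _×_; _,_; proj₁; proj₂)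
  open import Data.Sum.Base using (inj₁; inj₂)
  open import Data.Vec.Base using (Vec; []; _∷_; lookup; _[_]≔_)
  open import Data.Vec.Properties using (lookup∘updateAt; lookup∘updateAt′)
  open import Function.Base using (_∘_)
  open import Relation.Nullary.Decidable.Core using (yes; no)
  open import Relation.Nullary.Negation.Core using (contradiction)

  -- `fill` evaluates its expression for cell i when all cells below i are in place, so the
  -- expression may read them. Recursively defined tables are computed this way.
  data Stmt (G : ℕ) : Set where
    set  : Fin G → Expr G 0 → Stmt G
    fill : Arr → Fin G → Expr G 1 → Stmt G

  fillBody : ∀ {G} → Arr → Expr G 1 → Program
  fillBody {G} a e =
    compile e (2 + G) (G ∷ []) ⨾ store a G (2 + G) ⨾
    const (2 + G) 1 ⨾ add G G (2 + G) ⨾ sub (1 + G) (1 + G) (2 + G)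

  compileStmt : ∀ {G} → Stmt G → Program
  compileStmt {G} (set g e)    = compile e G [] ⨾ copy (toℕ g) G (suc G)
  compileStmt {G} (fill a g e) =
    const G 0 ⨾ copy (1 + G) (toℕ g) (2 + G) ⨾ while (1 + G) (fillBody a e)

  costStmt : ∀ {G} → Stmt G → ℕ → ℕ
  costStmt (set g e)    X = cost e X + 2
  costStmt (fill a g e) X = 1 + (2 + suc (X * suc (cost e X + 4)))

  record Matches {G} (γ : Vec ℕ G) (Φ : Arrays → Set) (s : Memory) : Set where
    constructor matches
    field
      globalsAgree : ∀ g → reg s (toℕ g) ≡ lookup γ g
      arraysHold   : Φ (arr s)

  open Matches

  -- A Hoare triple with a time bound. Globals are tracked by value, arrays by a predicate, since a
  -- table is specified only cell by cell and only up to its length.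
  Runs : ∀ {G} → Program → Vec ℕ G → (Arrays → Set) → Vec ℕ G → (Arrays → Set) → ℕ → Set
  Runs P γ Φ γ′ Φ′ b = ∀ s → Matches γ Φ s →
    ∃₂ λ s′ t → (⟨ P , s ⟩⇓[ t ] s′) × Matches γ′ Φ′ s′ × t ≤ b

  Runs-seq : ∀ {G P Q} {γ γ′ γ″ : Vec ℕ G} {Φ Φ′ Φ″ b c} →
             Runs P γ Φ γ′ Φ′ b → Runs Q γ′ Φ′ γ″ Φ″ c → Runs (P ⨾ Q) γ Φ γ″ Φ″ (b + c)
  Runs-seq p q s h =
    let s₁ , _ , run₁ , h₁ , le₁ = p s h
        s₂ , _ , run₂ , h₂ , le₂ = q s₁ h₁
    in s₂ , _ , ⇓seq run₁ run₂ , h₂ , +-mono-≤ le₁ le₂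

  Filled : Arr → (ℕ → ℕ) → Arrays → ℕ → Arrays → Set
  Filled a f A i A′ = (∀ b j → b ≢ a → A′ b j ≡ A b j) × (∀ j → j < i → A′ a j ≡ f j)

  module _ {G} (γ : Vec ℕ G) (X : ℕ) (γ≤X : ∀ g → lookup γ g ≤ X) (Φ : Arrays → Set) where

    set-runs : ∀ g (e : Expr G 0) {v} → (∀ A → Φ A → eval γ A e [] ≡ v) →
               Runs (compileStmt (set g e)) γ Φ (γ [ g ]≔ v) Φ (costStmt (set g e) X)
    set-runs g e {v} spec s h
      with compile-correct γ X γ≤X e G [] [] s (holds ≤-refl (globalsAgree h) (λ ()) (λ ()))
    ... | computes {s₁} run₁ fast₁ val₁ fr₁ =
      let s₂ , run₂ , val₂ , fr₂ , oth₂ = copied {s₁} {0} (toℕ g) G (suc G) (<⇒≢ ≤-refl) z≤n z≤n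
            (trans val₁ (spec (arr s) (arraysHold h)))
      in s₂ , _ , ⇓seq run₁ run₂ ,
         matches (agree s₁ s₂ fr₁ val₂ oth₂) (subst Φ (sym (trans (Frame.same fr₂) (Frame.same fr₁))) (arraysHold h)) ,
         +-monoˡ-≤ 2 fast₁
      where
      agree : ∀ s₁ s₂ → Frame G s s₁ → reg s₂ (toℕ g) ≡ v →
              (∀ {x} → x ≢ toℕ g → x ≢ suc G → reg s₂ x ≡ reg s₁ x) →
              ∀ g′ → reg s₂ (toℕ g′) ≡ lookup (γ [ g ]≔ v) g′
      agree s₁ s₂ fr val oth g′ with g′ Fin.≟ g
      ... | yes refl = trans val (sym (lookup∘updateAt g γ))
      ... | no g′≢g  = trans (oth (g′≢g ∘ toℕ-injective) (<⇒≢ (m≤n⇒m≤1+n (toℕ<n g′))))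
        (trans (Frame.below fr (toℕ<n g′))
        (trans (globalsAgree h g′) (sym (lookup∘updateAt′ g′ g g′≢g γ))))

    module _ (a : Arr) (count : Fin G) (e : Expr G 1) (f : ℕ → ℕ)
      (spec : ∀ A → Φ A → ∀ A′ i → i < lookup γ count → Filled a f A i A′ →
              eval γ A′ e (i ∷ []) ≡ f i)
      where

      private
        record At (A : Arrays) (i : ℕ) (s : Memory) : Set where
          constructor atStep
          field
            index  : reg s G ≡ i
            agree  : ∀ g → reg s (toℕ g) ≡ lookup γ g
            filled : Filled a f A i (arr s)

        open At

        once : ∀ A → Φ A → ∀ s i r → At A i s → reg s (1 + G) ≡ suc r → i < lookup γ count →
               ∃₂ λ s′ τ → (⟨ fillBody a e , s ⟩⇓[ τ ] s′) × τ ≤ cost e X + 4 ×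
               At A (suc i) s′ × reg s′ (1 + G) ≡ r
        once A φ s i r st rem i<
          with compile-correct γ X γ≤X e (2 + G) (G ∷ []) (i ∷ []) s
                 (holds (m≤n+m G 2) (agree st) (λ { zero → m≤n+m (suc G) 1 })
                        (λ { zero → index st }))
        ... | computes {s₁} run₁ fast₁ val₁ fr₁ =
          s₅ , _ , ⇓seq run₁ (⇓seq ⇓store (⇓seq ⇓const (⇓seq ⇓add ⇓sub))) ,
          +-monoˡ-≤ 4 fast₁ , atStep ixEq agree₅ (old , new) , remEq
          where
          s₂ = setCell s₁ a (reg s₁ G) (reg s₁ (2 + G))
          s₃ = setReg s₂ (2 + G) 1
          s₄ = setReg s₃ G (reg s₃ G + reg s₃ (2 + G))
          s₅ = setReg s₄ (1 + G) (reg s₄ (1 + G) ∸ reg s₄ (2 + G))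
          ix₁ : reg s₁ G ≡ i
          ix₁ = trans (Frame.below fr₁ (m≤n+m (suc G) 1)) (index st)
          one₃ : reg s₃ (2 + G) ≡ 1
          one₃ = update-at (reg s₂) (2 + G) 1
          ixEq : reg s₅ G ≡ suc i
          ixEq = trans (update-below (reg s₄) _ (n<1+n G))
            (trans (update-at (reg s₃) G _)
            (trans (cong₂ _+_ (trans (update-below (reg s₂) 1 (m≤n+m (suc G) 1)) ix₁) one₃)
                   (+-comm i 1)))
          remEq : reg s₅ (1 + G) ≡ r
          remEq = trans (update-at (reg s₄) (1 + G) _)
            (cong₂ _∸_
              (trans (update-above (reg s₃) _ (n<1+n G))
                (trans (update-below (reg s₂) 1 (n<1+n (suc G)))
                  (trans (Frame.below fr₁ (n<1+n (suc G))) rem)))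
              (trans (update-above (reg s₃) _ (m≤n+m (suc G) 1)) one₃))
          agree₅ : ∀ g → reg s₅ (toℕ g) ≡ lookup γ g
          agree₅ g = trans (update-below (reg s₄) _ (m≤n⇒m≤1+n (toℕ<n g)))
            (trans (update-below (reg s₃) _ (toℕ<n g))
            (trans (update-below (reg s₂) 1 (<-≤-trans (toℕ<n g) (m≤n+m G 2)))
            (trans (Frame.below fr₁ (<-≤-trans (toℕ<n g) (m≤n+m G 2))) (agree st g))))
          same₁ : arr s₁ ≡ arr s
          same₁ = Frame.same fr₁
          v : ℕ
          v = reg s₁ (2 + G)
          v≡ : v ≡ f i
          v≡ = trans val₁ (spec A φ (arr s) i i< (filled st))
          old : ∀ b j → b ≢ a → arr s₅ b j ≡ A b j
          old b j b≢a = trans (cong (λ row → row j) (update-other (arr s₁) _ b≢a))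
            (trans (cong (λ B → B b j) same₁) (proj₁ (filled st) b j b≢a))
          new : ∀ j → j < suc i → arr s₅ a j ≡ f j
          new j j< = trans (cong (λ row → row j) (update-at (arr s₁) a _)) (cell j j<)
            where
            cell : ∀ j → j < suc i → (arr s₁ a [ reg s₁ G ↦ v ]) j ≡ f j
            cell j j< with m≤n⇒m<n∨m≡n (s≤s⁻¹ j<)
            ... | inj₁ j<i = trans (update-other (arr s₁ a) v (λ eq → <⇒≢ j<i (trans eq ix₁)))
              (trans (cong (λ B → B a j) same₁) (proj₂ (filled st) j j<i))
            ... | inj₂ refl = trans
              (subst (λ k → (arr s₁ a [ k ↦ v ]) i ≡ v) (sym ix₁) (update-at (arr s₁ a) i v)) v≡

        many : ∀ A → Φ A → ∀ r i s → At A i s → reg s (1 + G) ≡ r → r + i ≡ lookup γ count →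
               ∃₂ λ s′ τ → (⟨ while (1 + G) (fillBody a e) , s ⟩⇓[ τ ] s′) ×
               τ ≤ suc (r * suc (cost e X + 4)) × At A (lookup γ count) s′
        many A φ zero i s st rem refl = s , 1 , ⇓done rem , ≤-refl , st
        many A φ (suc r) i s st rem eq =
          let s₁ , τ₁ , run₁ , fast₁ , st₁ , rem₁ = once A φ s i r st rem
                (subst (i <_) eq (s≤s (m≤n+m i r)))
              s₂ , τ₂ , run₂ , fast₂ , st₂ = many A φ r (suc i) s₁ st₁ rem₁ (trans (+-suc r i) eq)
          in s₂ , _ , ⇓loop (λ eq′ → contradiction (trans (sym rem) eq′) λ ()) run₁ run₂ ,
             s≤s (≤-trans (+-mono-≤ fast₁ fast₂) (≤-reflexive (+-suc (cost e X + 4) _))) , st₂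

      -- The hypothesis `spec` may assume that the cells before i already agree with `f`; it is the
      -- induction step of the recursion that defines the table.
      fill-runs : Runs (compileStmt (fill a count e)) γ Φ
                       γ (λ A′ → ∃ λ A → Φ A × Filled a f A (lookup γ count) A′)
                       (costStmt (fill a count e) X)
      fill-runs s h =
        let s₁ = setReg s G 0
            s₂ , run₂ , val₂ , fr₂ , oth₂ = copied {s₁} {G} (1 + G) (toℕ count) (2 + G)
              (<⇒≢ (<-≤-trans (toℕ<n count) (m≤n+m G 2))) (n≤1+n G) (m≤n+m G 2)
              (trans (update-below (reg s) 0 (toℕ<n count)) (globalsAgree h count))
            st₂ : At (arr s) 0 s₂
            st₂ = atStep
              (trans (oth₂ (<⇒≢ (n<1+n G)) (<⇒≢ (m≤n+m (suc G) 1))) (update-at (reg s) G 0))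
              (λ g → trans (Frame.below fr₂ (toℕ<n g))
                (trans (update-below (reg s) 0 (toℕ<n g)) (globalsAgree h g)))
              ((λ b j _ → cong (λ A → A b j) (Frame.same fr₂)) , λ _ ())
            s₃ , _ , run₃ , fast₃ , st₃ = many (arr s) (arraysHold h) (lookup γ count) 0 s₂ st₂ val₂
              (+-identityʳ _)
        in s₃ , _ , ⇓seq ⇓const (⇓seq run₂ run₃) ,
           matches (agree st₃) (arr s , arraysHold h , filled st₃) ,
           +-monoʳ-≤ 3 (≤-trans fast₃ (s≤s (*-monoˡ-≤ _ (γ≤X count))))

  -- For X ≥ 1 powers grow with the exponent, so one monomial can dominate a sum; adding the degrees
  -- serves sums and products alike.
  Polynomial : (ℕ → ℕ) → Set
  Polynomial f = ∃₂ λ C d → ∀ X → 1 ≤ X → f X ≤ C * X ^ d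

  poly-const : ∀ c → Polynomial (λ _ → c)
  poly-const c = c , 0 , λ _ _ → ≤-reflexive (sym (*-identityʳ c))

  poly-id : Polynomial (λ X → X)
  poly-id = 1 , 1 , λ X _ → ≤-reflexive (sym (trans (*-identityˡ _) (*-identityʳ X)))

  poly-+ : ∀ {f g} → Polynomial f → Polynomial g → Polynomial (λ X → f X + g X)
  poly-+ {f} {g} (C , d , p) (C′ , d′ , p′) = C + C′ , d + d′ , λ X 1≤X → begin
    f X + g X                               ≤⟨ +-mono-≤ (p X 1≤X) (p′ X 1≤X) ⟩
    C * X ^ d + C′ * X ^ d′                 ≤⟨ +-mono-≤
      (*-monoʳ-≤ C (^-monoʳ-≤ X {{>-nonZero 1≤X}} (m≤m+n d d′)))
      (*-monoʳ-≤ C′ (^-monoʳ-≤ X {{>-nonZero 1≤X}} (m≤n+m d′ d))) ⟩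
    C * X ^ (d + d′) + C′ * X ^ (d + d′)    ≡⟨ *-distribʳ-+ (X ^ (d + d′)) C C′ ⟨
    (C + C′) * X ^ (d + d′)                 ∎
    where open ≤-Reasoning

  poly-* : ∀ {f g} → Polynomial f → Polynomial g → Polynomial (λ X → f X * g X)
  poly-* {f} {g} (C , d , p) (C′ , d′ , p′) = C * C′ , d + d′ , λ X 1≤X → begin
    f X * g X                       ≤⟨ *-mono-≤ (p X 1≤X) (p′ X 1≤X) ⟩
    (C * X ^ d) * (C′ * X ^ d′)     ≡⟨ [m*n]*[o*p]≡[m*o]*[n*p] C (X ^ d) C′ (X ^ d′) ⟩
    (C * C′) * (X ^ d * X ^ d′)     ≡⟨ cong (C * C′ *_) (^-distribˡ-+-* X d d′) ⟨
    (C * C′) * X ^ (d + d′)         ∎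
    where open ≤-Reasoning

  cost-poly  : ∀ {G k} (e : Expr G k) → Polynomial (cost e)
  costs-poly : ∀ {G k r} (es : Vec (Expr G k) r) → Polynomial (costs es)

  cost-poly (lit v)      = poly-const 1
  cost-poly (glob g)     = poly-const 2
  cost-poly (var x)      = poly-const 2
  cost-poly (a ⊕ b)      = poly-+ (cost-poly a) (poly-+ (cost-poly b) (poly-const 1))
  cost-poly (a ⊖ b)      = poly-+ (cost-poly a) (poly-+ (cost-poly b) (poly-const 1))
  cost-poly (read r a)   = poly-+ (cost-poly a) (poly-const 1)
  cost-poly (ifnz c a b) =
    poly-+ (cost-poly c) (poly-+ (poly-const 1) (poly-+ (cost-poly a) (cost-poly b)))
  cost-poly (loop g a b) = poly-+ (cost-poly a)
    (poly-+ (poly-const 4) (poly-* poly-id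
      (poly-+ (poly-const 1) (poly-+ (cost-poly b) (poly-const 5)))))
  cost-poly (call f es)  = poly-+ (costs-poly es) (poly-+ (cost-poly f) (poly-const 2))

  costs-poly []       = poly-const 1
  costs-poly (e ∷ es) = poly-+ (cost-poly e) (costs-poly es)

  costStmt-poly : ∀ {G} (c : Stmt G) → Polynomial (costStmt c)
  costStmt-poly (set g e)    = poly-+ (cost-poly e) (poly-const 2)
  costStmt-poly (fill a g e) = poly-+ (poly-const 4)
    (poly-* poly-id (poly-+ (poly-const 1) (poly-+ (cost-poly e) (poly-const 4))))

-- Sums, minimisers, digits and bottleneck paths

module Arithmetic where

  open Language using (iter; choose)
  open import Data.Nat.DivMod
  open import Data.Nat.Divisibility using (n∣m*n)
  open import Data.Nat.Tactic.RingSolver using (solve-∀)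
  open import Data.Product.Base using (∃; _×_; _,_)
  open import Data.Sum.Base using (_⊎_; inj₁; inj₂)
  open import Function.Base using (_∘_)
  open import Relation.Nullary.Negation.Core using (contradiction)

  iter-cong : ∀ {A : Set} n {f g : ℕ → A → A} {a b} → a ≡ b →
              (∀ i x → i < n → f i x ≡ g i x) → iter n f a ≡ iter n g b
  iter-cong zero    a≡b eq = a≡b
  iter-cong (suc n) {f} {g} a≡b eq = trans
    (eq n _ ≤-refl)
    (cong (g n) (iter-cong n a≡b λ i x i<n → eq i x (m≤n⇒m≤1+n i<n)))

  iter-shift : ∀ {A : Set} n (f : A → A) a → iter (suc n) (λ _ → f) a ≡ iter n (λ _ → f) (f a)
  iter-shift zero    f a = refl
  iter-shift (suc n) f a = cong f (iter-shift n f a)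

  sumTo : ℕ → (ℕ → ℕ) → ℕ
  sumTo n f = iter n (λ i acc → acc + f i) 0

  sumTo-cong : ∀ n {f g} → (∀ i → i < n → f i ≡ g i) → sumTo n f ≡ sumTo n g
  sumTo-cong n eq = iter-cong n refl λ i x i<n → cong (x +_) (eq i i<n)

  sumTo-mono : ∀ n {f g} → (∀ i → i < n → f i ≤ g i) → sumTo n f ≤ sumTo n g
  sumTo-mono zero    le = z≤n
  sumTo-mono (suc n) le =
    +-mono-≤ (sumTo-mono n λ i i<n → le i (m≤n⇒m≤1+n i<n)) (le n ≤-refl)

  sumTo-* : ∀ n c f → sumTo n (λ i → c * f i) ≡ c * sumTo n f
  sumTo-* zero    c f = sym (*-zeroʳ c)
  sumTo-* (suc n) c f =
    trans (cong (_+ c * f n) (sumTo-* n c f)) (sym (*-distribˡ-+ c (sumTo n f) (f n)))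

  sumTo-affine : ∀ n c d f → sumTo n (λ i → c * f i + d) ≡ c * sumTo n f + n * d
  sumTo-affine zero    c d f = sym (trans (+-identityʳ _) (*-zeroʳ c))
  sumTo-affine (suc n) c d f = trans (cong (_+ (c * f n + d)) (sumTo-affine n c d f))
    (lemma c d (sumTo n f) (f n) (n * d))
    where
    lemma : ∀ c d s x y → c * s + y + (c * x + d) ≡ c * (s + x) + (d + y)
    lemma = solve-∀

  sumTo-prefix : ∀ {m n} f → m ≤ n → sumTo m f ≤ sumTo n f
  sumTo-prefix {n = zero}  f z≤n = z≤n
  sumTo-prefix {n = suc n} f m≤1+n with m≤n⇒m<n∨m≡n m≤1+n
  ... | inj₁ m<1+n = m≤n⇒m≤n+o (f n) (sumTo-prefix f (s≤s⁻¹ m<1+n))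
  ... | inj₂ refl  = ≤-refl

  sumTo-zero : ∀ n f → (∀ i → i < n → f i ≡ 0) → sumTo n f ≡ 0
  sumTo-zero zero    f eq = refl
  sumTo-zero (suc n) f eq =
    cong₂ _+_ (sumTo-zero n f λ i i<n → eq i (m≤n⇒m≤1+n i<n)) (eq n ≤-refl)

  sumTo-zero⁻¹ : ∀ n f → sumTo n f ≡ 0 → ∀ i → i < n → f i ≡ 0
  sumTo-zero⁻¹ (suc n) f eq i i<1+n with m≤n⇒m<n∨m≡n (s≤s⁻¹ i<1+n)
  ... | inj₁ i<n  = sumTo-zero⁻¹ n f (m+n≡0⇒m≡0 _ eq) i i<n
  ... | inj₂ refl = m+n≡0⇒n≡0 (sumTo n f) eq

  sumTo-head : ∀ n f → sumTo (suc n) f ≡ f 0 + sumTo n (f ∘ suc)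
  sumTo-head zero    f = +-comm 0 (f 0)
  sumTo-head (suc n) f = trans (cong (_+ f (suc n)) (sumTo-head n f)) (+-assoc (f 0) _ _)

  -- A fold that the machine can imitate literally: the truncated difference is nonzero exactly if i
  -- is strictly better. The initial candidate 0 lies in range only if there is one, hence `0 < n`
  -- in `argmin-<`.
  argmin : ℕ → (ℕ → ℕ) → ℕ
  argmin n f = iter n (λ i acc → choose (f acc ∸ f i) i acc) 0

  choose-min : (f : ℕ → ℕ) (i a : ℕ) → let b = choose (f a ∸ f i) i a in
               f b ≤ f i × f b ≤ f a × (b ≡ i ⊎ b ≡ a)
  choose-min f i a with f a ∸ f i in eq
  ... | zero  = m∸n≡0⇒m≤n eq , ≤-refl , inj₂ refl
  ... | suc d = ≤-refl , <⇒≤ (∸≡suc⇒> eq) , inj₁ refl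
    where
    ∸≡suc⇒> : ∀ {x y d} → x ∸ y ≡ suc d → y < x
    ∸≡suc⇒> eq = ≰⇒> λ x≤y → contradiction (trans (sym eq) (m≤n⇒m∸n≡0 x≤y)) λ ()

  argmin-minimal : ∀ n (f : ℕ → ℕ) i → i < n → f (argmin n f) ≤ f i
  argmin-minimal (suc n) f i i<1+n with choose-min f n (argmin n f) | m≤n⇒m<n∨m≡n (s≤s⁻¹ i<1+n)
  ... | _ , le , _ | inj₁ i<n  = ≤-trans le (argmin-minimal n f i i<n)
  ... | le , _ , _ | inj₂ refl = le

  argmin-< : ∀ n (f : ℕ → ℕ) → 0 < n → argmin n f < n
  argmin-< n@(suc _) f _ = s≤s (bound n ≤-refl)
    where
    bound : ∀ k → k ≤ n → argmin k f ≤ pred n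
    bound zero    _   = z≤n
    bound (suc k) k<n with choose-min f k (argmin k f)
    ... | _ , _ , inj₁ eq rewrite eq = s≤s⁻¹ k<n
    ... | _ , _ , inj₂ eq rewrite eq = bound k (<⇒≤ k<n)

  -- Digit s of x in base `suc R`, least significant first. The parameter is the largest digit, so
  -- that the base is visibly nonzero.
  digit : ℕ → ℕ → ℕ → ℕ
  digit R x s = iter s (λ _ y → y / suc R) x % suc R

  digit-≤ : ∀ R x s → digit R x s ≤ R
  digit-≤ R x s = s≤s⁻¹ (m%n<n (iter s _ x) (suc R))

  [m+kn]/n≡k : ∀ {m} k n .{{_ : NonZero n}} → m < n → (m + k * n) / n ≡ k
  [m+kn]/n≡k {m} k n m<n = trans (+-distrib-/-∣ʳ m (n∣m*n k))
    (cong₂ _+_ (m<n⇒m/n≡0 m<n) (m*n/n≡m k n))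

  [m+kn]%n≡m : ∀ {m} k n .{{_ : NonZero n}} → m < n → (m + k * n) % n ≡ m
  [m+kn]%n≡m {m} k n m<n = trans ([m+kn]%n≡m%n m k n) (m<n⇒m%n≡m m<n)

  -- Horner's rule: the code of the shifted sequence, times the base, plus the digit at 0.
  digits-onto : ∀ R L (v : ℕ → ℕ) → (∀ s → s < L → v s ≤ R) →
                ∃ λ x → x < suc R ^ L × (∀ s → s < L → digit R x s ≡ v s)
  digits-onto R zero    v le = 0 , s≤s z≤n , λ _ ()
  digits-onto R (suc L) v le with digits-onto R L (v ∘ suc) (λ s s<L → le (suc s) (s≤s s<L))
  ... | x , x< , eq = v 0 + x * suc R , bound , agree
    where
    v0<B : v 0 < suc R
    v0<B = s≤s (le 0 (s≤s z≤n))
    bound : v 0 + x * suc R < suc R ^ suc L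
    bound = begin-strict
      v 0 + x * suc R    <⟨ +-monoˡ-< (x * suc R) v0<B ⟩
      suc x * suc R      ≤⟨ *-monoˡ-≤ (suc R) x< ⟩
      suc R ^ L * suc R  ≡⟨ *-comm (suc R ^ L) (suc R) ⟩
      suc R ^ suc L      ∎
      where open ≤-Reasoning
    agree : ∀ s → s < suc L → digit R (v 0 + x * suc R) s ≡ v s
    agree zero    _         = [m+kn]%n≡m x (suc R) v0<B
    agree (suc s) (s≤s s<L) = trans
      (cong (_% suc R) (trans (iter-shift s (_/ suc R) _)
        (cong (iter s (λ _ y → y / suc R)) ([m+kn]/n≡k x (suc R) v0<B))))
      (eq s s<L)

  -- The cheapest way to go from node x through r further layers, where the cost of a
  -- path is that of its most expensive edge.
  module Bottleneck (n N : ℕ) (edge : ℕ → ℕ → ℕ → ℕ) where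

    step : (ℕ → ℕ) → ℕ → ℕ → ℕ → ℕ
    step V j x y = edge j x y ⊔ V y

    value : ℕ → ℕ → ℕ
    value zero    x = 0
    value (suc r) x = step (value r) (n ∸ suc r) x (argmin N (step (value r) (n ∸ suc r) x))

    -- Successors are not stored with the values: each is recovered by minimising again over the
    -- same candidates.
    path : ℕ → ℕ
    path zero    = argmin N (value n)
    path (suc j) = argmin N (step (value (n ∸ suc j)) j (path j))

    path-< : 0 < N → ∀ j → path j < N
    path-< 0<N zero    = argmin-< N (value n) 0<N
    path-< 0<N (suc j) = argmin-< N (step (value (n ∸ suc j)) j (path j)) 0<N

    module _ (ξ : ℕ → ℕ) (b : ℕ) (ξ<N : ∀ j → j ≤ n → ξ j < N)
             (cheap : ∀ j → j < n → edge j (ξ j) (ξ (suc j)) ≤ b) where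

      -- Induction on the remaining layers: ξ (suc j) is one of the candidates at ξ j, and the
      -- minimum is no worse.
      value-≤ : ∀ r j → j + r ≡ n → value r (ξ j) ≤ b
      value-≤ zero    j eq = z≤n
      value-≤ (suc r) j eq = subst
        (λ i → step (value r) i (ξ j) (argmin N (step (value r) i (ξ j))) ≤ b)
        (sym (trans (cong (_∸ suc r) (sym eq)) (m+n∸n≡m j (suc r))))
        (≤-trans (argmin-minimal N (step (value r) j (ξ j)) (ξ (suc j)) (ξ<N (suc j) j<n))
          (⊔-lub (cheap j j<n) (value-≤ r (suc j) eq′)))
        where
        eq′ : suc j + r ≡ n
        eq′ = trans (sym (+-suc j r)) eq
        j<n : j < n
        j<n = subst (j <_) eq′ (s≤s (m≤m+n j r))

      path-value : ∀ j → j ≤ n → value (n ∸ j) (path j) ≤ b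
      path-step : ∀ j → j < n →
                  step (value (n ∸ suc j)) j (path j) (path (suc j)) ≤ b

      path-value zero    _   =
        ≤-trans (argmin-minimal N (value n) (ξ 0) (ξ<N 0 z≤n)) (value-≤ n 0 refl)
      path-value (suc j) j<n = m⊔n≤o⇒n≤o _ _ (path-step j j<n)

      -- Once `n ∸ j` is a successor, `value` at `path j` unfolds to the step to its minimiser,
      -- which is `path (suc j)` after rewriting the indices.
      path-step j j<n with n ∸ j in eq | path-value j (<⇒≤ j<n)
      ... | zero  | _  = contradiction eq (m>n⇒m∸n≢0 j<n)
      ... | suc r | le = subst₂ (λ r i → step (value r) i (path j)
                                    (argmin N (step (value r) i (path j))) ≤ b) r≡ i≡ le
        where
        r≡ : r ≡ n ∸ suc j
        r≡ = sym (trans (sym (pred[m∸n]≡m∸[1+n] n j)) (cong pred eq))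
        i≡ : n ∸ suc r ≡ j
        i≡ = trans (cong (n ∸_) (sym eq)) (m∸[m∸n]≡n (<⇒≤ j<n))

      path-cheap : ∀ j → j < n → edge j (path j) (path (suc j)) ≤ b
      path-cheap j j<n = m⊔n≤o⇒m≤o _ _ (path-step j j<n)

-- Thresholds, and the rounded dynamic program and its approximation guarantee

module Scheduling where

  open Language using (choose)
  open Arithmetic
  open import Data.Nat.DivMod
  open import Data.Nat.Tactic.RingSolver using (solve-∀)
  open import Data.Product.Base using (∃; _×_; _,_; proj₁; proj₂)
  open import Data.Sum.Base using (_⊎_; inj₁; inj₂)
  open import Function.Base using (_∘_)
  open import Relation.Nullary.Decidable.Core using (yes; no)
  open import Relation.Nullary.Negation.Core using (contradiction)

  -- Total in the divisor, because loads are divided by deadlines, which are known to be positive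
  -- only on actual days.
  floorDiv : ℕ → ℕ → ℕ
  floorDiv a zero      = 0
  floorDiv a b@(suc _) = a / b

  floorDiv-lower : ∀ a b → floorDiv a b * b ≤ a
  floorDiv-lower a zero      = z≤n
  floorDiv-lower a b@(suc _) = m/n*n≤m a b

  floorDiv-upper : ∀ a b → 0 < b → a ≤ suc (floorDiv a b) * b
  floorDiv-upper a b@(suc _) _ = begin
    a                    ≡⟨ m≡m%n+[m/n]*n a b ⟩
    a % b + a / b * b    ≤⟨ +-monoˡ-≤ (a / b * b) (m%n≤n a b) ⟩
    suc (a / b) * b      ∎
    where open ≤-Reasoning

  floorDiv-≤ : ∀ {a} b c → a ≤ c * b → floorDiv a b ≤ c
  floorDiv-≤ zero      c le = z≤n
  floorDiv-≤ b@(suc _) c le = ≤-trans (/-monoˡ-≤ b le) (≤-reflexive (m*n/n≡m c b))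

  -- A scan downwards from `T`, whose own value is not tested; `least-reaches` takes it as a
  -- hypothesis. The scan ends at 0 or right above an index that fails, which is `least-tight`.
  least : ℕ → (ℕ → ℕ) → ℕ → ℕ
  least zero    f b = 0
  least (suc T) f b with b ≤? f T
  ... | yes _ = least T f b
  ... | no  _ = suc T

  least-≤ : ∀ T (f : ℕ → ℕ) b → least T f b ≤ T
  least-≤ zero    f b = z≤n
  least-≤ (suc T) f b with b ≤? f T
  ... | yes _ = m≤n⇒m≤1+n (least-≤ T f b)
  ... | no  _ = ≤-refl

  least-reaches : ∀ T (f : ℕ → ℕ) b → b ≤ f T → b ≤ f (least T f b)
  least-reaches zero    f b le = le
  least-reaches (suc T) f b le with b ≤? f T
  ... | yes le′ = least-reaches T f b le′
  ... | no  _   = le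

  least-tight : ∀ T (f : ℕ → ℕ) b → least T f b ≡ 0 ⊎ ∃ λ k → least T f b ≡ suc k × f k < b
  least-tight zero    f b = inj₁ refl
  least-tight (suc T) f b with b ≤? f T
  ... | yes _ = least-tight T f b
  ... | no ¬le = inj₂ (T , refl , ≰⇒> ¬le)

  choose-* : ∀ c s r p → choose c 0 (s * (r * p)) ≡ s * (r * choose c 0 p)
  choose-* zero    s r p = refl
  choose-* (suc c) s r p = sym (trans (cong (s *_) (*-zeroʳ r)) (*-zeroʳ s))

  module Threshold (e′ : ℕ) where

    e : ℕ
    e = suc e′

    -- The thresholds double every e steps and are equidistant in between, so that each
    -- is at most 1 + 1/e times its predecessor.
    threshold : ℕ → ℕ
    threshold k = 2 ^ (k / e) * (e + k % e)

    threshold-at : ∀ q {r} → r < e → threshold (r + q * e) ≡ 2 ^ q * (e + r)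
    threshold-at q r<e = cong₂ (λ a b → 2 ^ a * (e + b)) ([m+kn]/n≡k q e r<e) ([m+kn]%n≡m q e r<e)

    threshold-top : ∀ ℓ → threshold (ℓ * e) ≡ 2 ^ ℓ * e
    threshold-top ℓ = trans (threshold-at ℓ (s≤s z≤n)) (cong (2 ^ ℓ *_) (+-identityʳ e))

    -- One formula covers the carry as well: where a doubling interval ends, 2^q (e + e) is the
    -- first threshold of the next one.
    threshold-suc : ∀ k → threshold (suc k) ≡ 2 ^ (k / e) * (e + suc (k % e))
    threshold-suc k with m≤n⇒m<n∨m≡n (m%n<n k e)
    ... | inj₁ r<e = trans (cong (threshold ∘ suc) (m≡m%n+[m/n]*n k e)) (threshold-at (k / e) r<e)
    ... | inj₂ r≡e = begin
      threshold (suc k)                            ≡⟨ cong (threshold ∘ suc) (m≡m%n+[m/n]*n k e) ⟩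
      threshold (suc (k % e) + k / e * e)          ≡⟨ cong (λ r → threshold (r + k / e * e)) r≡e ⟩
      threshold (suc (k / e) * e)                  ≡⟨ threshold-top (suc (k / e)) ⟩
      2 * 2 ^ (k / e) * e                          ≡⟨ lemma (2 ^ (k / e)) e ⟩
      2 ^ (k / e) * (e + e)                        ≡⟨ cong (λ r → 2 ^ (k / e) * (e + r)) r≡e ⟨
      2 ^ (k / e) * (e + suc (k % e))              ∎
      where
      open ≡-Reasoning
      lemma : ∀ x y → 2 * x * y ≡ x * (y + y)
      lemma = solve-∀

    -- With r = k % e, the gap between (e + 1)(e + r) and e (e + r + 1) is exactly r.
    threshold-growth : ∀ k → e * threshold (suc k) ≤ suc e * threshold k
    threshold-growth k = begin
      e * threshold (suc k)                       ≡⟨ cong (e *_) (threshold-suc k) ⟩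
      e * (2 ^ (k / e) * (e + suc (k % e)))       ≤⟨ m≤m+n _ (2 ^ (k / e) * (k % e)) ⟩
      e * (2 ^ (k / e) * (e + suc (k % e))) + 2 ^ (k / e) * (k % e)
                                                  ≡⟨ lemma e (2 ^ (k / e)) (k % e) ⟩
      suc e * threshold k                         ∎
      where
      open ≤-Reasoning
      lemma : ∀ x y r → x * (y * (x + suc r)) + y * r ≡ suc x * (y * (x + r))
      lemma = solve-∀

    threshold-mono : ∀ {j k} → j ≤ k → threshold j ≤ threshold k
    threshold-mono {k = zero}  z≤n = ≤-refl
    threshold-mono {j} {suc k} j≤1+k with m≤n⇒m<n∨m≡n j≤1+k
    ... | inj₂ refl  = ≤-refl
    ... | inj₁ j<1+k = begin
      threshold j                        ≤⟨ threshold-mono {j} {k} (s≤s⁻¹ j<1+k) ⟩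
      2 ^ (k / e) * (e + k % e)          ≤⟨ *-monoʳ-≤ (2 ^ (k / e)) (+-monoʳ-≤ e (n≤1+n (k % e))) ⟩
      2 ^ (k / e) * (e + suc (k % e))    ≡⟨ threshold-suc k ⟨
      threshold (suc k)                  ∎
      where open ≤-Reasoning

    threshold>0 : ∀ k → 0 < threshold k
    threshold>0 k = *-mono-≤ (m^n>0 2 (k / e)) (m≤m+n 1 (e′ + k % e))

  module Algorithm (n m e′ ℓ : ℕ) (p : ℕ → ℕ → ℕ) where

    open Threshold e′ public

    -- Each day takes one digit per level and one more for the level of the next client. In
    -- `resolution`, `n * e` makes n rounding units at most 1/e of a deadline, and `levels` lets a
    -- level number fit into a digit. `scale` is the top threshold, so completion times are
    -- multiplied by `scale` before they are compared with a `deadline`, and the top deadline stands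
    -- for the whole day's work.
    top levels width positions resolution states scale : ℕ
    top        = ℓ * e
    levels     = suc top
    width      = suc levels
    positions  = m * width
    resolution = n * e + levels
    states     = suc resolution ^ positions
    scale      = 2 ^ ℓ * e

    total : ℕ → ℕ
    total i = sumTo n (p i)

    deadline : ℕ → ℕ → ℕ
    deadline i k = threshold k * total i

    -- A state x records, for every day i and level k, the load that the earlier clients
    -- put on the deadlines up to level k, in units of deadline i k / (scale * resolution),
    -- and the levels assigned to the next client.
    loadOf : ℕ → ℕ → ℕ → ℕ
    loadOf x i k = digit resolution x (i * width + k)

    levelOf : ℕ → ℕ → ℕ
    levelOf x i = digit resolution x (i * width + levels)

    -- Positive iff the load in x, with the job of client j added when its level is at most k,
    -- exceeds the load in y by more than one unit. That unit is what y may lose by rounding down.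
    -- `violation` adds up such excesses, a sum of naturals acting as a conjunction of constraints.
    overload : ℕ → ℕ → ℕ → ℕ → ℕ → ℕ
    overload j x y i k =
      choose (levelOf x i ∸ k) 0 (scale * (resolution * p i j)) + loadOf x i k * deadline i k
      ∸ suc (loadOf y i k) * deadline i k

    violation : ℕ → ℕ → ℕ → ℕ
    violation j x y = sumTo m λ i → (levelOf x i ∸ top) + sumTo levels (overload j x y i)

    budget : ℕ → ℕ
    budget x = sumTo m λ i → deadline i (levelOf x i)

    -- The largest budget that valid levels can have: all of them at `top`. Hence `suc limit` serves
    -- as the infinite cost of a forbidden edge.
    limit : ℕ
    limit = scale * sumTo m total

    edge : ℕ → ℕ → ℕ → ℕ
    edge j x y = choose (violation j x y) (suc limit) (budget x)

    open Bottleneck n states edge public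

    states>0 : 0 < states
    states>0 = m^n>0 (suc resolution) positions

    assigned : ℕ → ℕ → ℕ
    assigned i j = levelOf (path j) i

    loadUpTo : (ℕ → ℕ → ℕ) → ℕ → ℕ → ℕ → ℕ
    loadUpTo κ i k t = sumTo t λ j → choose (κ i j ∸ k) 0 (p i j)

    position< : ∀ {i k} → i < m → k ≤ levels → i * width + k < positions
    position< {i} {k} i<m k≤ = begin-strict
      i * width + k      <⟨ +-monoʳ-< (i * width) (s≤s k≤) ⟩
      i * width + width  ≡⟨ +-comm (i * width) width ⟩
      suc i * width      ≤⟨ *-monoˡ-≤ width i<m ⟩
      positions          ∎
      where open ≤-Reasoning

    module _ {j x y} (ok : violation j x y ≡ 0) {i} (i<m : i < m) where

      private
        zero-at : (levelOf x i ∸ top) + sumTo levels (overload j x y i) ≡ 0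
        zero-at = sumTo-zero⁻¹ m _ ok i i<m

      level-valid : levelOf x i ≤ top
      level-valid = m∸n≡0⇒m≤n (m+n≡0⇒m≡0 _ zero-at)

      load-valid : ∀ {k} → k ≤ top →
        choose (levelOf x i ∸ k) 0 (scale * (resolution * p i j)) + loadOf x i k * deadline i k
        ≤ suc (loadOf y i k) * deadline i k
      load-valid k≤top = m∸n≡0⇒m≤n
        (sumTo-zero⁻¹ levels _ (m+n≡0⇒n≡0 (levelOf x i ∸ top) zero-at) _ (s≤s k≤top))

    edge-valid : ∀ j x y → edge j x y ≤ limit → violation j x y ≡ 0 × budget x ≡ edge j x y
    edge-valid j x y le with violation j x y
    ... | zero  = refl , refl
    ... | suc _ = contradiction le 1+n≰n

    module Sound (ok : ∀ j → j < n → violation j (path j) (path (suc j)) ≡ 0) where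

      -- Every step rounds by less than one unit, n steps by less than 1/e of the capacity.
      accumulated : ∀ {i k} → i < m → k ≤ top → ∀ t → t ≤ n →
        scale * (resolution * loadUpTo assigned i k t) ≤ (loadOf (path t) i k + t) * deadline i k
      accumulated {i} {k} i<m k≤top zero _ =
        ≤-trans (≤-reflexive (trans (cong (scale *_) (*-zeroʳ resolution)) (*-zeroʳ scale))) z≤n
      accumulated {i} {k} i<m k≤top (suc t) t<n = begin
        scale * (resolution * (loadUpTo assigned i k t + c))
          ≡⟨ lemma₁ scale resolution (loadUpTo assigned i k t) c ⟩
        scale * (resolution * loadUpTo assigned i k t) + scale * (resolution * c)
          ≤⟨ +-monoˡ-≤ _ (accumulated i<m k≤top t (<⇒≤ t<n)) ⟩
        (loadOf (path t) i k + t) * d + scale * (resolution * c)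
          ≡⟨ lemma₂ (loadOf (path t) i k) t d (scale * (resolution * c)) ⟩
        (scale * (resolution * c) + loadOf (path t) i k * d) + t * d
          ≡⟨ cong (λ z → z + loadOf (path t) i k * d + t * d)
               (choose-* (assigned i t ∸ k) scale resolution (p i t)) ⟨
        (choose (assigned i t ∸ k) 0 (scale * (resolution * p i t)) + loadOf (path t) i k * d) + t * d
          ≤⟨ +-monoˡ-≤ (t * d) (load-valid (ok t t<n) i<m k≤top) ⟩
        suc (loadOf (path (suc t)) i k) * d + t * d
          ≡⟨ lemma₃ (loadOf (path (suc t)) i k) t d ⟩
        (loadOf (path (suc t)) i k + suc t) * d
          ∎
        where
        open ≤-Reasoning
        d = deadline i k
        c = choose (assigned i t ∸ k) 0 (p i t)
        lemma₁ : ∀ s r x y → s * (r * (x + y)) ≡ s * (r * x) + s * (r * y)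
        lemma₁ = solve-∀
        lemma₂ : ∀ x t d y → (x + t) * d + y ≡ (y + x * d) + t * d
        lemma₂ = solve-∀
        lemma₃ : ∀ x t d → suc x * d + t * d ≡ (x + suc t) * d
        lemma₃ = solve-∀

      -- The last stored load is a digit, hence at most `resolution` units, which make up one
      -- deadline; the n rounding units add at most 1/e of it. The load stored in `path 0` is
      -- arbitrary, but a surplus there only tightens the later constraints.
      nearly-on-time : ∀ {i k} → i < m → k ≤ top →
        e * (scale * loadUpTo assigned i k n) ≤ suc e * deadline i k
      nearly-on-time {i} {k} i<m k≤top = *-cancelˡ-≤ resolution {{>-nonZero resolution>0}} (begin
        resolution * (e * (scale * assignedLoad))
          ≡⟨ lemma₁ resolution e scale assignedLoad ⟩
        e * (scale * (resolution * assignedLoad))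
          ≤⟨ *-monoʳ-≤ e (accumulated i<m k≤top n ≤-refl) ⟩
        e * ((loadOf (path n) i k + n) * d)
          ≤⟨ *-monoʳ-≤ e (*-monoˡ-≤ d (+-monoˡ-≤ n (digit-≤ resolution (path n) (i * width + k)))) ⟩
        e * ((resolution + n) * d)
          ≡⟨ lemma₂ e resolution n d ⟩
        resolution * (e * d) + n * e * d
          ≤⟨ +-monoʳ-≤ (resolution * (e * d)) (*-monoˡ-≤ d (m≤m+n (n * e) levels)) ⟩
        resolution * (e * d) + resolution * d
          ≡⟨ lemma₃ resolution e d ⟩
        resolution * (suc e * d)
          ∎)
        where
        open ≤-Reasoning
        d = deadline i k
        assignedLoad = loadUpTo assigned i k n
        resolution>0 : 0 < resolution
        resolution>0 = ≤-trans (s≤s z≤n) (m≤n+m levels (n * e))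
        lemma₁ : ∀ r e s x → r * (e * (s * x)) ≡ e * (s * (r * x))
        lemma₁ = solve-∀
        lemma₂ : ∀ e r n d → e * ((r + n) * d) ≡ r * (e * d) + n * e * d
        lemma₂ = solve-∀
        lemma₃ : ∀ r e d → r * (e * d) + r * d ≡ r * (suc e * d)
        lemma₃ = solve-∀

    -- The reference schedule enters only through its completion times `C`. `last-job` captures what
    -- makes them completion times: among the clients of level at most k, the one processed last
    -- finishes after all their work. `fine` puts the lowest deadline at 1/(m e) of a day's total or
    -- below.
    module Complete
      (fine : m * e ≤ 2 ^ ℓ) (C : ℕ → ℕ → ℕ) (K* : ℕ)
      (C≤total : ∀ i j → i < m → j < n → C i j ≤ total i)
      (total≤K* : ∀ i → i < m → total i ≤ K*)
      (C≤K* : ∀ j → j < n → sumTo m (λ i → C i j) ≤ K*)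
      (last-job : ∀ i (κ : ℕ → ℕ) k s b → i < m → (∀ j → j < n → κ j ≤ k → s * C i j ≤ b) →
                  s * sumTo n (λ j → choose (κ j ∸ k) 0 (p i j)) ≤ b)
      (total>0 : ∀ i → i < m → 0 < total i)
      where

      κ : ℕ → ℕ → ℕ
      κ i j = least top (deadline i) (scale * C i j)

      κ≤top : ∀ i j → κ i j ≤ top
      κ≤top i j = least-≤ top (deadline i) (scale * C i j)

      on-time : ∀ {i j} → i < m → j < n → scale * C i j ≤ deadline i (κ i j)
      on-time {i} {j} i<m j<n = least-reaches top (deadline i) (scale * C i j)
        (subst (λ u → scale * C i j ≤ u * total i) (sym (threshold-top ℓ))
          (*-monoʳ-≤ scale (C≤total i j i<m j<n)))

      -- At a positive level the preceding threshold was missed, so the growth bound applies. At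
      -- level 0 the deadline is a multiple of the day's total, which `K*` dominates; the additive
      -- term this leaves, summed over m days, is at most `scale * K*` by `fine`.
      deadline-tight : ∀ {i j} → i < m → j < n →
        e * deadline i (κ i j) ≤ suc e * scale * C i j + e * e * K*
      deadline-tight {i} {j} i<m j<n with least-tight top (deadline i) (scale * C i j)
      ... | inj₁ eq rewrite eq = begin
        e * (1 * (e + 0) * total i)               ≡⟨ lemma e (total i) ⟩
        e * e * total i                           ≤⟨ *-monoʳ-≤ (e * e) (total≤K* i i<m) ⟩
        e * e * K*                                ≤⟨ m≤n+m _ (suc e * scale * C i j) ⟩
        suc e * scale * C i j + e * e * K*        ∎
        where
        open ≤-Reasoning
        lemma : ∀ e t → e * (1 * (e + 0) * t) ≡ e * e * t
        lemma = solve-∀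
      ... | inj₂ (k , eq , lt) rewrite eq = begin
        e * (threshold (suc k) * total i)         ≡⟨ *-assoc e (threshold (suc k)) (total i) ⟨
        e * threshold (suc k) * total i           ≤⟨ *-monoˡ-≤ (total i) (threshold-growth k) ⟩
        suc e * threshold k * total i             ≡⟨ *-assoc (suc e) (threshold k) (total i) ⟩
        suc e * deadline i k                      ≤⟨ *-monoʳ-≤ (suc e) (<⇒≤ lt) ⟩
        suc e * (scale * C i j)                   ≡⟨ *-assoc (suc e) scale (C i j) ⟨
        suc e * scale * C i j                     ≤⟨ m≤m+n _ _ ⟩
        suc e * scale * C i j + e * e * K*        ∎
        where open ≤-Reasoning

      prefixLoad : ℕ → ℕ → ℕ → ℕ
      prefixLoad = loadUpTo κ

      units : ℕ → ℕ → ℕ → ℕ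
      units j i k = floorDiv (scale * (resolution * prefixLoad i k j)) (deadline i k)

      -- Clients of level at most k finish by deadline k, so by `last-job` their total work fits
      -- before it, and `resolution` units are one deadline.
      units-≤ : ∀ {j i} k → j ≤ n → i < m → units j i k ≤ resolution
      units-≤ {j} {i} k j≤n i<m = floorDiv-≤ (deadline i k) resolution (begin
        scale * (resolution * prefixLoad i k j)    ≡⟨ lemma scale resolution (prefixLoad i k j) ⟩
        resolution * (scale * prefixLoad i k j)    ≤⟨ *-monoʳ-≤ resolution (*-monoʳ-≤ scale
          (sumTo-prefix (λ j → choose (κ i j ∸ k) 0 (p i j)) j≤n)) ⟩
        resolution * (scale * prefixLoad i k n)    ≤⟨ *-monoʳ-≤ resolution
          (last-job i (κ i) k scale (deadline i k) i<m λ j′ j′<n κ≤k →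
            ≤-trans (on-time i<m j′<n) (*-monoˡ-≤ (total i) (threshold-mono κ≤k))) ⟩
        resolution * deadline i k            ∎)
        where
        open ≤-Reasoning
        lemma : ∀ s r x → s * (r * x) ≡ r * (s * x)
        lemma = solve-∀

      digitsOf : ℕ → ℕ → ℕ
      digitsOf j s = choose (levels ∸ s % width) (units j (s / width) (s % width)) (κ (s / width) j)

      digitsOf-≤ : ∀ j → j ≤ n → ∀ s → s < positions → digitsOf j s ≤ resolution
      digitsOf-≤ j j≤n s s< with levels ∸ s % width
      ... | zero  = ≤-trans (κ≤top (s / width) j) (≤-trans (n≤1+n top) (m≤n+m levels (n * e)))
      ... | suc _ = units-≤ (s % width) j≤n (m<n*o⇒m/o<n s<)

      ξ : ℕ → ℕ
      ξ j with j ≤? n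
      ... | yes j≤n = proj₁ (digits-onto resolution positions (digitsOf j) (digitsOf-≤ j j≤n))
      ... | no  _   = 0

      ξ-< : ∀ j → j ≤ n → ξ j < states
      ξ-< j j≤n with j ≤? n
      ... | yes j≤n′ = proj₁ (proj₂ (digits-onto resolution positions (digitsOf j) (digitsOf-≤ j j≤n′)))
      ... | no  j≰n  = contradiction j≤n j≰n

      ξ-digit : ∀ j → j ≤ n → ∀ {i k} → i < m → k ≤ levels →
                digit resolution (ξ j) (i * width + k) ≡ choose (levels ∸ k) (units j i k) (κ i j)
      ξ-digit j j≤n {i} {k} i<m k≤ with j ≤? n
      ... | no  j≰n  = contradiction j≤n j≰n
      ... | yes j≤n′ = trans
        (proj₂ (proj₂ (digits-onto resolution positions (digitsOf j) (digitsOf-≤ j j≤n′)))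
          (i * width + k) (position< i<m k≤))
        (trans (cong (digitsOf j) (+-comm (i * width) k))
          (cong₂ (λ q r → choose (levels ∸ r) (units j q r) (κ q j))
            ([m+kn]/n≡k i width (s≤s k≤)) ([m+kn]%n≡m i width (s≤s k≤))))

      ξ-level : ∀ j → j ≤ n → ∀ {i} → i < m → levelOf (ξ j) i ≡ κ i j
      ξ-level j j≤n {i} i<m = trans (ξ-digit j j≤n i<m ≤-refl)
        (cong (λ c → choose c (units j i levels) (κ i j)) (n∸n≡0 levels))

      ξ-load : ∀ j → j ≤ n → ∀ {i k} → i < m → k ≤ top → loadOf (ξ j) i k ≡ units j i k
      ξ-load j j≤n {i} {k} i<m k≤top = trans (ξ-digit j j≤n i<m (m≤n⇒m≤1+n k≤top))
        (cong (λ c → choose c (units j i k) (κ i j)) (+-∸-assoc 1 k≤top))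

      -- The floor in ξ j underestimates the exact prefix load and the floor in ξ (suc j) loses less
      -- than one unit, which is precisely the slack in `overload`.
      ξ-valid : ∀ j → j < n → violation j (ξ j) (ξ (suc j)) ≡ 0
      ξ-valid j j<n = sumTo-zero m _ λ i i<m → cong₂ _+_
        (m≤n⇒m∸n≡0 (≤-trans (≤-reflexive (ξ-level j (<⇒≤ j<n) i<m)) (κ≤top i j)))
        (sumTo-zero levels _ λ k k<levels → m≤n⇒m∸n≡0 (fits i k i<m (s≤s⁻¹ k<levels)))
        where
        open ≤-Reasoning
        lemma : ∀ s r x y → s * (r * y) + s * (r * x) ≡ s * (r * (x + y))
        lemma = solve-∀
        fits : ∀ i k → i < m → k ≤ top →
          choose (levelOf (ξ j) i ∸ k) 0 (scale * (resolution * p i j)) + loadOf (ξ j) i k * deadline i k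
          ≤ suc (loadOf (ξ (suc j)) i k) * deadline i k
        fits i k i<m k≤top rewrite ξ-level j (<⇒≤ j<n) i<m | ξ-load j (<⇒≤ j<n) i<m k≤top
          | ξ-load (suc j) j<n i<m k≤top = begin
          choose (κ i j ∸ k) 0 (scale * (resolution * p i j)) + units j i k * deadline i k
            ≤⟨ +-monoʳ-≤ _ (floorDiv-lower (scale * (resolution * prefixLoad i k j)) (deadline i k)) ⟩
          choose (κ i j ∸ k) 0 (scale * (resolution * p i j)) + scale * (resolution * prefixLoad i k j)
            ≡⟨ cong (_+ scale * (resolution * prefixLoad i k j)) (choose-* (κ i j ∸ k) scale resolution (p i j)) ⟩
          scale * (resolution * choose (κ i j ∸ k) 0 (p i j)) + scale * (resolution * prefixLoad i k j)
            ≡⟨ lemma scale resolution (prefixLoad i k j) (choose (κ i j ∸ k) 0 (p i j)) ⟩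
          scale * (resolution * prefixLoad i k (suc j))
            ≤⟨ floorDiv-upper _ (deadline i k) (*-mono-≤ (threshold>0 k) (total>0 i i<m)) ⟩
          suc (units (suc j) i k) * deadline i k
            ∎

      ξ-budget : ∀ j → j < n → budget (ξ j) ≡ sumTo m (λ i → deadline i (κ i j))
      ξ-budget j j<n = sumTo-cong m λ i i<m → cong (deadline i) (ξ-level j (<⇒≤ j<n) i<m)

      target : ℕ
      target = (2 + e) * scale * K*

      -- Both bounds pass to the path that is found: `limit` forces its edges to be valid, `target`
      -- bounds its budgets.
      ξ-cheap : ∀ j → j < n → edge j (ξ j) (ξ (suc j)) ≤ limit ⊓ floorDiv target e
      ξ-cheap j j<n rewrite ξ-valid j j<n | ξ-budget j j<n = ⊓-glb
        (≤-trans
          (sumTo-mono m λ i _ → *-monoˡ-≤ (total i)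
            (≤-trans (threshold-mono (κ≤top i j)) (≤-reflexive (threshold-top ℓ))))
          (≤-reflexive (sumTo-* m scale total)))
        (≤-trans (≤-reflexive (sym (m*n/n≡m (sumTo m (λ i → deadline i (κ i j))) e)))
          (/-monoˡ-≤ e (begin
            sumTo m (λ i → deadline i (κ i j)) * e        ≡⟨ *-comm _ e ⟩
            e * sumTo m (λ i → deadline i (κ i j))        ≡⟨ sumTo-* m e _ ⟨
            sumTo m (λ i → e * deadline i (κ i j))        ≤⟨ sumTo-mono m (λ i i<m → deadline-tight i<m j<n) ⟩
            sumTo m (λ i → suc e * scale * C i j + e * e * K*)
                                                          ≡⟨ sumTo-affine m (suc e * scale) (e * e * K*) (λ i → C i j) ⟩
            suc e * scale * sumTo m (λ i → C i j) + m * (e * e * K*)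
                                                          ≤⟨ +-mono-≤ (*-monoʳ-≤ (suc e * scale) (C≤K* j j<n)) (≤-reflexive (lemma₁ m e K*)) ⟩
            suc e * scale * K* + m * e * e * K*           ≤⟨ +-monoʳ-≤ (suc e * scale * K*) (*-monoˡ-≤ K* (*-monoˡ-≤ e fine)) ⟩
            suc e * scale * K* + scale * K*               ≡⟨ lemma₂ e scale K* ⟩
            target                                        ∎)))
        where
        open ≤-Reasoning
        lemma₁ : ∀ m e k → m * (e * e * k) ≡ m * e * e * k
        lemma₁ = solve-∀
        lemma₂ : ∀ e s k → suc e * s * k + s * k ≡ (2 + e) * s * k
        lemma₂ = solve-∀

      path-within : ∀ j → j < n → edge j (path j) (path (suc j)) ≤ limit ⊓ floorDiv target e
      path-within = path-cheap ξ _ ξ-< ξ-cheap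

      path-valid : ∀ j → j < n → violation j (path j) (path (suc j)) ≡ 0 × budget (path j) ≤ floorDiv target e
      path-valid j j<n =
        let ok , eq = edge-valid j (path j) (path (suc j)) (m≤n⊓o⇒m≤n limit _ (path-within j j<n))
        in ok , ≤-trans (≤-reflexive eq) (m≤n⊓o⇒m≤o limit _ (path-within j j<n))

      open Sound (λ j j<n → proj₁ (path-valid j j<n))

      near-optimal : ∀ j → j < n →
        e * sumTo m (λ i → loadUpTo assigned i (assigned i j) n) ≤ (5 + e) * K*
      near-optimal j j<n = *-cancelˡ-≤ (e * scale) {{>-nonZero (*-mono-≤ (s≤s (z≤n {e′})) scale>0)}} (begin
        e * scale * (e * S)                     ≡⟨ lemma₁ e scale S ⟩
        e * (e * scale * S)                     ≡⟨ cong (e *_) (sumTo-* m (e * scale) _) ⟨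
        e * sumTo m (λ i → e * scale * loadUpTo assigned i (assigned i j) n)
          ≤⟨ *-monoʳ-≤ e (sumTo-mono m λ i i<m → ≤-trans (≤-reflexive (*-assoc e scale _))
               (nearly-on-time i<m (level-valid (proj₁ (path-valid j j<n)) i<m))) ⟩
        e * sumTo m (λ i → suc e * deadline i (assigned i j))
          ≡⟨ cong (e *_) (sumTo-* m (suc e) _) ⟩
        e * (suc e * budget (path j))           ≤⟨ *-monoʳ-≤ e (*-monoʳ-≤ (suc e) (proj₂ (path-valid j j<n))) ⟩
        e * (suc e * (target / e))              ≡⟨ lemma₂ e (target / e) ⟩
        suc e * (target / e * e)                ≤⟨ *-monoʳ-≤ (suc e) (m/n*n≤m target e) ⟩
        -- (e + 1)(e + 2) falls short of e (e + 5) by 2 (e - 1) = 2 e′.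
        suc e * target                          ≤⟨ m≤m+n _ (2 * e′ * scale * K*) ⟩
        suc e * target + 2 * e′ * scale * K*    ≡⟨ lemma₃ e′ scale K* ⟩
        e * scale * ((5 + e) * K*)              ∎)
        where
        open ≤-Reasoning
        S = sumTo m (λ i → loadUpTo assigned i (assigned i j) n)
        scale>0 : 0 < scale
        scale>0 = *-mono-≤ (m^n>0 2 ℓ) (s≤s (z≤n {e′}))
        lemma₁ : ∀ e s x → e * s * (e * x) ≡ e * (e * s * x)
        lemma₁ = solve-∀
        lemma₂ : ∀ e x → e * (suc e * x) ≡ suc e * (x * e)
        lemma₂ = solve-∀
        lemma₃ : ∀ f s k → suc (suc f) * ((2 + suc f) * s * k) + 2 * f * s * k ≡ suc f * s * ((5 + suc f) * k)
        lemma₃ = solve-∀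

-- The algorithm as expressions, and their evaluation

module Code where

  open Language
  open Arithmetic
  open Scheduling
  open import Data.Fin.Base using (Fin; zero; suc)
  open import Data.Fin using (#_)
  open import Data.Nat.DivMod
  open import Data.Product.Base using (_×_; _,_; proj₁)
  open import Data.Sum.Base using (inj₁; inj₂)
  open import Data.Vec.Base using (Vec; []; _∷_)
  open import Relation.Nullary.Negation.Core using (contradiction)

  G : ℕ
  G = 14

  v₀ : ∀ {k} → Expr G (1 + k)
  v₀ = var zero
  v₁ : ∀ {k} → Expr G (2 + k)
  v₁ = var (suc zero)
  v₂ : ∀ {k} → Expr G (3 + k)
  v₂ = var (suc (suc zero))
  v₃ : ∀ {k} → Expr G (4 + k)
  v₃ = var (suc (suc (suc zero)))
  v₄ : ∀ {k} → Expr G (5 + k)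
  v₄ = var (suc (suc (suc (suc zero))))
  v₅ : ∀ {k} → Expr G (6 + k)
  v₅ = var (suc (suc (suc (suc (suc zero)))))
  v₆ : ∀ {k} → Expr G (7 + k)
  v₆ = var (suc (suc (suc (suc (suc (suc zero))))))

  clients# days# e# product# ℓ# top# levels# positions# resolution# states# cells# scale# entries# cap# : Fin G
  clients#    = # 0
  days#       = # 1
  e#          = # 2
  product#    = # 3
  ℓ#          = # 4
  top#        = # 5
  levels#     = # 6
  positions#  = # 7
  resolution# = # 8
  states#     = # 9
  cells#      = # 10
  scale#      = # 11
  entries#    = # 12
  cap#        = # 13

  -- Arrays: 0 the processing times, 1 the output, 2 the values and 3 the optimal path of
  -- the dynamic program.

  widthE baseE : ∀ {k} → Expr G k
  widthE = lit 1 ⊕ glob levels#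
  baseE  = lit 1 ⊕ glob resolution#

  opaque
    -- Of the `cap` rounds only the first v₂ act, v₂ being the first factor. Only that factor must
    -- be at most `cap`.
    mulE : Expr G 2
    mulE = loop cap# (lit 0) (ifnz (v₂ ⊖ v₁) (v₀ ⊕ v₃) v₀)

    powE : Expr G 1
    powE = loop cap# (lit 1) (ifnz (v₂ ⊖ v₁) (v₀ ⊕ v₀) v₀)

  opaque
    quotE : Expr G 2
    quotE = loop cap# (lit 0) (ifnz (call mulE ((lit 1 ⊕ v₀) ∷ v₃ ∷ []) ⊖ v₂) v₀ (lit 1 ⊕ v₀))

    remE : Expr G 2
    remE = v₀ ⊖ call mulE (call quotE (v₀ ∷ v₁ ∷ []) ∷ v₁ ∷ [])

    digitE : Expr G 2
    digitE = call remE
      ( loop positions# v₀ (ifnz (v₃ ⊖ v₁) (call quotE (v₀ ∷ baseE ∷ [])) v₀)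
      ∷ baseE ∷ [])

    loadE : Expr G 3
    loadE = call digitE (v₀ ∷ (call mulE (v₁ ∷ widthE ∷ []) ⊕ v₂) ∷ [])

    levelE : Expr G 2
    levelE = call digitE (v₀ ∷ (call mulE (v₁ ∷ widthE ∷ []) ⊕ glob levels#) ∷ [])

  opaque
    timeE : Expr G 2
    timeE = read 0 (call mulE (v₀ ∷ glob clients# ∷ []) ⊕ v₁)

    totalE : Expr G 1
    totalE = loop clients# (lit 0) (v₀ ⊕ call timeE (v₂ ∷ v₁ ∷ []))

    deadlineE : Expr G 2
    deadlineE = call mulE
      ( call mulE
          ( call powE (call quotE (v₁ ∷ glob e# ∷ []) ∷ [])
          ∷ (glob e# ⊕ call remE (v₁ ∷ glob e# ∷ []))
          ∷ [])
      ∷ call totalE (v₀ ∷ []) ∷ [])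

  opaque
    overloadE : Expr G 5
    overloadE =
      ifnz (call levelE (v₁ ∷ v₃ ∷ []) ⊖ v₄) (lit 0)
        (call mulE (glob scale# ∷ call mulE (glob resolution# ∷ call timeE (v₃ ∷ v₀ ∷ []) ∷ []) ∷ []))
      ⊕ call mulE (call loadE (v₁ ∷ v₃ ∷ v₄ ∷ []) ∷ call deadlineE (v₃ ∷ v₄ ∷ []) ∷ [])
      ⊖ call mulE ((lit 1 ⊕ call loadE (v₂ ∷ v₃ ∷ v₄ ∷ [])) ∷ call deadlineE (v₃ ∷ v₄ ∷ []) ∷ [])

  opaque
    violationE : Expr G 3
    violationE = loop days# (lit 0) (v₀ ⊕
      ((call levelE (v₃ ∷ v₁ ∷ []) ⊖ glob top#) ⊕
       -- In the inner body v₁ is the level, v₂ the outer accumulator, v₃ the day, and v₄, v₅, v₆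
       -- are j, x, y.
       loop levels# (lit 0) (v₀ ⊕ call overloadE (v₄ ∷ v₅ ∷ v₆ ∷ v₃ ∷ v₁ ∷ []))))

    budgetE : Expr G 1
    budgetE = loop days# (lit 0) (v₀ ⊕ call deadlineE (v₁ ∷ call levelE (v₂ ∷ v₁ ∷ []) ∷ []))

    limitE : Expr G 0
    limitE = call mulE (glob scale# ∷ loop days# (lit 0) (v₀ ⊕ call totalE (v₁ ∷ [])) ∷ [])

    edgeE : Expr G 3
    edgeE = ifnz (call violationE (v₀ ∷ v₁ ∷ v₂ ∷ [])) (lit 1 ⊕ call limitE []) (call budgetE (v₁ ∷ []))

  opaque
    maxE : Expr G 2
    maxE = v₀ ⊕ (v₁ ⊖ v₀)

    valueE : Expr G 2
    valueE = read 2 (call mulE (v₀ ∷ glob states# ∷ []) ⊕ v₁)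

    -- j, r, x, y: the cost of going from x through y, with client j next and r clients after it
    stepE : Expr G 4
    stepE = call maxE (call edgeE (v₀ ∷ v₂ ∷ v₃ ∷ []) ∷ call valueE (v₁ ∷ v₃ ∷ []) ∷ [])

  opaque
    argminE : Expr G 3
    argminE = loop states# (lit 0)
      (ifnz (call stepE (v₂ ∷ v₃ ∷ v₄ ∷ v₀ ∷ []) ⊖ call stepE (v₂ ∷ v₃ ∷ v₄ ∷ v₁ ∷ [])) v₁ v₀)

  opaque
    bestE : Expr G 3
    bestE = call stepE (v₀ ∷ v₁ ∷ v₂ ∷ call argminE (v₀ ∷ v₁ ∷ v₂ ∷ []) ∷ [])

  opaque
    cellE : Expr G 2
    cellE = ifnz v₀ (call bestE ((glob clients# ⊖ v₀) ∷ (v₀ ⊖ lit 1) ∷ v₁ ∷ [])) (lit 0)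

    valueTableE : Expr G 1
    valueTableE = call cellE
      (call quotE (v₀ ∷ glob states# ∷ []) ∷ call remE (v₀ ∷ glob states# ∷ []) ∷ [])

  opaque
    startE : Expr G 0
    startE = loop states# (lit 0)
      (ifnz (call valueE (glob clients# ∷ v₀ ∷ []) ⊖ call valueE (glob clients# ∷ v₁ ∷ [])) v₁ v₀)

  opaque
    pathTableE : Expr G 1
    pathTableE = ifnz v₀
      (call argminE ((v₀ ⊖ lit 1) ∷ (glob clients# ⊖ v₀) ∷ read 3 (v₀ ⊖ lit 1) ∷ []))
      (call startE [])

  opaque
    -- The level comes first and the client number breaks ties, so the keys of a day are distinct
    -- and counting smaller keys gives distinct positions.
    keyE : Expr G 2
    keyE = call mulE (call levelE (read 3 v₁ ∷ v₀ ∷ []) ∷ glob clients# ∷ []) ⊕ v₁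

    rankE : Expr G 2
    rankE = loop clients# (lit 0)
      (v₀ ⊕ ifnz (call keyE (v₂ ∷ v₃ ∷ []) ⊖ call keyE (v₂ ∷ v₁ ∷ [])) (lit 1) (lit 0))

    outputE : Expr G 1
    outputE = call rankE
      (call quotE (v₀ ∷ glob clients# ∷ []) ∷ call remE (v₀ ∷ glob clients# ∷ []) ∷ [])

  -- The code agrees with its specification only on small enough accumulators; `P` records that they
  -- stay so.
  iter-cong-inv : ∀ {A : Set} (P : A → Set) n {f g : ℕ → A → A} {a} → P a →
                  (∀ i x → i < n → P x → f i x ≡ g i x × P (g i x)) →
                  iter n f a ≡ iter n g a × P (iter n g a)
  iter-cong-inv P zero    Pa step = refl , Pa
  iter-cong-inv P (suc n) {f} Pa step =
    let eq , Px = iter-cong-inv P n Pa λ i x i<n → step i x (m≤n⇒m≤1+n i<n)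
        eq′ , Py = step n _ ≤-refl Px
    in trans (cong (f n) eq) eq′ , Py

  -- Loop bounds are globals, so an x-fold iteration is coded as k rounds of which those with index
  -- x or more do nothing.
  iter-guard : ∀ {A : Set} (g : A → A) k x b →
               iter k (λ i a → choose (x ∸ i) (g a) a) b ≡ iter (x ⊓ k) (λ _ → g) b
  iter-guard g zero    x b = cong (λ t → iter t (λ _ → g) b) (sym (⊓-zeroʳ x))
  iter-guard g (suc k) x b with <-≤-connex k x
  ... | inj₂ x≤k rewrite m≤n⇒m∸n≡0 x≤k | m≤n⇒m⊓n≡m (m≤n⇒m≤1+n x≤k) =
    trans (iter-guard g k x b) (cong (λ t → iter t (λ _ → g) b) (m≤n⇒m⊓n≡m x≤k))
  ... | inj₁ k<x rewrite m≥n⇒m⊓n≡n k<x with x ∸ k in eq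
  ...   | zero  = contradiction eq (m>n⇒m∸n≢0 k<x)
  ...   | suc _ = cong g (trans (iter-guard g k x b)
          (cong (λ t → iter t (λ _ → g) b) (m≥n⇒m⊓n≡n (<⇒≤ k<x))))

  iter-guard-≤ : ∀ {A : Set} (g : A → A) {k x} b → x ≤ k →
                 iter k (λ i a → choose (x ∸ i) (g a) a) b ≡ iter x (λ _ → g) b
  iter-guard-≤ g {k} {x} b x≤k =
    trans (iter-guard g k x b) (cong (λ t → iter t (λ _ → g) b) (m≤n⇒m⊓n≡m x≤k))

  iter-+ : ∀ k c b → iter k (λ _ a → a + c) b ≡ k * c + b
  iter-+ zero    c b = refl
  iter-+ (suc k) c b = trans (cong (_+ c) (iter-+ k c b))
    (trans (+-comm (k * c + b) c) (sym (+-assoc c (k * c) b)))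

  iter-double : ∀ k b → iter k (λ _ a → a + a) b ≡ 2 ^ k * b
  iter-double zero    b = sym (+-identityʳ b)
  iter-double (suc k) b = trans (cong (λ a → a + a) (iter-double k b))
    (trans (cong (2 ^ k * b +_) (sym (+-identityʳ (2 ^ k * b)))) (sym (*-assoc 2 (2 ^ k) b)))

  iter-^ : ∀ k r → iter k (λ _ a → r * a) 1 ≡ r ^ k
  iter-^ zero    r = refl
  iter-^ (suc k) r = cong (r *_) (iter-^ k r)

  m+[n∸m]≡m⊔n : ∀ m n → m + (n ∸ m) ≡ m ⊔ n
  m+[n∸m]≡m⊔n m n with ≤-total m n
  ... | inj₁ m≤n = trans (m+[n∸m]≡n m≤n) (sym (m≤n⇒m⊔n≡n m≤n))
  ... | inj₂ n≤m rewrite m≤n⇒m∸n≡0 n≤m | m≥n⇒m⊔n≡m n≤m = +-identityʳ m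

  choose-cong : ∀ {A : Set} {c c′} {a a′ b b′ : A} → c ≡ c′ → a ≡ a′ → b ≡ b′ →
                choose c a b ≡ choose c′ a′ b′
  choose-cong refl refl refl = refl

  choose-elim : ∀ {A : Set} (P : A → Set) c {a b} → P a → P b → P (choose c a b)
  choose-elim P zero    Pa Pb = Pb
  choose-elim P (suc _) Pa Pb = Pa

  module Semantics (n m e′ ℓ : ℕ) (input : ℕ → ℕ) where

    time : ℕ → ℕ → ℕ
    time i j = input (i * n + j)

    open Algorithm n m e′ ℓ time public

    -- A sum instead of a maximum, as the machine gets it by additions alone. The final 1 makes room
    -- for the base `suc resolution`.
    product cells entries cap : ℕ
    product = m * e
    cells   = suc n * states
    entries = m * n
    cap     = n + (m + (product + (ℓ + (positions + (states + (cells + (scale + (entries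
                + (e + (top + (levels + (resolution + 1))))))))))))

    final : Vec ℕ G
    final = n ∷ m ∷ e ∷ product ∷ ℓ ∷ top ∷ levels ∷ positions ∷ resolution ∷ states
              ∷ cells ∷ scale ∷ entries ∷ cap ∷ []

    private
      skip+ : ∀ z {x y} → x ≤ y → x ≤ z + y
      skip+ z le = m≤n⇒m≤o+n z le

    n≤cap : n ≤ cap
    n≤cap = m≤m+n n _
    m≤cap : m ≤ cap
    m≤cap = skip+ n (m≤m+n m _)
    product≤cap : product ≤ cap
    product≤cap = skip+ n (skip+ m (m≤m+n product _))
    ℓ≤cap : ℓ ≤ cap
    ℓ≤cap = skip+ n (skip+ m (skip+ product (m≤m+n ℓ _)))
    positions≤cap : positions ≤ cap
    positions≤cap = skip+ n (skip+ m (skip+ product (skip+ ℓ (m≤m+n positions _))))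
    states≤cap : states ≤ cap
    states≤cap = skip+ n (skip+ m (skip+ product (skip+ ℓ (skip+ positions (m≤m+n states _)))))
    cells≤cap : cells ≤ cap
    cells≤cap = skip+ n (skip+ m (skip+ product (skip+ ℓ (skip+ positions (skip+ states (m≤m+n cells _))))))
    scale≤cap : scale ≤ cap
    scale≤cap = skip+ n (skip+ m (skip+ product (skip+ ℓ (skip+ positions (skip+ states (skip+ cells (m≤m+n scale _)))))))
    entries≤cap : entries ≤ cap
    entries≤cap = skip+ n (skip+ m (skip+ product (skip+ ℓ (skip+ positions (skip+ states (skip+ cells (skip+ scale (m≤m+n entries _))))))))
    e≤cap : e ≤ cap
    e≤cap = skip+ n (skip+ m (skip+ product (skip+ ℓ (skip+ positions (skip+ states (skip+ cells (skip+ scale (skip+ entries (m≤m+n e _)))))))))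
    top≤cap : top ≤ cap
    top≤cap = skip+ n (skip+ m (skip+ product (skip+ ℓ (skip+ positions (skip+ states (skip+ cells (skip+ scale (skip+ entries (skip+ e (m≤m+n top _))))))))))
    levels≤cap : levels ≤ cap
    levels≤cap = skip+ n (skip+ m (skip+ product (skip+ ℓ (skip+ positions (skip+ states (skip+ cells (skip+ scale (skip+ entries (skip+ e (skip+ top (m≤m+n levels _)))))))))))
    1+resolution≤cap : suc resolution ≤ cap
    1+resolution≤cap = skip+ n (skip+ m (skip+ product (skip+ ℓ (skip+ positions (skip+ states (skip+ cells (skip+ scale (skip+ entries (skip+ e (skip+ top (skip+ levels (≤-reflexive (+-comm 1 resolution)))))))))))))

    key : ℕ → ℕ → ℕ
    key i j = assigned i j * n + j

    rank : ℕ → ℕ → ℕ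
    rank i j = sumTo n λ l → choose (key i j ∸ key i l) 1 0

    module _ (A : Arrays) where

      opaque
        unfolding mulE

        mul-eval : ∀ a b → a ≤ cap → eval final A mulE (a ∷ b ∷ []) ≡ a * b
        mul-eval a b a≤ = trans (iter-guard-≤ (_+ b) 0 a≤)
          (trans (iter-+ a b 0) (+-identityʳ (a * b)))

        pow-eval : ∀ a → a ≤ cap → eval final A powE (a ∷ []) ≡ 2 ^ a
        pow-eval a a≤ = trans (iter-guard-≤ (λ x → x + x) 1 a≤)
          (trans (iter-double a 1) (*-identityʳ (2 ^ a)))

      opaque
        unfolding quotE

        -- After k rounds the counter is the minimum of k and the quotient, and the quotient is at
        -- most a, hence at most `cap`.
        quot-eval : ∀ a b .{{_ : NonZero b}} → a ≤ cap → eval final A quotE (a ∷ b ∷ []) ≡ a / b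
        quot-eval a b a≤ = trans (go cap ≤-refl) (m≥n⇒m⊓n≡n (≤-trans (m/n≤m a b) a≤))
          where
          q : ℕ
          q = a / b
          body : ℕ → ℕ
          body v = choose (eval final A mulE (suc v ∷ b ∷ []) ∸ a) v (suc v)
          go : ∀ k → k ≤ cap → iter k (λ _ → body) 0 ≡ k ⊓ q
          go zero    _  = refl
          go (suc k) k< rewrite go k (<⇒≤ k<)
            | mul-eval (suc (k ⊓ q)) b (≤-trans (s≤s (m⊓n≤m k q)) k<) with <-≤-connex k q
          ... | inj₁ k<q rewrite m≤n⇒m⊓n≡m (<⇒≤ k<q) | m≤n⇒m⊓n≡m k<q
            | m≤n⇒m∸n≡0 (≤-trans (*-monoˡ-≤ b k<q) (m/n*n≤m a b)) = refl
          ... | inj₂ q≤k rewrite m≥n⇒m⊓n≡n q≤k | m≥n⇒m⊓n≡n (m≤n⇒m≤1+n q≤k)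
            with suc q * b ∸ a in eq
          ...   | suc _ = refl
          ...   | zero  = contradiction (m∸n≡0⇒m≤n eq) (<⇒≱ (begin-strict
              a                ≡⟨ m≡m%n+[m/n]*n a b ⟩
              a % b + q * b    <⟨ +-monoˡ-< (q * b) (m%n<n a b) ⟩
              suc q * b        ∎))
            where open ≤-Reasoning

        rem-eval : ∀ a b .{{_ : NonZero b}} → a ≤ cap → eval final A remE (a ∷ b ∷ []) ≡ a % b
        rem-eval a b a≤ = trans
          (cong (λ q → a ∸ eval final A mulE (q ∷ b ∷ [])) (quot-eval a b a≤))
          (trans (cong (a ∸_) (mul-eval (a / b) b (≤-trans (m/n≤m a b) a≤)))
                 (sym (m%n≡m∸m/n*n a b)))

        digit-eval : ∀ x s → x ≤ cap → s ≤ positions →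
                     eval final A digitE (x ∷ s ∷ []) ≡ digit resolution x s
        digit-eval x s x≤ s≤ =
          let eq , le = iter-cong-inv (_≤ cap) positions x≤ λ i y _ y≤ →
                choose-cong {c = s ∸ i} refl (quot-eval y (suc resolution) y≤) refl ,
                choose-elim (_≤ cap) (s ∸ i) (≤-trans (m/n≤m y (suc resolution)) y≤) y≤
              eq′ = iter-guard-≤ (_/ suc resolution) x s≤
          in trans (cong (λ y → eval final A remE (y ∷ suc resolution ∷ [])) eq)
               (trans (rem-eval _ (suc resolution) le) (cong (_% suc resolution) eq′))

        load-eval : ∀ x {i k} → x ≤ cap → i < m → k ≤ top →
                    eval final A loadE (x ∷ i ∷ k ∷ []) ≡ loadOf x i k
        load-eval x {i} {k} x≤ i<m k≤top = trans
          (cong (λ s → eval final A digitE (x ∷ (s + k) ∷ []))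
            (mul-eval i width (≤-trans (<⇒≤ i<m) m≤cap)))
          (digit-eval x _ x≤ (<⇒≤ (position< i<m (m≤n⇒m≤1+n k≤top))))

        level-eval : ∀ x {i} → x ≤ cap → i < m → eval final A levelE (x ∷ i ∷ []) ≡ levelOf x i
        level-eval x {i} x≤ i<m = trans
          (cong (λ s → eval final A digitE (x ∷ (s + levels) ∷ []))
            (mul-eval i width (≤-trans (<⇒≤ i<m) m≤cap)))
          (digit-eval x _ x≤ (<⇒≤ (position< i<m ≤-refl)))

      module _ (A₀ : ∀ k → A 0 k ≡ input k) where

        opaque
          unfolding timeE

          time-eval : ∀ {i} j → i < m → eval final A timeE (i ∷ j ∷ []) ≡ time i j
          time-eval {i} j i<m = trans
            (cong (λ s → A 0 (s + j)) (mul-eval i n (≤-trans (<⇒≤ i<m) m≤cap))) (A₀ _)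

          total-eval : ∀ {i} → i < m → eval final A totalE (i ∷ []) ≡ total i
          total-eval i<m = sumTo-cong n λ j _ → time-eval j i<m

          deadline-eval : ∀ {i k} → i < m → k ≤ top → eval final A deadlineE (i ∷ k ∷ []) ≡ deadline i k
          deadline-eval {i} {k} i<m k≤top = trans
            (cong₂ (λ a b → eval final A mulE (a ∷ b ∷ [])) thresholdEq (total-eval i<m))
            (mul-eval (threshold k) (total i) threshold≤cap)
            where
            k≤cap : k ≤ cap
            k≤cap = ≤-trans k≤top (≤-trans (n≤1+n top) levels≤cap)
            threshold≤cap : threshold k ≤ cap
            threshold≤cap = ≤-trans (≤-trans (threshold-mono k≤top) (≤-reflexive (threshold-top ℓ))) scale≤cap
            powEq : eval final A powE (eval final A quotE (k ∷ e ∷ []) ∷ []) ≡ 2 ^ (k / e)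
            powEq = trans (cong (λ a → eval final A powE (a ∷ [])) (quot-eval k e k≤cap))
              (pow-eval (k / e) (≤-trans (m/n≤m k e) k≤cap))
            thresholdEq : eval final A mulE
              (eval final A powE (eval final A quotE (k ∷ e ∷ []) ∷ []) ∷ (e + eval final A remE (k ∷ e ∷ [])) ∷ [])
              ≡ threshold k
            thresholdEq = trans
              (cong₂ (λ a b → eval final A mulE (a ∷ (e + b) ∷ [])) powEq (rem-eval k e k≤cap))
              (mul-eval (2 ^ (k / e)) _ (≤-trans (m≤m*n (2 ^ (k / e)) (e + k % e)) threshold≤cap))

        opaque
          unfolding overloadE

          overload-eval : ∀ j {x y i k} → x ≤ cap → y ≤ cap → i < m → k ≤ top →
                          eval final A overloadE (j ∷ x ∷ y ∷ i ∷ k ∷ []) ≡ overload j x y i k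
          overload-eval j {x} {y} {i} {k} x≤ y≤ i<m k≤top = cong₂ _∸_
            (cong₂ _+_
              (choose-cong {b = eval final A mulE (scale ∷ eval final A mulE (resolution ∷ eval final A timeE (i ∷ j ∷ []) ∷ []) ∷ [])}
                (cong (_∸ k) (level-eval x x≤ i<m)) refl
                (trans
                  (cong (λ z → eval final A mulE (scale ∷ z ∷ []))
                    (trans (cong (λ z → eval final A mulE (resolution ∷ z ∷ [])) (time-eval j i<m))
                           (mul-eval resolution (time i j) (<⇒≤ 1+resolution≤cap))))
                  (mul-eval scale _ scale≤cap)))
              (trans (cong₂ (λ a b → eval final A mulE (a ∷ b ∷ [])) (load-eval x x≤ i<m k≤top) (deadline-eval i<m k≤top))
                (mul-eval _ _ (<⇒≤ (≤-trans (s≤s (digit-≤ resolution x (i * width + k))) 1+resolution≤cap)))))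
            (trans (cong₂ (λ a b → eval final A mulE (suc a ∷ b ∷ [])) (load-eval y y≤ i<m k≤top) (deadline-eval i<m k≤top))
              (mul-eval _ _ (≤-trans (s≤s (digit-≤ resolution y (i * width + k))) 1+resolution≤cap)))

        opaque
          unfolding violationE

          violation-eval : ∀ j {x y} → x ≤ cap → y ≤ cap →
                           eval final A violationE (j ∷ x ∷ y ∷ []) ≡ violation j x y
          violation-eval j {x} {y} x≤ y≤ = sumTo-cong m λ i i<m → cong₂ _+_
            (cong (_∸ top) (level-eval x x≤ i<m))
            (sumTo-cong levels λ k k< → overload-eval j x≤ y≤ i<m (s≤s⁻¹ k<))

          -- `deadlineE` is known to be right only up to level `top`, while a digit may exceed it.
          -- The budget is selected only if the violation is 0, and then all levels are valid.
          edge-eval : ∀ j {x y} → x ≤ cap → y ≤ cap →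
                      eval final A edgeE (j ∷ x ∷ y ∷ []) ≡ edge j x y
          edge-eval j {x} {y} x≤ y≤ = trans
            (cong (λ c → choose c (suc (eval final A limitE [])) (eval final A budgetE (x ∷ []))) (violation-eval j x≤ y≤))
            (by-cases (violation j x y) refl)
            where
            limit-eval : eval final A limitE [] ≡ limit
            limit-eval = trans
              (cong (λ z → eval final A mulE (scale ∷ z ∷ [])) (sumTo-cong m λ i i<m → total-eval i<m))
              (mul-eval scale _ scale≤cap)
            by-cases : ∀ c → violation j x y ≡ c →
              choose c (suc (eval final A limitE [])) (eval final A budgetE (x ∷ [])) ≡ choose c (suc limit) (budget x)
            by-cases (suc c) _  = cong suc limit-eval
            by-cases zero    ok = sumTo-cong m λ i i<m → trans
              (cong (λ k → eval final A deadlineE (i ∷ k ∷ [])) (level-eval x x≤ i<m))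
              (deadline-eval i<m (level-valid ok i<m))

        module _ (r : ℕ) (r≤n : r ≤ n)
                 (A₂ : ∀ y → y < states → A 2 (r * states + y) ≡ value r y) where

          opaque
            unfolding maxE

            value-eval : ∀ y → y < states → eval final A valueE (r ∷ y ∷ []) ≡ value r y
            value-eval y y< = trans
              (cong (λ s → A 2 (s + y)) (mul-eval r states (≤-trans r≤n n≤cap))) (A₂ y y<)

            step-eval : ∀ j {x y} → x < states → y < states →
                        eval final A stepE (j ∷ r ∷ x ∷ y ∷ []) ≡ step (value r) j x y
            step-eval j {x} {y} x< y< = trans
              (m+[n∸m]≡m⊔n (eval final A edgeE (j ∷ x ∷ y ∷ [])) (eval final A valueE (r ∷ y ∷ [])))
              (cong₂ _⊔_ (edge-eval j (<⇒≤ (≤-trans x< states≤cap)) (<⇒≤ (≤-trans y< states≤cap)))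
                         (value-eval y y<))

          opaque
            unfolding argminE

            argmin-eval : ∀ j {x} → x < states →
                          eval final A argminE (j ∷ r ∷ x ∷ []) ≡ argmin states (step (value r) j x)
            argmin-eval j {x} x< = proj₁ (iter-cong-inv (_< states) states states>0 λ i y i< y< →
              choose-cong (cong₂ _∸_ (step-eval j x< y<) (step-eval j x< i<)) refl refl ,
              choose-elim (_< states) (step (value r) j x y ∸ step (value r) j x i) i< y<)

          opaque
            unfolding bestE

            best-eval : ∀ j {x} → x < states →
                        eval final A bestE (j ∷ r ∷ x ∷ []) ≡
                        step (value r) j x (argmin states (step (value r) j x))
            best-eval j {x} x< = trans
              (cong (λ y → eval final A stepE (j ∷ r ∷ x ∷ y ∷ [])) (argmin-eval j x<))
              (step-eval j x< (argmin-< states (step (value r) j x) states>0))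

        opaque
          unfolding startE

          start-eval : (∀ y → y < states → A 2 (n * states + y) ≡ value n y) →
                       eval final A startE [] ≡ argmin states (value n)
          start-eval A₂ = proj₁ (iter-cong-inv (_< states) states states>0 λ i y i< y< →
            choose-cong (cong₂ _∸_ (value-eval n ≤-refl A₂ y y<) (value-eval n ≤-refl A₂ i i<)) refl refl ,
            choose-elim (_< states) (value n y ∸ value n i) i< y<)

        module _ (A₃ : ∀ j → j < n → A 3 j ≡ path j) where

          opaque
            unfolding keyE

            key-eval : ∀ {i j} → i < m → j < n → eval final A keyE (i ∷ j ∷ []) ≡ key i j
            key-eval {i} {j} i<m j<n = cong (_+ j) (trans
              (cong (λ c → eval final A mulE (c ∷ n ∷ []))
                (trans (cong (λ x → eval final A levelE (x ∷ i ∷ [])) (A₃ j j<n))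
                       (level-eval (path j) (<⇒≤ (≤-trans (path-< states>0 j) states≤cap)) i<m)))
              (mul-eval _ n (<⇒≤ (≤-trans (s≤s (digit-≤ resolution (path j) (i * width + levels))) 1+resolution≤cap))))

            rank-eval : ∀ {i j} → i < m → j < n → eval final A rankE (i ∷ j ∷ []) ≡ rank i j
            rank-eval i<m j<n = sumTo-cong n λ l l<n →
              choose-cong (cong₂ _∸_ (key-eval i<m j<n) (key-eval i<m l<n)) refl refl

-- The complete program and its execution

module Programs where

  open Language
  open Statements
  open Arithmetic
  open Scheduling
  open Code
  open import Data.Fin.Base using (Fin; zero; suc)
  import Data.Fin.Properties as Fin
  open import Data.List.Base using (List; []; _∷_)
  open import Data.Nat.DivMod
  open import Data.Sum.Base using (_⊎_; inj₁; inj₂)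
  open import Data.Product.Base using (∃; _×_; _,_)
  open import Data.Vec.Base using (Vec; []; _∷_; lookup; replicate; _[_]≔_)
  open import Data.Vec.Properties using (lookup∘updateAt; lookup∘updateAt′; lookup-replicate)
  open import Relation.Nullary.Decidable.Core using (yes; no)
  open import Relation.Nullary.Negation.Core using (contradiction)

  compileAll : ∀ {G} → List (Stmt G) → Program
  compileAll []       = skip
  compileAll (c ∷ cs) = compileStmt c ⨾ compileAll cs

  costAll : ∀ {G} → List (Stmt G) → ℕ → ℕ
  costAll []       X = 1
  costAll (c ∷ cs) X = costStmt c X + costAll cs X

  costAll-poly : ∀ {G} (cs : List (Stmt G)) → Polynomial (costAll cs)
  costAll-poly []       = poly-const 1
  costAll-poly (c ∷ cs) = poly-+ (costStmt-poly c) (costAll-poly cs)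

  Runs-skip : ∀ {G} {γ : Vec ℕ G} {Φ} → Runs skip γ Φ γ Φ 1
  Runs-skip s h = s , 1 , ⇓skip , h , ≤-refl

  Runs-post : ∀ {G P} {γ γ′ : Vec ℕ G} {Φ Φ′ Φ″ : Arrays → Set} {b} → (∀ A → Φ′ A → Φ″ A) →
              Runs P γ Φ γ′ Φ′ b → Runs P γ Φ γ′ Φ″ b
  Runs-post f r s h =
    let s′ , t , run , matches g φ , le = r s h
    in s′ , t , run , matches g (f _ φ) , le

  lookup-≤ : ∀ {G X v} (γ : Vec ℕ G) g → (∀ g′ → lookup γ g′ ≤ X) → v ≤ X →
             ∀ g′ → lookup (γ [ g ]≔ v) g′ ≤ X
  lookup-≤ γ g γ≤ v≤ g′ with g′ Fin.≟ g
  ... | yes refl = ≤-trans (≤-reflexive (lookup∘updateAt g γ)) v≤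
  ... | no g′≢g  = ≤-trans (≤-reflexive (lookup∘updateAt′ g′ g g′≢g γ)) (γ≤ g′)

  floorDiv-≡ : ∀ a b .{{_ : NonZero b}} → floorDiv a b ≡ a / b
  floorDiv-≡ a (suc b) = refl

  choose-suc : ∀ c x → choose c (suc x) 1 ≡ suc (choose c x 0)
  choose-suc zero    x = refl
  choose-suc (suc _) x = refl

  -- The search for ⌈log₂ v⌉ as the machine performs it.
  logUp : ℕ → ℕ
  logUp v = iter v (λ _ a → choose (v ∸ 2 ^ (a ⊓ v)) (suc a) a) 0

  n<2^n : ∀ n → n < 2 ^ n
  n<2^n zero    = s≤s z≤n
  n<2^n (suc n) = begin
    2 + n            ≤⟨ +-mono-≤ (m^n>0 2 n) (n<2^n n) ⟩
    2 ^ n + 2 ^ n    ≡⟨ cong (2 ^ n +_) (+-identityʳ (2 ^ n)) ⟨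
    2 * 2 ^ n        ∎
    where open ≤-Reasoning

  private
    search : ℕ → ℕ → ℕ
    search v k = iter k (λ _ a → choose (v ∸ 2 ^ (a ⊓ v)) (suc a) a) 0

  -- Until the test succeeds every round increments the counter, and v increments suffice since v <
  -- 2^v. The exponent is cut off at v because the power is computed in v rounds.
  logUp-lower : ∀ v → v ≤ 2 ^ logUp v
  logUp-lower v with progress v
    where
    progress : ∀ k → k ≤ search v k ⊎ v ≤ 2 ^ (search v k ⊓ v)
    progress zero    = inj₁ z≤n
    progress (suc k) with v ∸ 2 ^ (search v k ⊓ v) in eq | progress k
    ... | zero  | _        = inj₂ (m∸n≡0⇒m≤n eq)
    ... | suc _ | inj₁ k≤a = inj₁ (s≤s k≤a)
    ... | suc _ | inj₂ le  = contradiction (trans (sym eq) (m≤n⇒m∸n≡0 le)) λ ()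
  ... | inj₁ v≤a = ≤-trans (<⇒≤ (n<2^n v)) (^-monoʳ-≤ 2 v≤a)
  ... | inj₂ le  = ≤-trans le (^-monoʳ-≤ 2 (m⊓n≤m (logUp v) v))

  -- As v < 2^v, the cut-off also leaves v ≤ 2^(q ⊓ v); hence no increment happens at q or beyond.
  logUp-upper : ∀ v q → v ≤ 2 ^ q → logUp v ≤ q
  logUp-upper v q v≤ = bounded v
    where
    v≤′ : v ≤ 2 ^ (q ⊓ v)
    v≤′ with ≤-total q v
    ... | inj₁ q≤v rewrite m≤n⇒m⊓n≡m q≤v = v≤
    ... | inj₂ v≤q rewrite m≥n⇒m⊓n≡n v≤q = <⇒≤ (n<2^n v)
    bounded : ∀ k → search v k ≤ q
    bounded zero    = z≤n
    bounded (suc k) with v ∸ 2 ^ (search v k ⊓ v) in eq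
    ... | zero  = bounded k
    ... | suc _ = ≰⇒> λ q≤a → contradiction
      (trans (sym eq) (m≤n⇒m∸n≡0 (≤-trans v≤′ (^-monoʳ-≤ 2 (⊓-monoˡ-≤ v q≤a))))) λ ()

  -- Without days the time bound leaves no room for a precision growing with 1/ε, so e is then 1.
  -- Nothing is lost, as every objective value is 0.
  init-e : ℕ → Expr G 0
  init-e E = ifnz (glob days#) (lit (suc E)) (lit 1)

  -- `mulE` relies on `cap`, which is computed last. Products and powers are therefore loops over
  -- globals that are already set.
  init-product init-ℓ init-top init-levels init-positions init-resolution init-states init-cells init-scale init-entries init-cap : Expr G 0
  init-product = loop days# (lit 0) (v₀ ⊕ glob e#)
  init-ℓ = loop product# (lit 0)
    (ifnz (glob product# ⊖ loop product# (lit 1) (ifnz (v₂ ⊖ v₁) (v₀ ⊕ v₀) v₀)) (lit 1 ⊕ v₀) v₀)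
  init-top = loop ℓ# (lit 0) (v₀ ⊕ glob e#)
  init-levels = lit 1 ⊕ glob top#
  init-positions = loop days# (lit 0) (v₀ ⊕ widthE)
  init-resolution = loop clients# (glob levels#) (v₀ ⊕ glob e#)
  init-states = loop positions# (lit 1) (loop resolution# v₀ (v₀ ⊕ v₂))
  init-cells = loop clients# (glob states#) (v₀ ⊕ glob states#)
  init-scale = loop ℓ# (glob e#) (v₀ ⊕ v₀)
  init-entries = loop days# (lit 0) (v₀ ⊕ glob clients#)
  init-cap = glob clients# ⊕ (glob days# ⊕ (glob product# ⊕ (glob ℓ# ⊕ (glob positions# ⊕
    (glob states# ⊕ (glob cells# ⊕ (glob scale# ⊕ (glob entries# ⊕ (glob e# ⊕ (glob top# ⊕
    (glob levels# ⊕ (glob resolution# ⊕ lit 1))))))))))))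

  remaining : List (Stmt G)
  remaining =
    set product# init-product ∷
    set ℓ# init-ℓ ∷
    set top# init-top ∷
    set levels# init-levels ∷
    set positions# init-positions ∷
    set resolution# init-resolution ∷
    set states# init-states ∷
    set cells# init-cells ∷
    set scale# init-scale ∷
    set entries# init-entries ∷
    set cap# init-cap ∷
    fill 2 cells# valueTableE ∷
    fill 3 clients# pathTableE ∷
    fill 1 entries# outputE ∷
    []

  program : ℕ → List (Stmt G)
  program E = set e# (init-e E) ∷ remaining

  module Execution (n m E : ℕ) (input : ℕ → ℕ) where

    e′ ℓ : ℕ
    e′ = choose m E 0
    ℓ  = logUp (m * suc e′)

    open Semantics n m e′ ℓ input public

    -- Division by n is harmless for n = 0, where there are no output entries.
    output : ℕ → ℕ
    output k = rank (floorDiv k n) (k ∸ floorDiv k n * n)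

    output-at : ∀ i {j} → j < n → output (i * n + j) ≡ rank i j
    output-at i {j} j<n rewrite floorDiv-≡ (i * n + j) n {{>-nonZero (≤-<-trans z≤n j<n)}}
      | +-comm (i * n) j | [m+kn]/n≡k i n {{>-nonZero (≤-<-trans z≤n j<n)}} j<n = cong (rank i) (m+n∸n≡m j (i * n))

    instance
      states≢0 : NonZero states
      states≢0 = >-nonZero states>0

    valueTable : ℕ → ℕ
    valueTable k = value (k / states) (k % states)

    valueTable-at : ∀ r {x} → x < states → valueTable (r * states + x) ≡ value r x
    valueTable-at r {x} x< rewrite +-comm (r * states) x =
      cong₂ value ([m+kn]/n≡k r states x<) ([m+kn]%n≡m r states x<)

    cell< : ∀ {r r′ x} → r < r′ → x < states → r * states + x < r′ * states
    cell< {r} {r′} {x} r< x< = begin-strict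
      r * states + x         <⟨ +-monoʳ-< (r * states) x< ⟩
      r * states + states    ≡⟨ +-comm (r * states) states ⟩
      suc r * states         ≤⟨ *-monoˡ-≤ states r< ⟩
      r′ * states            ∎
      where open ≤-Reasoning

    Inputs : Arrays → Set
    Inputs A = ∀ k → A 0 k ≡ input k

    Values : Arrays → Set
    Values A = Inputs A × (∀ k → k < cells → A 2 k ≡ valueTable k)

    Paths : Arrays → Set
    Paths A = Inputs A × (∀ j → j < n → A 3 j ≡ path j)

    Ranked : Arrays → Set
    Ranked A = ∀ i j → i < m → j < n → A 1 (i * n + j) ≡ rank i j

    opaque
      unfolding cellE

      cell-eval : ∀ A → Inputs A → ∀ r {x} → r ≤ n → x < states →
        (∀ r′ y → r′ < r → y < states → A 2 (r′ * states + y) ≡ value r′ y) →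
        eval final A cellE (r ∷ x ∷ []) ≡ value r x
      cell-eval A A₀ zero    r≤n x< A₂ = refl
      cell-eval A A₀ (suc r) r≤n x< A₂ =
        best-eval A A₀ r (<⇒≤ r≤n) (λ y → A₂ r y ≤-refl) (n ∸ suc r) x<

      -- Row r depends on row r - 1 only, and in row-major order that row lies entirely before cell
      -- k.
      valueTable-eval : ∀ A → Inputs A → ∀ A′ k → k < cells → Filled 2 valueTable A k A′ →
        eval final A′ valueTableE (k ∷ []) ≡ valueTable k
      valueTable-eval A A₀ A′ k k< (old , new) = trans
        (cong₂ (λ r x → eval final A′ cellE (r ∷ x ∷ []))
          (quot-eval A′ k states (<⇒≤ (≤-trans k< cells≤cap)))
          (rem-eval A′ k states (<⇒≤ (≤-trans k< cells≤cap))))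
        (cell-eval A′ (λ i → trans (old 0 i λ ()) (A₀ i)) (k / states)
          (s≤s⁻¹ (m<n*o⇒m/o<n k<)) (m%n<n k states)
          λ r y r< y< → trans (new _ (≤-trans (cell< r< y<) (m/n*n≤m k states))) (valueTable-at r y<))

    opaque
      unfolding pathTableE

      pathTable-eval : ∀ A → Values A → ∀ A′ j → j < n → Filled 3 path A j A′ →
        eval final A′ pathTableE (j ∷ []) ≡ path j
      pathTable-eval A (A₀ , A₂) A′ j j<n (old , new) = by-cases j j<n new
        where
        A₀′ : Inputs A′
        A₀′ k = trans (old 0 k λ ()) (A₀ k)
        A₂′ : ∀ r → r ≤ n → ∀ y → y < states → A′ 2 (r * states + y) ≡ value r y
        A₂′ r r≤n y y< = trans (old 2 _ λ ())
          (trans (A₂ _ (cell< (s≤s r≤n) y<)) (valueTable-at r y<))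
        by-cases : ∀ j → j < n → (∀ i → i < j → A′ 3 i ≡ path i) →
          eval final A′ pathTableE (j ∷ []) ≡ path j
        by-cases zero    _   new = start-eval A′ A₀′ (A₂′ n ≤-refl)
        by-cases (suc j) j<n new = trans
          (cong (λ x → eval final A′ argminE (j ∷ (n ∸ suc j) ∷ x ∷ [])) (new j ≤-refl))
          (argmin-eval A′ A₀′ (n ∸ suc j) (m∸n≤m n (suc j)) (A₂′ (n ∸ suc j) (m∸n≤m n (suc j)))
            j (path-< states>0 j))

    opaque
      unfolding keyE

      output-eval : ∀ A → Paths A → ∀ A′ k → k < entries → Filled 1 output A k A′ →
        eval final A′ outputE (k ∷ []) ≡ output k
      output-eval A (A₀ , A₃) A′ k k< (old , _) = trans
        (cong₂ (λ i j → eval final A′ rankE (i ∷ j ∷ []))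
          (quot-eval A′ k n (<⇒≤ (≤-trans k< entries≤cap)))
          (rem-eval A′ k n (<⇒≤ (≤-trans k< entries≤cap))))
        (trans
          (rank-eval A′ (λ i → trans (old 0 i λ ()) (A₀ i)) (λ j j<n → trans (old 3 j λ ()) (A₃ j j<n))
            (m<n*o⇒m/o<n k<) (m%n<n k n))
          (cong₂ rank (sym (floorDiv-≡ k n))
            (trans (m%n≡m∸m/n*n k n) (cong (λ q → k ∸ q * n) (sym (floorDiv-≡ k n))))))
        where
        instance
          n≢0 : NonZero n
          n≢0 = m*n≢0⇒n≢0 m {{>-nonZero (≤-<-trans z≤n k<)}}

    start : Vec ℕ G
    start = n ∷ m ∷ replicate 12 0

    start-≤ : ∀ g → lookup start g ≤ cap
    start-≤ zero          = n≤cap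
    start-≤ (suc zero)    = m≤cap
    start-≤ (suc (suc g)) = ≤-trans (≤-reflexive (lookup-replicate g 0)) z≤n

    private
      iter-+₀ : ∀ k c → iter k (λ _ a → a + c) 0 ≡ k * c
      iter-+₀ k c = trans (iter-+ k c 0) (+-identityʳ (k * c))

      ℓ-eval : iter product (λ _ a → choose
          (product ∸ iter product (λ i b → choose (a ∸ i) (b + b) b) 1) (suc a) a) 0 ≡ ℓ
      ℓ-eval = iter-cong product refl λ _ a _ → cong (λ x → choose (product ∸ x) (suc a) a)
        (trans (iter-guard (λ b → b + b) product a 1)
          (trans (iter-double (a ⊓ product) 1) (*-identityʳ (2 ^ (a ⊓ product)))))

      states-eval : iter positions (λ _ a → iter resolution (λ _ b → b + a) a) 1 ≡ states
      states-eval = trans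
        (iter-cong positions refl λ _ a _ → trans (iter-+ resolution a a) (+-comm (resolution * a) a))
        (iter-^ positions (suc resolution))

    program-runs : Runs (compileAll (program E)) start Inputs final Ranked
                        (costAll (program E) cap)
    program-runs =
      Runs-seq (set-runs γ₀ cap b₀ Inputs e# (init-e E) (λ _ _ → choose-suc m E)) (
      Runs-seq (set-runs γ₁ cap b₁ Inputs product# init-product (λ _ _ → iter-+₀ m e)) (
      Runs-seq (set-runs γ₂ cap b₂ Inputs ℓ# init-ℓ (λ _ _ → ℓ-eval)) (
      Runs-seq (set-runs γ₃ cap b₃ Inputs top# init-top (λ _ _ → iter-+₀ ℓ e)) (
      Runs-seq (set-runs γ₄ cap b₄ Inputs levels# init-levels (λ _ _ → refl)) (
      Runs-seq (set-runs γ₅ cap b₅ Inputs positions# init-positions (λ _ _ → iter-+₀ m width)) (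
      Runs-seq (set-runs γ₆ cap b₆ Inputs resolution# init-resolution (λ _ _ → iter-+ n e levels)) (
      Runs-seq (set-runs γ₇ cap b₇ Inputs states# init-states (λ _ _ → states-eval)) (
      Runs-seq (set-runs γ₈ cap b₈ Inputs cells# init-cells
        (λ _ _ → trans (iter-+ n states states) (+-comm (n * states) states))) (
      Runs-seq (set-runs γ₉ cap b₉ Inputs scale# init-scale (λ _ _ → iter-double ℓ e)) (
      Runs-seq (set-runs γ₁₀ cap b₁₀ Inputs entries# init-entries (λ _ _ → iter-+₀ m n)) (
      Runs-seq (set-runs γ₁₁ cap b₁₁ Inputs cap# init-cap (λ _ _ → refl)) (
      Runs-seq (Runs-post values (fill-runs final cap final-≤ Inputs 2 cells# valueTableE valueTable valueTable-eval)) (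
      Runs-seq (Runs-post paths (fill-runs final cap final-≤ Values 3 clients# pathTableE path pathTable-eval)) (
      Runs-seq (Runs-post outputs (fill-runs final cap final-≤ Paths 1 entries# outputE output output-eval))
      Runs-skip))))))))))))))
      where
      γ₀ γ₁ γ₂ γ₃ γ₄ γ₅ γ₆ γ₇ γ₈ γ₉ γ₁₀ γ₁₁ : Vec ℕ G
      γ₀  = start
      γ₁  = γ₀ [ e# ]≔ e
      γ₂  = γ₁ [ product# ]≔ product
      γ₃  = γ₂ [ ℓ# ]≔ ℓ
      γ₄  = γ₃ [ top# ]≔ top
      γ₅  = γ₄ [ levels# ]≔ levels
      γ₆  = γ₅ [ positions# ]≔ positions
      γ₇  = γ₆ [ resolution# ]≔ resolution
      γ₈  = γ₇ [ states# ]≔ states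
      γ₉  = γ₈ [ cells# ]≔ cells
      γ₁₀ = γ₉ [ scale# ]≔ scale
      γ₁₁ = γ₁₀ [ entries# ]≔ entries
      b₀  = start-≤
      b₁  = lookup-≤ γ₀ e# b₀ e≤cap
      b₂  = lookup-≤ γ₁ product# b₁ product≤cap
      b₃  = lookup-≤ γ₂ ℓ# b₂ ℓ≤cap
      b₄  = lookup-≤ γ₃ top# b₃ top≤cap
      b₅  = lookup-≤ γ₄ levels# b₄ levels≤cap
      b₆  = lookup-≤ γ₅ positions# b₅ positions≤cap
      b₇  = lookup-≤ γ₆ resolution# b₆ (<⇒≤ 1+resolution≤cap)
      b₈  = lookup-≤ γ₇ states# b₇ states≤cap
      b₉  = lookup-≤ γ₈ cells# b₈ cells≤cap
      b₁₀ = lookup-≤ γ₉ scale# b₉ scale≤cap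
      b₁₁ = lookup-≤ γ₁₀ entries# b₁₀ entries≤cap
      -- The twelve updates of `start` compute to `final`.
      final-≤ : ∀ g → lookup final g ≤ cap
      final-≤ = lookup-≤ γ₁₁ cap# b₁₁ ≤-refl
      values : ∀ A → (∃ λ B → Inputs B × Filled 2 valueTable B cells A) → Values A
      values A (B , B₀ , old , new) = (λ k → trans (old 0 k λ ()) (B₀ k)) , new
      paths : ∀ A → (∃ λ B → Values B × Filled 3 path B n A) → Paths A
      paths A (B , (B₀ , _) , old , new) = (λ k → trans (old 0 k λ ()) (B₀ k)) , new
      outputs : ∀ A → (∃ λ B → Paths B × Filled 1 output B entries A) → Ranked A
      outputs A (B , _ , _ , new) i j i<m j<n = trans
        (new (i * n + j) (begin-strict
          i * n + j    <⟨ +-monoʳ-< (i * n) j<n ⟩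
          i * n + n    ≡⟨ +-comm (i * n) n ⟩
          suc i * n    ≤⟨ *-monoˡ-≤ n i<m ⟩
          m * n        ∎))
        (output-at i j<n)
        where open ≤-Reasoning

-- From computed ranks to schedules, and comparison with an arbitrary schedule

module Schedules where

  open Language
  open Arithmetic
  open Code
  open Programs
  open import Data.Bool.Base using (true; false; if_then_else_)
  open import Data.Fin.Base using (Fin; zero; suc; toℕ; fromℕ<; combine; punchOut; remQuot)
  import Data.Fin.Properties as Fin
  open import Data.Fin.Permutation using (Permutation′; permutation; _⟨$⟩ʳ_)
  open import Data.List.Base using ([]; _∷_; map; filter; allFin; tabulate)
  open import Data.List.Properties using (map-tabulate)
  open import Data.List.Extrema.Nat using (max≤v⁺; xs≤max)
  open import Data.List.Relation.Unary.All using (All; lookup)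
  import Data.List.Relation.Unary.All.Properties as All
  open import Data.List.Membership.Propositional.Properties using (∈-map⁺; ∈-allFin)
  open import Data.Nat.ListAction using (sum)
  open import Data.Nat.DivMod
  open import Data.Product.Base using (∃; _×_; _,_; proj₁; proj₂; uncurry)
  open import Data.Sum.Base using (_⊎_; inj₁; inj₂)
  open import Function.Base using (_∘_; id)
  open import Function.Definitions using (Injective)
  open import Level using (0ℓ)
  open import Relation.Binary.Definitions using (tri<; tri≈; tri>)
  open import Relation.Nullary.Decidable.Core using (Dec; yes; no; does)
  open import Relation.Nullary.Negation.Core using (contradiction)
  open import Relation.Unary using (Pred; Decidable)

  sum-tabulate : ∀ n (f : Fin n → ℕ) (g : ℕ → ℕ) → (∀ i → f i ≡ g (toℕ i)) →
                 sum (tabulate f) ≡ sumTo n g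
  sum-tabulate zero    f g eq = refl
  sum-tabulate (suc n) f g eq =
    trans (cong₂ _+_ (eq zero) (sum-tabulate n (f ∘ suc) (g ∘ suc) (eq ∘ suc))) (sym (sumTo-head n g))

  sum-allFin : ∀ n (f : Fin n → ℕ) (g : ℕ → ℕ) → (∀ i → f i ≡ g (toℕ i)) →
               sum (map f (allFin n)) ≡ sumTo n g
  sum-allFin n f g eq = trans (cong sum (map-tabulate id f)) (sum-tabulate n f g eq)

  sum-filter : ∀ {A : Set} {P : Pred A 0ℓ} (P? : Decidable {A = A} P) (f : A → ℕ) xs →
               sum (map f (filter P? xs)) ≡ sum (map (λ x → if does (P? x) then f x else 0) xs)
  sum-filter P? f []       = refl
  sum-filter P? f (x ∷ xs) with does (P? x)
  ... | true  = cong (f x +_) (sum-filter P? f xs)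
  ... | false = sum-filter P? f xs

  if≤-choose : ∀ {a b} (a≤?b : Dec (a ≤ b)) {A : Set} {x y : A} →
               (if does a≤?b then x else y) ≡ choose (a ∸ b) y x
  if≤-choose (yes a≤b) rewrite m≤n⇒m∸n≡0 a≤b = refl
  if≤-choose {a} {b} (no a≰b) with a ∸ b in eq
  ... | zero  = contradiction (m∸n≡0⇒m≤n eq) a≰b
  ... | suc _ = refl

  term≤sumTo : ∀ n f {i} → i < n → f i ≤ sumTo n f
  term≤sumTo n f {i} i<n = ≤-trans (m≤n+m (f i) (sumTo i f)) (sumTo-prefix f i<n)

  sumTo-strict : ∀ n {f g : ℕ → ℕ} → (∀ i → i < n → f i ≤ g i) → ∀ {i} → i < n → f i < g i →
                 sumTo n f < sumTo n g
  sumTo-strict (suc n) le {i} i<1+n lt with m≤n⇒m<n∨m≡n (s≤s⁻¹ i<1+n)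
  ... | inj₁ i<n  = +-mono-<-≤ (sumTo-strict n (λ j j<n → le j (m≤n⇒m≤1+n j<n)) i<n lt) (le n ≤-refl)
  ... | inj₂ refl = +-mono-≤-< (sumTo-mono n λ j j<n → le j (m≤n⇒m≤1+n j<n)) lt

  sumTo-ones : ∀ n → sumTo n (λ _ → 1) ≡ n
  sumTo-ones zero    = refl
  sumTo-ones (suc n) = trans (+-comm (sumTo n (λ _ → 1)) 1) (cong suc (sumTo-ones n))

  on-Fin : ∀ {n} (P : ℕ → Set) → (∀ (i : Fin n) → P (toℕ i)) → ∀ i → i < n → P i
  on-Fin P f i i<n = subst P (Fin.toℕ-fromℕ< i<n) (f (fromℕ< i<n))

  extend : ∀ {n} → (Fin n → ℕ) → ℕ → ℕ
  extend {n} f k with k <? n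
  ... | yes k<n = f (fromℕ< k<n)
  ... | no  _   = 0

  extend-toℕ : ∀ {n} (f : Fin n → ℕ) i → extend f (toℕ i) ≡ f i
  extend-toℕ {n} f i with toℕ i <? n
  ... | yes i<n = cong f (Fin.fromℕ<-toℕ i i<n)
  ... | no  i≮n = contradiction (Fin.toℕ<n i) i≮n

  -- If y were missed, removing it from the codomain would inject `Fin (suc n)` into `Fin n`.
  injective⇒surjective : ∀ {n} (f : Fin n → Fin n) → Injective _≡_ _≡_ f → ∀ y → ∃ λ x → f x ≡ y
  injective⇒surjective {suc n} f inj y with Fin.any? (λ x → f x Fin.≟ y)
  ... | yes found = found
  ... | no  none  =
    let i , j , i<j , eq = Fin.pigeonhole ≤-refl (λ x → punchOut {i = y} {j = f x} (λ y≡fx → none (x , sym y≡fx)))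
    in contradiction (inj (Fin.punchOut-injective {i = y} _ _ eq)) (Fin.<⇒≢ i<j)

  injective⇒permutation : ∀ {n} (f : Fin n → Fin n) → Injective _≡_ _≡_ f → Permutation′ n
  injective⇒permutation f inj = permutation f (λ y → proj₁ (onto y)) (λ y → proj₂ (onto y))
    (λ x → inj (proj₂ (onto (f x))))
    where
    onto : ∀ y → ∃ λ x → f x ≡ y
    onto = injective⇒surjective f inj

  module _ (n : ℕ) (key : ℕ → ℕ) where

    rankOf : ℕ → ℕ
    rankOf j = sumTo n λ l → choose (key j ∸ key l) 1 0

    rankOf-< : ∀ {j} → j < n → rankOf j < n
    rankOf-< {j} j<n = subst (rankOf j <_) (sumTo-ones n)
      (sumTo-strict n (λ l _ → choose-elim (_≤ 1) (key j ∸ key l) ≤-refl z≤n) j<n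
        (subst (λ c → choose c 1 0 < 1) (sym (n∸n≡0 (key j))) ≤-refl))

    -- Every key below that of j is below that of l, and j itself counts for l but not for j.
    rankOf-mono : ∀ {j l} → j < n → key j < key l → rankOf j < rankOf l
    rankOf-mono {j} {l} j<n lt = sumTo-strict n le j<n strict
      where
      positive : ∀ {a b} → a < b → choose (b ∸ a) 1 0 ≡ 1
      positive {a} {b} a<b with b ∸ a in eq
      ... | zero  = contradiction eq (m>n⇒m∸n≢0 a<b)
      ... | suc _ = refl
      le : ∀ i → i < n → choose (key j ∸ key i) 1 0 ≤ choose (key l ∸ key i) 1 0
      le i _ with <-≤-connex (key i) (key l)
      ... | inj₁ i<l rewrite positive i<l = choose-elim (_≤ 1) (key j ∸ key i) ≤-refl z≤n
      ... | inj₂ l≤i rewrite m≤n⇒m∸n≡0 (≤-trans (<⇒≤ lt) l≤i) = z≤n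
      strict : choose (key j ∸ key j) 1 0 < choose (key l ∸ key j) 1 0
      strict rewrite positive lt | n∸n≡0 (key j) = ≤-refl

    rankOf-reflects : ∀ {j l} → l < n → rankOf j ≤ rankOf l → key j ≤ key l
    rankOf-reflects l<n le = ≮⇒≥ λ lt → <⇒≱ (rankOf-mono l<n lt) le

  module Instances {n m : ℕ} (I : Instance n m) (E : ℕ) where

    input : ℕ → ℕ
    input = arr (initial I) 0

    open Execution n m E input

    time-at : ∀ i j → time (toℕ i) (toℕ j) ≡ Instance.p I i j
    time-at i j = trans (cong input layout) at-entry
      where
      layout : toℕ i * n + toℕ j ≡ toℕ (combine i j)
      layout = trans (cong (_+ toℕ j) (*-comm (toℕ i) n)) (sym (Fin.toℕ-combine i j))
      at-entry : input (toℕ (combine i j)) ≡ Instance.p I i j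
      at-entry with toℕ (combine i j) <? m * n
      ... | yes k<mn = trans
        (cong (uncurry (Instance.p I) ∘ remQuot n) (Fin.fromℕ<-toℕ (combine i j) k<mn))
        (cong (uncurry (Instance.p I)) (Fin.remQuot-combine i j))
      ... | no  k≮mn = contradiction (Fin.toℕ<n (combine i j)) k≮mn

    jobCompletion-≡ : ∀ π i j (pos : ℕ → ℕ) → (∀ l → pos (toℕ l) ≡ toℕ (π i ⟨$⟩ʳ l)) →
      jobCompletion I π i j ≡ sumTo n (λ l → choose (pos l ∸ pos (toℕ j)) 0 (time (toℕ i) l))
    jobCompletion-≡ π i j pos eq = trans
      (sum-filter (λ l → (π i ⟨$⟩ʳ l) Fin.≤? (π i ⟨$⟩ʳ j)) (Instance.p I i) (allFin n))
      (sum-allFin n _ _ λ l → trans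
        (if≤-choose (toℕ (π i ⟨$⟩ʳ l) ≤? toℕ (π i ⟨$⟩ʳ j)))
        (choose-cong (sym (cong₂ _∸_ (eq l) (eq j))) refl (sym (time-at i l))))

    clientCompletion-≡ : ∀ π j (C : ℕ → ℕ) → (∀ i → C (toℕ i) ≡ jobCompletion I π i j) →
      clientCompletion I π j ≡ sumTo m C
    clientCompletion-≡ π j C eq = sum-allFin m _ C (sym ∘ eq)

    clientCompletion≤K : ∀ π j → clientCompletion I π j ≤ K I π
    clientCompletion≤K π j =
      lookup (xs≤max 0 (map (clientCompletion I π) (allFin n))) (∈-map⁺ (clientCompletion I π) (∈-allFin j))

    K≤ : ∀ π {v} → (∀ j → clientCompletion I π j ≤ v) → K I π ≤ v
    K≤ π le = max≤v⁺ z≤n (All.map⁺ (All.tabulate⁺ le))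

    module _ (i : ℕ) where

      private
        -- Level and client number are quotient and remainder of the key modulo n, so keys compare
        -- levels first.
        key-< : ∀ {j l} → j < n → key i j ≤ key i l → assigned i j ≤ assigned i l ⊎ n ≤ l
        key-< {j} {l} j<n le with l <? n
        ... | no  l≮n = inj₂ (≮⇒≥ l≮n)
        ... | yes l<n = inj₁ (s≤s⁻¹ (*-cancelʳ-< n _ _ (begin-strict
          assigned i j * n          ≤⟨ m≤m+n _ j ⟩
          key i j                   ≤⟨ le ⟩
          assigned i l * n + l      <⟨ +-monoʳ-< (assigned i l * n) l<n ⟩
          assigned i l * n + n      ≡⟨ +-comm (assigned i l * n) n ⟩
          suc (assigned i l) * n    ∎)))
          where open ≤-Reasoning

        key-injective : ∀ {j l} → j < n → l < n → key i j ≡ key i l → j ≡ l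
        key-injective {j} {l} j<n l<n eq = begin
          j                              ≡⟨ [m+kn]%n≡m (assigned i j) n j<n ⟨
          (j + assigned i j * n) % n     ≡⟨ cong (_% n) (+-comm j _) ⟩
          key i j % n                    ≡⟨ cong (_% n) eq ⟩
          key i l % n                    ≡⟨ cong (_% n) (+-comm _ l) ⟩
          (l + assigned i l * n) % n     ≡⟨ [m+kn]%n≡m (assigned i l) n l<n ⟩
          l                              ∎
          where
          open ≡-Reasoning
          instance
            n≢0 : NonZero n
            n≢0 = >-nonZero (≤-<-trans z≤n j<n)

      rankFin : Fin n → Fin n
      rankFin j = fromℕ< (rankOf-< n (key i) (Fin.toℕ<n j))

      rankFin-toℕ : ∀ j → toℕ (rankFin j) ≡ rank i (toℕ j)
      rankFin-toℕ j = Fin.toℕ-fromℕ< _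

      rankFin-injective : Injective _≡_ _≡_ rankFin
      rankFin-injective {j} {l} eq with <-cmp (key i (toℕ j)) (key i (toℕ l))
      ... | tri≈ _ same _ = Fin.toℕ-injective (key-injective (Fin.toℕ<n j) (Fin.toℕ<n l) same)
      ... | tri< lt _ _   = contradiction (trans (sym (rankFin-toℕ j)) (trans (cong toℕ eq) (rankFin-toℕ l)))
                              (<⇒≢ (rankOf-mono n (key i) (Fin.toℕ<n j) lt))
      ... | tri> _ _ gt   = contradiction (trans (sym (rankFin-toℕ l)) (trans (cong toℕ (sym eq)) (rankFin-toℕ j)))
                              (<⇒≢ (rankOf-mono n (key i) (Fin.toℕ<n l) gt))

      earlier-level : ∀ {j l} → j < n → l < n → rank i l ≤ rank i j → assigned i l ≤ assigned i j
      earlier-level {j} {l} j<n l<n le with key-< l<n (rankOf-reflects n (key i) j<n le)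
      ... | inj₁ a≤  = a≤
      ... | inj₂ n≤j = contradiction n≤j (<⇒≱ j<n)

    schedule : Schedule n m
    schedule i = injective⇒permutation (rankFin (toℕ i)) (rankFin-injective (toℕ i))

    schedule-at : ∀ i j → toℕ (schedule i ⟨$⟩ʳ j) ≡ rank (toℕ i) (toℕ j)
    schedule-at i j = rankFin-toℕ (toℕ i) j

    schedule-outputs : ∀ s → Ranked (arr s) → Outputs s schedule
    schedule-outputs s out i j = trans
      (cong (arr s 1) (trans (Fin.toℕ-combine i j) (cong (_+ toℕ j) (*-comm n (toℕ i)))))
      (trans (out (toℕ i) (toℕ j) (Fin.toℕ<n i) (Fin.toℕ<n j)) (sym (schedule-at i j)))

    -- Jobs are ordered by level, so only jobs of at most the same level are processed up to job j.
    jobCompletion-≤ : ∀ i j → jobCompletion I schedule i j ≤ loadUpTo assigned (toℕ i) (assigned (toℕ i) (toℕ j)) n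
    jobCompletion-≤ i j = ≤-trans
      (≤-reflexive (jobCompletion-≡ schedule i j (rank (toℕ i)) (λ l → sym (schedule-at i l))))
      (sumTo-mono n pointwise)
      where
      pointwise : ∀ l → l < n →
        choose (rank (toℕ i) l ∸ rank (toℕ i) (toℕ j)) 0 (time (toℕ i) l) ≤
        choose (assigned (toℕ i) l ∸ assigned (toℕ i) (toℕ j)) 0 (time (toℕ i) l)
      pointwise l l<n with rank (toℕ i) l ∸ rank (toℕ i) (toℕ j) in eq
      ... | suc _ = z≤n
      ... | zero rewrite m≤n⇒m∸n≡0 (earlier-level (toℕ i) (Fin.toℕ<n j) l<n (m∸n≡0⇒m≤n eq)) = ≤-refl

    module Optimum (0<n : 0 < n) (π* : Schedule n m) where

      position : Fin m → ℕ → ℕ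
      position i = extend (toℕ ∘ (π* i ⟨$⟩ʳ_))

      C : ℕ → ℕ → ℕ
      C i j = extend (λ i′ → extend (jobCompletion I π* i′) j) i

      C-at : ∀ i j → C (toℕ i) (toℕ j) ≡ jobCompletion I π* i j
      C-at i j = trans (extend-toℕ _ i) (extend-toℕ (jobCompletion I π* i) j)

      C-sum : ∀ i j → C (toℕ i) (toℕ j) ≡
        sumTo n (λ l → choose (position i l ∸ position i (toℕ j)) 0 (time (toℕ i) l))
      C-sum i j = trans (C-at i j) (jobCompletion-≡ π* i j (position i) (extend-toℕ _))

      C-client : ∀ j → sumTo m (λ i → C i (toℕ j)) ≡ clientCompletion I π* j
      C-client j = sym (clientCompletion-≡ π* j _ (λ i → C-at i j))

      C≤total : ∀ i j → i < m → j < n → C i j ≤ total i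
      C≤total i j i<m j<n = on-Fin (λ i → C i j ≤ total i)
        (λ i → on-Fin (λ j → C (toℕ i) j ≤ total (toℕ i))
          (λ j → ≤-trans (≤-reflexive (C-sum i j)) (sumTo-mono n λ l _ →
            choose-elim (_≤ time (toℕ i) l) (position i l ∸ position i (toℕ j)) z≤n ≤-refl)) j j<n) i i<m

      C≤K* : ∀ j → j < n → sumTo m (λ i → C i j) ≤ K I π*
      C≤K* = on-Fin _ λ j → ≤-trans (≤-reflexive (C-client j)) (clientCompletion≤K π* j)

      -- `latest` searches the clients of level at most k for the one in last position. If there is
      -- none the load is 0; otherwise its completion time covers all their jobs.
      last-job : ∀ i (κ : ℕ → ℕ) k s b → i < m → (∀ j → j < n → κ j ≤ k → s * C i j ≤ b) →
                 s * sumTo n (λ j → choose (κ j ∸ k) 0 (time i j)) ≤ b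
      last-job i κ k s b i<m = on-Fin
        (λ i → (∀ j → j < n → κ j ≤ k → s * C i j ≤ b) →
               s * sumTo n (λ j → choose (κ j ∸ k) 0 (time i j)) ≤ b) day i i<m
        where
        day : ∀ i → (∀ j → j < n → κ j ≤ k → s * C (toℕ i) j ≤ b) →
              s * sumTo n (λ j → choose (κ j ∸ k) 0 (time (toℕ i) j)) ≤ b
        day i early with latest n
          where
          latest : ∀ t → (∀ l → l < t → k < κ l) ⊎
                   ∃ λ j → j < t × κ j ≤ k × (∀ l → l < t → κ l ≤ k → position i l ≤ position i j)
          latest zero = inj₁ λ _ ()
          latest (suc t) with latest t | <-≤-connex k (κ t)
          ... | inj₁ none | inj₁ k<κt = inj₁ below
            where
            below : ∀ l → l < suc t → k < κ l
            below l l< with m≤n⇒m<n∨m≡n (s≤s⁻¹ l<)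
            ... | inj₁ l<t  = none l l<t
            ... | inj₂ refl = k<κt
          ... | inj₁ none | inj₂ κt≤k = inj₂ (t , ≤-refl , κt≤k , below)
            where
            below : ∀ l → l < suc t → κ l ≤ k → position i l ≤ position i t
            below l l< κl≤k with m≤n⇒m<n∨m≡n (s≤s⁻¹ l<)
            ... | inj₁ l<t  = contradiction κl≤k (<⇒≱ (none l l<t))
            ... | inj₂ refl = ≤-refl
          ... | inj₂ (j , j<t , κj≤k , top-j) | inj₁ k<κt = inj₂ (j , m≤n⇒m≤1+n j<t , κj≤k , below)
            where
            below : ∀ l → l < suc t → κ l ≤ k → position i l ≤ position i j
            below l l< κl≤k with m≤n⇒m<n∨m≡n (s≤s⁻¹ l<)
            ... | inj₁ l<t  = top-j l l<t κl≤k
            ... | inj₂ refl = contradiction κl≤k (<⇒≱ k<κt)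
          ... | inj₂ (j , j<t , κj≤k , top-j) | inj₂ κt≤k with ≤-total (position i j) (position i t)
          ...   | inj₁ j≤t = inj₂ (t , ≤-refl , κt≤k , below)
            where
            below : ∀ l → l < suc t → κ l ≤ k → position i l ≤ position i t
            below l l< κl≤k with m≤n⇒m<n∨m≡n (s≤s⁻¹ l<)
            ... | inj₁ l<t  = ≤-trans (top-j l l<t κl≤k) j≤t
            ... | inj₂ refl = ≤-refl
          ...   | inj₂ t≤j = inj₂ (j , m≤n⇒m≤1+n j<t , κj≤k , below)
            where
            below : ∀ l → l < suc t → κ l ≤ k → position i l ≤ position i j
            below l l< κl≤k with m≤n⇒m<n∨m≡n (s≤s⁻¹ l<)
            ... | inj₁ l<t  = top-j l l<t κl≤k
            ... | inj₂ refl = t≤j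
        ... | inj₁ none = ≤-trans (≤-reflexive (trans
          (cong (s *_) (sumTo-zero n _ λ l l<n → empty l (none l l<n))) (*-zeroʳ s))) z≤n
          where
          empty : ∀ l → k < κ l → choose (κ l ∸ k) 0 (time (toℕ i) l) ≡ 0
          empty l k< with κ l ∸ k in eq
          ... | zero  = contradiction eq (m>n⇒m∸n≢0 k<)
          ... | suc _ = refl
        ... | inj₂ (j , j<n , κj≤k , top-j) = ≤-trans (*-monoʳ-≤ s covered) (early j j<n κj≤k)
          where
          inside : ∀ l → l < n → choose (κ l ∸ k) 0 (time (toℕ i) l) ≤
                   choose (position i l ∸ position i j) 0 (time (toℕ i) l)
          inside l l<n with κ l ∸ k in eq
          ... | suc _ = z≤n
          ... | zero rewrite m≤n⇒m∸n≡0 (top-j l l<n (m∸n≡0⇒m≤n eq)) = ≤-refl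
          covered : sumTo n (λ l → choose (κ l ∸ k) 0 (time (toℕ i) l)) ≤ C (toℕ i) j
          covered = ≤-trans (sumTo-mono n inside) (on-Fin
            (λ j → sumTo n (λ l → choose (position i l ∸ position i j) 0 (time (toℕ i) l)) ≤ C (toℕ i) j)
            (λ j → ≤-reflexive (sym (C-sum i j))) j j<n)

      -- With a constant level every client counts, so `last-job` speaks of the client who is last
      -- on day i and completes at the day's total.
      total≤K* : ∀ i → i < m → total i ≤ K I π*
      total≤K* i i<m = ≤-trans (≤-reflexive (sym (*-identityˡ (total i))))
        (last-job i (λ _ → 0) 0 1 (K I π*) i<m λ j j<n _ → ≤-trans (≤-reflexive (*-identityˡ (C i j)))
          (≤-trans (term≤sumTo m (λ i → C i j) i<m) (C≤K* j j<n)))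

      total>0 : ∀ i → i < m → 0 < total i
      total>0 = on-Fin (λ i → 0 < total i) λ i → <-≤-trans
        (on-Fin {n} (λ j → 0 < time (toℕ i) j) (λ j → subst (0 <_) (sym (time-at i j)) (p>0 I i j)) 0 0<n)
        (term≤sumTo n (time (toℕ i)) 0<n)

      open Complete (logUp-lower (m * e)) C (K I π*) C≤total total≤K* C≤K* last-job total>0

      client-≤ : ∀ j → e * clientCompletion I schedule j ≤ (5 + e) * K I π*
      client-≤ j = ≤-trans
        (*-monoʳ-≤ e (≤-trans (≤-reflexive (clientCompletion-≡ schedule j
            (extend (λ i → jobCompletion I schedule i j)) (extend-toℕ _)))
          (sumTo-mono m (on-Fin
            (λ i → extend (λ i → jobCompletion I schedule i j) i ≤ loadUpTo assigned i (assigned i (toℕ j)) n)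
            λ i → ≤-trans (≤-reflexive (extend-toℕ _ i)) (jobCompletion-≤ i j)))))
        (near-optimal (toℕ j) (Fin.toℕ<n j))

      schedule-≤ : e * K I schedule ≤ (5 + e) * K I π*
      schedule-≤ = ≤-trans
        -- Bounding the maximum takes a natural number that bounds each client; the rounded quotient
        -- by e is one.
        (*-monoʳ-≤ e (K≤ schedule {((5 + e) * K I π*) / e} λ j →
          ≤-trans (≤-reflexive (sym (m*n/n≡m (clientCompletion I schedule j) e)))
            (/-monoˡ-≤ e (≤-trans (≤-reflexive (*-comm _ e)) (client-≤ j)))))
        (≤-trans (≤-reflexive (*-comm e _)) (m/n*n≤m ((5 + e) * K I π*) e))

-- Bounding the largest global variable

module Growth where

  open Code
  open Programs
  open Language using (choose)
  open import Data.Nat.Induction using (<-wellFounded)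
  open import Data.Nat.Logarithm
  open import Data.Nat.Tactic.RingSolver using (solve-∀)
  open import Induction.WellFounded using (Acc; acc)

  ⌈log₂⌉>0 : ∀ {g} → 2 ≤ g → 1 ≤ ⌈log₂ g ⌉
  ⌈log₂⌉>0 2≤g = ≤-trans (≤-reflexive (sym (⌈log₂2^n⌉≡n 1))) (⌈log₂⌉-mono-≤ 2≤g)

  n≤2^⌈log₂n⌉ : ∀ n → n ≤ 2 ^ ⌈log₂ n ⌉
  n≤2^⌈log₂n⌉ n = go n (<-wellFounded n)
    where
    go : ∀ n → Acc _<_ n → n ≤ 2 ^ ⌈log₂ n ⌉
    go zero          _         = z≤n
    go (suc zero)    _         = m^n>0 2 ⌈log₂ 1 ⌉
    go n@(suc (suc k)) (acc rec) = begin
      n                                  ≡⟨ ⌊n/2⌋+⌈n/2⌉≡n n ⟨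
      ⌊ n /2⌋ + ⌈ n /2⌉                  ≤⟨ +-monoˡ-≤ ⌈ n /2⌉ (⌊n/2⌋≤⌈n/2⌉ n) ⟩
      ⌈ n /2⌉ + ⌈ n /2⌉                  ≤⟨ +-mono-≤ ih ih ⟩
      2 ^ (⌈log₂ n ⌉ ∸ 1) + 2 ^ (⌈log₂ n ⌉ ∸ 1)
                                         ≡⟨ cong (2 ^ (⌈log₂ n ⌉ ∸ 1) +_) (+-identityʳ _) ⟨
      2 ^ suc (⌈log₂ n ⌉ ∸ 1)            ≡⟨ cong (2 ^_) (m+[n∸m]≡n {1} {⌈log₂ n ⌉} (⌈log₂⌉>0 {n} (s≤s (s≤s z≤n)))) ⟩
      2 ^ ⌈log₂ n ⌉                      ∎
      where
      open ≤-Reasoning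
      ih : ⌈ n /2⌉ ≤ 2 ^ (⌈log₂ n ⌉ ∸ 1)
      ih = subst (λ l → ⌈ n /2⌉ ≤ 2 ^ l) (⌈log₂⌈n/2⌉⌉≡⌈log₂n⌉∸1 n) (go ⌈ n /2⌉ (rec (⌈n/2⌉<n k)))

  module CapBound (n m e′ ℓ : ℕ) (input : ℕ → ℕ) (q H : ℕ)
    (ℓ≤q : ℓ ≤ q) (me≤H : m * suc e′ ≤ H) (e≤H : suc e′ ≤ H) (H≤ : H ≤ 2 ^ q)
    where

    open Semantics n m e′ ℓ input

    -- With Q = base^q, e is at most Q and ℓ e at most Q², so `suc resolution` is at most 4 base Q²,
    -- hence at most base³ Q²: this is base^`small`. The factor (2 + q) H bounds the number of
    -- digits.
    base small exponent : ℕ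
    base     = 2 ⊔ n
    small    = 3 + (q + q)
    exponent = small * ((2 + q) * H)

    private
      2≤base : 2 ≤ base
      2≤base = m≤m⊔n 2 n

      instance
        base≢0 : NonZero base
        base≢0 = >-nonZero (≤-trans (s≤s z≤n) 2≤base)

      n≤base : n ≤ base
      n≤base = m≤n⊔m 2 n

      Q : ℕ
      Q = base ^ q

      H≤Q : H ≤ Q
      H≤Q = ≤-trans H≤ (^-monoˡ-≤ q 2≤base)

      q≤Q : q ≤ Q
      q≤Q = ≤-trans (<⇒≤ (n<2^n q)) (^-monoˡ-≤ q 2≤base)

      1≤Q : 1 ≤ Q
      1≤Q = m^n>0 base q

      m≤me : m ≤ m * e
      m≤me = m≤m*n m e

      1≤H : 1 ≤ H
      1≤H = ≤-trans (s≤s z≤n) e≤H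

      small-^ : base ^ small ≡ base * (base * (base * (Q * Q)))
      small-^ = cong (λ z → base * (base * (base * z))) (^-distribˡ-+-* base q q)

      scaled : ∀ {x y} → x ≤ base → y ≤ Q * Q → x * y ≤ base ^ small
      scaled {x} {y} x≤ y≤ = ≤-trans (*-mono-≤ x≤ y≤) (≤-trans
        (*-monoʳ-≤ base (≤-trans (m≤n*m (Q * Q) base) (*-monoʳ-≤ base (m≤n*m (Q * Q) base))))
        (≤-reflexive (sym small-^)))

      below-small : ∀ {y} → y ≤ Q * Q → y ≤ base ^ small
      below-small {y} y≤ = ≤-trans (≤-reflexive (sym (*-identityˡ y)))
        (scaled (≤-trans (s≤s z≤n) 2≤base) y≤)

      Q≤QQ : Q ≤ Q * Q
      Q≤QQ = ≤-trans (≤-reflexive (sym (*-identityʳ Q))) (*-monoʳ-≤ Q 1≤Q)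

      base-^₃ : 4 * (base * (Q * Q)) ≤ base ^ small
      base-^₃ = ≤-trans (≤-trans
        (*-monoˡ-≤ (base * (Q * Q)) (*-mono-≤ 2≤base 2≤base))
        (≤-reflexive (*-assoc base base (base * (Q * Q))))) (≤-reflexive (sym small-^))

      one-≤ : 1 ≤ base * (Q * Q)
      one-≤ = *-mono-≤ (≤-trans (s≤s z≤n) 2≤base) (*-mono-≤ 1≤Q 1≤Q)

      top≤QQ : top ≤ Q * Q
      top≤QQ = *-mono-≤ (≤-trans ℓ≤q q≤Q) (≤-trans e≤H H≤Q)

      base₊ : suc resolution ≤ base ^ small
      base₊ = begin
        suc resolution                                ≡⟨ cong suc (+-suc (n * e) top) ⟩
        2 + (n * e + top)                             ≤⟨ +-monoʳ-≤ 2 (+-mono-≤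
          (*-mono-≤ n≤base (≤-trans (≤-trans e≤H H≤Q) Q≤QQ))
          (≤-trans top≤QQ (m≤n*m (Q * Q) base))) ⟩
        2 + (base * (Q * Q) + base * (Q * Q))         ≤⟨ +-monoˡ-≤ _ (*-monoʳ-≤ 2 one-≤) ⟩
        2 * (base * (Q * Q)) + (base * (Q * Q) + base * (Q * Q))
                                                      ≡⟨ lemma (base * (Q * Q)) ⟩
        4 * (base * (Q * Q))                          ≤⟨ base-^₃ ⟩
        base ^ small                                  ∎
        where
        open ≤-Reasoning
        lemma : ∀ x → 2 * x + (x + x) ≡ 4 * x
        lemma = solve-∀

      positions≤ : positions ≤ (2 + q) * H
      positions≤ = begin
        m * (2 + ℓ * e)        ≡⟨ lemma m ℓ e ⟩
        2 * m + ℓ * (m * e)    ≤⟨ +-mono-≤ (*-monoʳ-≤ 2 (≤-trans m≤me me≤H)) (*-mono-≤ ℓ≤q me≤H) ⟩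
        2 * H + q * H          ≡⟨ *-distribʳ-+ H 2 q ⟨
        (2 + q) * H            ∎
        where
        open ≤-Reasoning
        lemma : ∀ m l e → m * (2 + l * e) ≡ 2 * m + l * (m * e)
        lemma = solve-∀

      -- The extra 2 is for `cells`, since n + 1 is at most base².
      W : ℕ
      W = base ^ (2 + exponent)

      states≤ : states ≤ base ^ exponent
      states≤ = begin
        suc resolution ^ positions            ≤⟨ ^-monoˡ-≤ positions base₊ ⟩
        (base ^ small) ^ positions            ≡⟨ ^-*-assoc base small positions ⟩
        base ^ (small * positions)            ≤⟨ ^-monoʳ-≤ base (*-monoʳ-≤ small positions≤) ⟩
        base ^ exponent                       ∎
        where open ≤-Reasoning

      exponent≤W : base ^ exponent ≤ W
      exponent≤W = ^-monoʳ-≤ base (m≤n+m exponent 2)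

      small≤W : base ^ small ≤ W
      small≤W = ≤-trans (^-monoʳ-≤ base (≤-trans (≤-reflexive (sym (*-identityʳ small)))
        (*-monoʳ-≤ small (*-mono-≤ (s≤s (z≤n {1 + q})) 1≤H)))) exponent≤W

      small-W : ∀ {y} → y ≤ Q * Q → y ≤ W
      small-W y≤ = ≤-trans (below-small y≤) small≤W

      m≤Q : m ≤ Q
      m≤Q = ≤-trans (≤-trans m≤me me≤H) H≤Q

      n-W : n ≤ W
      n-W = ≤-trans (≤-trans (≤-reflexive (sym (*-identityʳ n))) (scaled n≤base (*-mono-≤ 1≤Q 1≤Q))) small≤W
      m-W : m ≤ W
      m-W = small-W (≤-trans m≤Q Q≤QQ)
      product-W : product ≤ W
      product-W = small-W (≤-trans (≤-trans me≤H H≤Q) Q≤QQ)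
      ℓ-W : ℓ ≤ W
      ℓ-W = small-W (≤-trans (≤-trans ℓ≤q q≤Q) Q≤QQ)
      states-W : states ≤ W
      states-W = ≤-trans states≤ exponent≤W
      positions-W : positions ≤ W
      positions-W = ≤-trans (≤-trans (<⇒≤ (n<2^n positions))
        (^-monoˡ-≤ positions (s≤s (≤-trans (s≤s z≤n) (m≤n+m levels (n * e)))))) states-W
      cells-W : cells ≤ W
      cells-W = begin
        suc n * states                   ≤⟨ *-mono-≤ 1+n≤ states≤ ⟩
        base * base * base ^ exponent    ≡⟨ *-assoc base base _ ⟩
        W                                ∎
        where
        open ≤-Reasoning
        1+n≤ : suc n ≤ base * base
        1+n≤ = ≤-trans (+-mono-≤ (≤-trans (s≤s z≤n) 2≤base) n≤base)
          (≤-trans (≤-reflexive (cong (base +_) (sym (+-identityʳ base)))) (*-monoˡ-≤ base 2≤base))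
      scale-W : scale ≤ W
      scale-W = small-W (*-mono-≤ (≤-trans (^-monoʳ-≤ 2 ℓ≤q) (^-monoˡ-≤ q 2≤base)) (≤-trans e≤H H≤Q))
      entries-W : entries ≤ W
      entries-W = ≤-trans (≤-trans (≤-reflexive (*-comm m n)) (scaled n≤base (≤-trans m≤Q Q≤QQ))) small≤W
      e-W : e ≤ W
      e-W = small-W (≤-trans (≤-trans e≤H H≤Q) Q≤QQ)
      top-W : top ≤ W
      top-W = small-W top≤QQ
      resolution-W : resolution + 1 ≤ W
      resolution-W = ≤-trans (≤-trans (≤-reflexive (+-comm resolution 1)) base₊) small≤W
      levels-W : levels ≤ W
      levels-W = ≤-trans (m≤n+m levels (n * e)) (≤-trans (m≤m+n resolution 1) resolution-W)

    cap-≤ : cap ≤ base ^ (6 + exponent)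
    cap-≤ = begin
      cap                      ≤⟨ +-mono-≤ n-W (+-mono-≤ m-W (+-mono-≤ product-W (+-mono-≤ ℓ-W
        (+-mono-≤ positions-W (+-mono-≤ states-W (+-mono-≤ cells-W (+-mono-≤ scale-W
        (+-mono-≤ entries-W (+-mono-≤ e-W (+-mono-≤ top-W (+-mono-≤ levels-W resolution-W))))))))))) ⟩
      _                        ≡⟨ lemma W ⟩
      -- Thirteen summands, rounded up to 2^4, add 4 to the exponent.
      13 * W                   ≤⟨ *-monoˡ-≤ W (m≤m+n 13 3) ⟩
      2 ^ 4 * W                ≤⟨ *-monoˡ-≤ W (^-monoˡ-≤ 4 2≤base) ⟩
      base ^ 4 * W             ≡⟨ ^-distribˡ-+-* base 4 (2 + exponent) ⟨
      base ^ (6 + exponent)    ∎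
      where
      open ≤-Reasoning
      lemma : ∀ w → w + (w + (w + (w + (w + (w + (w + (w + (w + (w + (w + (w + w))))))))))) ≡ 13 * w
      lemma = solve-∀

  -- With q = 2 c l and H = c g.
  exponent-≤ : ∀ c g l → 1 ≤ c → 2 ≤ g → 1 ≤ l →
    6 + (3 + (2 * c * l + 2 * c * l)) * ((2 + 2 * c * l) * (c * g)) ≤ 36 * c ^ 3 * g * l ^ 2
  exponent-≤ (suc c) (suc (suc g)) (suc l) _ (s≤s (s≤s _)) _ = begin
    6 + (3 + (q + q)) * ((2 + q) * H)            ≤⟨ +-mono-≤ six (*-mono-≤ {3 + (q + q)} {4 * q} three (*-monoˡ-≤ H two)) ⟩
    q * q * H + 4 * q * (2 * q * H)              ≡⟨ lemma (suc c) (2 + g) (suc l) ⟩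
    36 * suc c ^ 3 * (2 + g) * suc l ^ 2         ∎
    where
    open ≤-Reasoning
    q H : ℕ
    q = 2 * suc c * suc l
    H = suc c * (2 + g)
    2≤q : 2 ≤ q
    2≤q = *-mono-≤ {2} {2 * suc c} {1} {suc l} (*-monoʳ-≤ 2 (s≤s z≤n)) (s≤s z≤n)
    2≤H : 2 ≤ H
    2≤H = *-mono-≤ {1} {suc c} {2} {2 + g} (s≤s z≤n) (s≤s (s≤s z≤n))
    six : 6 ≤ q * q * H
    six = ≤-trans (m≤m+n 6 2) (*-mono-≤ (*-mono-≤ 2≤q 2≤q) 2≤H)
    two : 2 + q ≤ 2 * q
    two = ≤-trans (+-monoˡ-≤ q 2≤q) (≤-reflexive (cong (q +_) (sym (+-identityʳ q))))
    three : 3 + (q + q) ≤ 4 * q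
    three = ≤-trans (+-monoˡ-≤ (q + q) (≤-trans (m≤m+n 3 1) (*-monoʳ-≤ 2 2≤q))) (≤-reflexive (lemma′ q))
      where
      lemma′ : ∀ q → 2 * q + (q + q) ≡ 4 * q
      lemma′ = solve-∀
    lemma : ∀ c g l → 2 * c * l * (2 * c * l) * (c * g) + 4 * (2 * c * l) * (2 * (2 * c * l) * (c * g))
            ≡ 36 * (c * (c * (c * 1))) * g * (l * (l * 1))
    lemma = solve-∀

  module _ (n m E c g : ℕ) (input : ℕ → ℕ)
    (1≤c : 1 ≤ c) (2≤g : 2 ≤ g)
    (me≤ : m * suc (choose m E 0) ≤ c * g) (e≤ : suc (choose m E 0) ≤ c * g) where

    open Execution n m E input using (cap; ℓ)

    private
      l : ℕ
      l = ⌈log₂ g ⌉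
      1≤l : 1 ≤ l
      1≤l = ⌈log₂⌉>0 2≤g
      -- The crude c < 2^c is affordable, as c depends on ε alone and ends up in the hidden
      -- constant.
      H≤ : c * g ≤ 2 ^ (2 * c * l)
      H≤ = begin
        c * g               ≤⟨ *-mono-≤ (<⇒≤ (n<2^n c)) (n≤2^⌈log₂n⌉ g) ⟩
        2 ^ c * 2 ^ l       ≡⟨ ^-distribˡ-+-* 2 c l ⟨
        2 ^ (c + l)         ≤⟨ ^-monoʳ-≤ 2 (+-mono-≤ (c≤ c l 1≤l) (l≤ c l 1≤c)) ⟩
        2 ^ (c * l + c * l) ≡⟨ cong (2 ^_) (lemma c l) ⟩
        2 ^ (2 * c * l)     ∎
        where
        open ≤-Reasoning
        c≤ : ∀ c l → 1 ≤ l → c ≤ c * l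
        c≤ c l 1≤l = m≤m*n c l {{>-nonZero 1≤l}}
        l≤ : ∀ c l → 1 ≤ c → l ≤ c * l
        l≤ c l 1≤c = m≤n*m l c {{>-nonZero 1≤c}}
        lemma : ∀ c l → c * l + c * l ≡ 2 * c * l
        lemma = solve-∀

    -- The 36 is 9 · 4: `exponent-≤` arrives at 9 q² H, where q = 2 c l.
    cap-bound : cap ≤ (2 ⊔ n) ^ (36 * c ^ 3 * g * l ^ 2)
    cap-bound = ≤-trans
      (CapBound.cap-≤ n m (choose m E 0) ℓ input (2 * c * l) (c * g)
        (logUp-upper (m * suc (choose m E 0)) (2 * c * l) (≤-trans me≤ H≤)) me≤ e≤ H≤)
      (^-monoʳ-≤ (2 ⊔ n) {{>-nonZero (≤-trans (s≤s z≤n) (m≤m⊔n 2 n))}} (exponent-≤ c g l 1≤c 2≤g 1≤l))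

-- Rational ε: choice of the precision, hidden constants and the final bounds

module Approximation where

  open Language
  open Statements
  open Programs
  open Schedules
  open Growth
  open import Data.Integer.Base as ℤ using (+_; +[1+_]; -[1+_]; +≤+; -≤+)
  import Data.Integer.DivMod as ℤ
  import Data.Integer.Properties as ℤ
  open import Data.Fin.Base using (zero; suc; toℕ)
  open import Data.Nat.Coprimality using (Coprime)
  open import Data.Nat.DivMod
  open import Data.Nat.Logarithm using (⌈log₂_⌉)
  open import Data.Nat.Tactic.RingSolver using (solve-∀)
  open import Data.Product.Base using (Σ-syntax; _×_; _,_; proj₁; proj₂)
  open import Data.Rational.Base as ℚ using (ℚ; mkℚ; 1ℚ; Positive; ↥_; ↧_; toℚᵘ; *≤*)
  import Data.Rational.Properties as ℚ
  open import Data.Rational.Unnormalised.Base as ℚᵘ using (ℚᵘ; mkℚᵘ)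
  import Data.Rational.Unnormalised.Properties as ℚᵘ
  open import Data.Vec.Base using (lookup)
  open import Data.Vec.Properties using (lookup-replicate)

  i≤∣i∣ : ∀ i → i ℤ.≤ + ℤ.∣ i ∣
  i≤∣i∣ (+ n)    = ℤ.≤-refl
  i≤∣i∣ -[1+ n ] = -≤+

  floor-≤ : ∀ p → ℚ.⌊ p ⌋ ℤ.* ↧ p ℤ.≤ ↥ p
  floor-≤ p@record{} = ℤ.[n/d]*d≤n (↥ p) (↧ p)

  -- The ceiling is minus the floor of -p, so the bound for the floor is negated; the absolute value
  -- can only enlarge the result.
  ≤-∣ceiling∣ : ∀ p → ↥ p ℤ.≤ + ℤ.∣ ℚ.⌈ p ⌉ ∣ ℤ.* ↧ p
  ≤-∣ceiling∣ p@record{} = begin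
    ↥ p                                ≡⟨ ℤ.neg-involutive (↥ p) ⟨
    ℤ.- (ℤ.- ↥ p)                      ≡⟨ cong ℤ.-_ (ℚ.↥-neg p) ⟨
    ℤ.- (↥ (ℚ.- p))                    ≤⟨ ℤ.neg-mono-≤ (floor-≤ (ℚ.- p)) ⟩
    ℤ.- (ℚ.⌊ ℚ.- p ⌋ ℤ.* ↧ (ℚ.- p))    ≡⟨ cong (λ d → ℤ.- (ℚ.⌊ ℚ.- p ⌋ ℤ.* d)) (ℚ.↧-neg p) ⟩
    ℤ.- (ℚ.⌊ ℚ.- p ⌋ ℤ.* ↧ p)          ≡⟨ ℤ.neg-distribˡ-* ℚ.⌊ ℚ.- p ⌋ (↧ p) ⟩
    ℚ.⌈ p ⌉ ℤ.* ↧ p                    ≤⟨ ℤ.*-monoʳ-≤-nonNeg (↧ p) (i≤∣i∣ ℚ.⌈ p ⌉) ⟩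
    + ℤ.∣ ℚ.⌈ p ⌉ ∣ ℤ.* ↧ p            ∎
    where open ℤ.≤-Reasoning

  fraction-≤ : ∀ {x y d d′} → x * suc d′ ≤ y * suc d → mkℚᵘ (+ x) d ℚᵘ.≤ mkℚᵘ (+ y) d′
  fraction-≤ {x} {y} {d} {d′} le =
    ℚᵘ.*≤* (subst₂ ℤ._≤_ (ℤ.pos-* x (suc d′)) (ℤ.pos-* y (suc d)) (+≤+ le))

  fraction-≤⁻¹ : ∀ {x y d d′} → mkℚᵘ (+ x) d ℚᵘ.≤ mkℚᵘ (+ y) d′ → x * suc d′ ≤ y * suc d
  fraction-≤⁻¹ {x} {y} {d} {d′} (ℚᵘ.*≤* le) =
    ℤ.drop‿+≤+ (subst₂ ℤ._≤_ (sym (ℤ.pos-* x (suc d′))) (sym (ℤ.pos-* y (suc d))) le)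

  ℕ→ℚ-≃ : ∀ k → toℚᵘ (ℕ→ℚ k) ℚᵘ.≃ mkℚᵘ (+ k) 0
  ℕ→ℚ-≃ k = ℚ.toℚᵘ-fromℚᵘ (mkℚᵘ (+ k) 0)

  ceiling-≤ : ∀ p {g} → ℤ.∣ ℚ.⌈ p ⌉ ∣ ≤ g → p ℚ.≤ ℕ→ℚ g
  ceiling-≤ p@record{} {g} le = ℚ.toℚᵘ-cancel-≤ (begin
    toℚᵘ p          ≤⟨ ℚᵘ.*≤* (ℤ.≤-trans (ℤ.≤-reflexive (ℤ.*-identityʳ (↥ p)))
      (ℤ.≤-trans (≤-∣ceiling∣ p) (ℤ.*-monoʳ-≤-nonNeg (↧ p) (+≤+ le)))) ⟩
    mkℚᵘ (+ g) 0    ≃⟨ ℕ→ℚ-≃ g ⟨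
    toℚᵘ (ℕ→ℚ g)    ∎)
    where open ℚᵘ.≤-Reasoning

  -- 1 + ⌊ε⌋ for ε ≥ 0.
  roundUp : ℚ → ℕ
  roundUp (mkℚ (+ a)    d _) = suc (a / suc d)
  roundUp (mkℚ -[1+ _ ] d _) = 1

  roundUp-mono : ∀ {ε ε′} → ε ℚ.≤ ε′ → roundUp ε ≤ roundUp ε′
  roundUp-mono {mkℚ -[1+ _ ] d _} {mkℚ (+ a)    d′ _} _        = s≤s z≤n
  roundUp-mono {mkℚ -[1+ _ ] d _} {mkℚ -[1+ _ ] d′ _} _        = ≤-refl
  roundUp-mono {mkℚ (+ a)    d _} {mkℚ -[1+ b ] d′ _} (*≤* le) with ℤ.≤-trans (ℤ.≤-reflexive (ℤ.pos-* a (suc d′))) le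
  ... | ()
  roundUp-mono {mkℚ (+ a)    d _} {mkℚ (+ b)    d′ _} (*≤* le) = s≤s (begin
    a / suc d                          ≡⟨ m*n/n≡m (a / suc d) (suc d′) ⟨
    a / suc d * suc d′ / suc d′        ≤⟨ /-monoˡ-≤ (suc d′) (*-cancelʳ-≤ (a / suc d * suc d′) b (suc d) (begin
      a / suc d * suc d′ * suc d         ≡⟨ lemma (a / suc d) (suc d′) (suc d) ⟩
      a / suc d * suc d * suc d′         ≤⟨ *-monoˡ-≤ (suc d′) (m/n*n≤m a (suc d)) ⟩
      a * suc d′                         ≤⟨ fraction-≤⁻¹ {a} {b} {d} {d′} (ℚᵘ.*≤* le) ⟩
      b * suc d                          ∎)) ⟩
    b / suc d′                         ∎)
    where
    open ≤-Reasoning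
    lemma : ∀ x y z → x * y * z ≡ x * z * y
    lemma = solve-∀

  roundUp>0 : ∀ ε → 1 ≤ roundUp ε
  roundUp>0 (mkℚ (+ a)    d _) = s≤s z≤n
  roundUp>0 (mkℚ -[1+ _ ] d _) = ≤-refl

  -- With u = `roundUp ε` above ε and g at least m/ε², m is at most g u² and m/ε at most g u. Hence
  -- 5 m (⌊1/ε⌋ + 1) is at most 10 u² g, and the multiplier of g is monotone in ε, as a hidden
  -- constant must be.
  factor : ℚ → ℕ
  factor ε = 10 * (roundUp ε * roundUp ε)

  factor-mono : ∀ {ε ε′} → ε ℚ.≤ ε′ → factor ε ≤ factor ε′
  factor-mono {ε} {ε′} le = *-monoʳ-≤ 10 (*-mono-≤ (roundUp-mono {ε} {ε′} le) (roundUp-mono {ε} {ε′} le))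

  opaque
    coefficient degree : ℕ
    coefficient = proj₁ (costAll-poly (program 0))
    degree      = proj₁ (proj₂ (costAll-poly (program 0)))

    costAll-≤ : ∀ X → 1 ≤ X → costAll (program 0) X ≤ coefficient * X ^ degree
    costAll-≤ = proj₂ (proj₂ (costAll-poly (program 0)))

  constant exponentConstant : HiddenConstant
  constant = record { at = λ _ → coefficient ; mono = λ _ → ≤-refl }
  exponentConstant = record
    { at   = λ ε → 36 * factor ε ^ 3 * degree
    ; mono = λ {ε} {ε′} le → *-monoˡ-≤ degree (*-monoʳ-≤ 36 (^-monoˡ-≤ 3 (factor-mono {ε} {ε′} le)))
    }

  -- ε = a/b, w = ⌊1/ε⌋, u = 1 + ⌊ε⌋, g ≥ m/ε²
  size-≤ : ∀ m g u w a b .{{_ : NonZero a}} .{{_ : NonZero b}} →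
           m * (b * b) ≤ g * (a * a) → a ≤ u * b → w * a ≤ b → 1 ≤ u →
           m * (5 * suc w) ≤ 10 * (u * u) * g
  size-≤ m g u w a b size a≤ub wa≤b 1≤u = begin
    m * (5 * suc w)                  ≡⟨ lemma₁ m w ⟩
    5 * (m + m * w)                  ≤⟨ *-monoʳ-≤ 5 (+-mono-≤ m≤ mw≤) ⟩
    5 * (g * (u * u) + g * u)        ≤⟨ *-monoʳ-≤ 5 (+-monoʳ-≤ (g * (u * u)) (*-monoʳ-≤ g (m≤m*n u u {{>-nonZero 1≤u}}))) ⟩
    5 * (g * (u * u) + g * (u * u))  ≡⟨ lemma₂ g u ⟩
    10 * (u * u) * g                 ∎
    where
    open ≤-Reasoning
    lemma₁ : ∀ m w → m * (5 * suc w) ≡ 5 * (m + m * w)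
    lemma₁ = solve-∀
    lemma₂ : ∀ g u → 5 * (g * (u * u) + g * (u * u)) ≡ 10 * (u * u) * g
    lemma₂ = solve-∀
    lemma₃ : ∀ g u b → g * (u * b * (u * b)) ≡ g * (u * u) * (b * b)
    lemma₃ = solve-∀
    lemma₄ : ∀ m w a b → m * w * (a * b) ≡ m * (w * a * b)
    lemma₄ = solve-∀
    lemma₅ : ∀ g u a b → g * (a * (u * b)) ≡ g * u * (a * b)
    lemma₅ = solve-∀
    m≤ : m ≤ g * (u * u)
    m≤ = *-cancelʳ-≤ m (g * (u * u)) (b * b) {{m*n≢0 b b}} (begin
      m * (b * b)                ≤⟨ size ⟩
      g * (a * a)                ≤⟨ *-monoʳ-≤ g (*-mono-≤ a≤ub a≤ub) ⟩
      g * (u * b * (u * b))      ≡⟨ lemma₃ g u b ⟩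
      g * (u * u) * (b * b)      ∎)
    mw≤ : m * w ≤ g * u
    mw≤ = *-cancelʳ-≤ (m * w) (g * u) (a * b) {{m*n≢0 a b}} (begin
      m * w * (a * b)        ≡⟨ lemma₄ m w a b ⟩
      m * (w * a * b)        ≤⟨ *-monoʳ-≤ m (*-monoˡ-≤ b wa≤b) ⟩
      m * (b * b)            ≤⟨ size ⟩
      g * (a * a)            ≤⟨ *-monoʳ-≤ g (*-monoʳ-≤ a a≤ub) ⟩
      g * (a * (u * b))      ≡⟨ lemma₅ g u a b ⟩
      g * u * (a * b)        ∎)

  m≤[1+m/n]*n : ∀ m n .{{_ : NonZero n}} → m ≤ suc (m / n) * n
  m≤[1+m/n]*n m n = begin
    m                    ≡⟨ m≡m%n+[m/n]*n m n ⟩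
    m % n + m / n * n    ≤⟨ +-monoˡ-≤ (m / n * n) (m%n≤n m n) ⟩
    suc (m / n) * n      ∎
    where open ≤-Reasoning

  module Precision (a d : ℕ) .(c : Coprime (suc a) (suc d)) where

    ε : ℚ
    ε = mkℚ +[1+ a ] d c

    -- Chosen so that `suc E` is 5 (⌊1/ε⌋ + 1), which exceeds 5/ε; the relative error 5/e is then
    -- below ε.
    num den E : ℕ
    num = suc a
    den = suc d
    E   = 4 + 5 * (den / num)

    1+E : suc E ≡ 5 * suc (den / num)
    1+E = sym (*-suc 5 (den / num))

    module _ (m : ℕ) where

      g : ℕ
      g = 2 ⊔ ℤ.∣ ℚ.⌈ m / ε ² ⌉ ∣

      2≤g : 2 ≤ g
      2≤g = m≤m⊔n 2 ℤ.∣ ℚ.⌈ m / ε ² ⌉ ∣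

      times-ε² : (m / ε ²) ℚ.* (ε ℚ.* ε) ≡ ℕ→ℚ m
      times-ε² = trans (ℚ.*-assoc (ℕ→ℚ m) (ℚ.1/ (ε ℚ.* ε)) (ε ℚ.* ε))
        (trans (cong (ℕ→ℚ m ℚ.*_) (ℚ.*-inverseˡ (ε ℚ.* ε))) (ℚ.*-identityʳ (ℕ→ℚ m)))
        where
        instance
          ε²≢0 : ℚ.NonZero (ε ℚ.* ε)
          ε²≢0 = ℚ.pos⇒nonZero (ε ℚ.* ε) {{ℚ.pos*pos⇒pos ε ε}}

      m≤g*ε² : m * (den * den) ≤ g * (num * num)
      -- The factors 1 are the denominators of the integers m and g in unnormalised fractions.
      m≤g*ε² = ≤-trans (≤-reflexive (cong (m *_) (sym (*-identityˡ (den * den))))) (≤-trans (fraction-≤⁻¹ {m} {g * (num * num)} {0} {pred (1 * (den * den))} (begin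
        mkℚᵘ (+ m) 0                                  ≃⟨ ℕ→ℚ-≃ m ⟨
        toℚᵘ (ℕ→ℚ m)                                  ≤⟨ ℚ.toℚᵘ-mono-≤ m≤ ⟩
        toℚᵘ (ℕ→ℚ g ℚ.* (ε ℚ.* ε))                    ≃⟨ ℚ.toℚᵘ-homo-* (ℕ→ℚ g) (ε ℚ.* ε) ⟩
        toℚᵘ (ℕ→ℚ g) ℚᵘ.* toℚᵘ (ε ℚ.* ε)              ≃⟨ ℚᵘ.*-cong (ℕ→ℚ-≃ g) (ℚ.toℚᵘ-homo-* ε ε) ⟩
        mkℚᵘ (+ g) 0 ℚᵘ.* (toℚᵘ ε ℚᵘ.* toℚᵘ ε)        ≡⟨ cong (λ z → mkℚᵘ z (pred (1 * (den * den))))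
          (trans (cong (+ g ℤ.*_) (sym (ℤ.pos-* num num))) (sym (ℤ.pos-* g (num * num)))) ⟩
        mkℚᵘ (+ (g * (num * num))) (pred (1 * (den * den))) ∎)) (≤-reflexive (*-identityʳ _)))
        where
        open ℚᵘ.≤-Reasoning
        m≤ : ℕ→ℚ m ℚ.≤ ℕ→ℚ g ℚ.* (ε ℚ.* ε)
        m≤ = subst (ℚ._≤ ℕ→ℚ g ℚ.* (ε ℚ.* ε)) times-ε²
          (ℚ.*-monoʳ-≤-nonNeg (ε ℚ.* ε) {{ℚ.pos⇒nonNeg (ε ℚ.* ε) {{ℚ.pos*pos⇒pos ε ε}}}}
            (ceiling-≤ (m / ε ²) (m≤n⊔m 2 ℤ.∣ ℚ.⌈ m / ε ² ⌉ ∣)))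

      size : m * suc E ≤ factor ε * g
      size = subst (λ x → m * x ≤ factor ε * g) (sym 1+E)
        (size-≤ m g (roundUp ε) (den / num) num den m≤g*ε² (m≤[1+m/n]*n num den)
          (m/n*n≤m den num) (roundUp>0 ε))

      1≤factor : 1 ≤ factor ε
      1≤factor = *-mono-≤ {1} {10} (s≤s z≤n) (*-mono-≤ (roundUp>0 ε) (roundUp>0 ε))

      size-product : m * suc (choose m E 0) ≤ factor ε * g
      size-product = go m size
        where
        go : ∀ m → m * suc E ≤ factor ε * g → m * suc (choose m E 0) ≤ factor ε * g
        go zero    _  = z≤n
        go (suc m) le = le

      -- For positive m, e is at most m e. For m = 0 such a bound would fail for small ε, but then
      -- the precision has been reset to 1.
      size-precision : suc (choose m E 0) ≤ factor ε * g
      size-precision = go m size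
        where
        go : ∀ m → m * suc E ≤ factor ε * g → suc (choose m E 0) ≤ factor ε * g
        go zero    _  = *-mono-≤ 1≤factor (≤-trans (s≤s z≤n) 2≤g)
        go (suc m) le = ≤-trans (m≤m+n (suc E) (m * suc E)) le

    ratio : ∀ {K K*} → suc E * K ≤ (5 + suc E) * K* → K * den ≤ (den + num) * K*
    ratio {K} {K*} le = *-cancelˡ-≤ (suc E) (begin
      suc E * (K * den)                            ≡⟨ *-assoc (suc E) K den ⟨
      suc E * K * den                              ≤⟨ *-monoˡ-≤ den le ⟩
      (5 + suc E) * K* * den                       ≡⟨ lemma₁ (suc E) K* den ⟩
      5 * den * K* + suc E * (den * K*)            ≤⟨ +-monoˡ-≤ _ (*-monoˡ-≤ K* (*-monoʳ-≤ 5 (m≤[1+m/n]*n den num))) ⟩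
      5 * (suc (den / num) * num) * K* + suc E * (den * K*)
                                                   ≡⟨ cong (λ x → x * K* + suc E * (den * K*)) (*-assoc 5 (suc (den / num)) num) ⟨
      5 * suc (den / num) * num * K* + suc E * (den * K*)
                                                   ≡⟨ cong (λ x → x * num * K* + suc E * (den * K*)) 1+E ⟨
      suc E * num * K* + suc E * (den * K*)        ≡⟨ lemma₂ (suc E) num den K* ⟩
      suc E * ((den + num) * K*)                   ∎)
      where
      open ≤-Reasoning
      lemma₁ : ∀ e k d → (5 + e) * k * d ≡ 5 * d * k + e * (d * k)
      lemma₁ = solve-∀
      lemma₂ : ∀ e n d k → e * n * k + e * (d * k) ≡ e * ((d + n) * k)
      lemma₂ = solve-∀

    ratio-ℚ : ∀ {K K*} → K * den ≤ (den + num) * K* → ℕ→ℚ K ℚ.≤ (1ℚ ℚ.+ ε) ℚ.* ℕ→ℚ K*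
    ratio-ℚ {K} {K*} le = ℚ.toℚᵘ-cancel-≤ (begin
      toℚᵘ (ℕ→ℚ K)                                  ≃⟨ ℕ→ℚ-≃ K ⟩
      mkℚᵘ (+ K) 0                                  ≤⟨ fraction-≤ {K} {(den + num) * K*} {0} {pred (1 * den * 1)}
        (≤-trans (≤-reflexive (cong (K *_) (trans (*-identityʳ (1 * den)) (*-identityˡ den))))
          (≤-trans le (≤-reflexive (sym (*-identityʳ _))))) ⟩
      mkℚᵘ (+ ((den + num) * K*)) (pred (1 * den * 1))
                                                    ≡⟨ cong (λ z → mkℚᵘ z (pred (1 * den * 1)))
        (trans (ℤ.pos-* (den + num) K*) (cong (ℤ._* + K*) (cong₂ ℤ._+_ (sym (ℤ.*-identityˡ (+ den))) (sym (ℤ.*-identityʳ (+ num)))))) ⟩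
      (ℚᵘ.1ℚᵘ ℚᵘ.+ toℚᵘ ε) ℚᵘ.* mkℚᵘ (+ K*) 0       ≃⟨ ℚᵘ.*-cong (ℚ.toℚᵘ-homo-+ 1ℚ ε) (ℕ→ℚ-≃ K*) ⟨
      toℚᵘ (1ℚ ℚ.+ ε) ℚᵘ.* toℚᵘ (ℕ→ℚ K*)            ≃⟨ ℚ.toℚᵘ-homo-* (1ℚ ℚ.+ ε) (ℕ→ℚ K*) ⟨
      toℚᵘ ((1ℚ ℚ.+ ε) ℚ.* ℕ→ℚ K*)                  ∎)
      where open ℚᵘ.≤-Reasoning

    -- Without clients or days the objective is 0. Otherwise m is a successor, so e computes to
    -- `suc E` and the general guarantee applies.
    near-optimal-schedule : ∀ {n m} (I : Instance n m) π* →
      K I (Instances.schedule I E) * den ≤ (den + num) * K I π*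
    near-optimal-schedule {zero}          I π* = z≤n
    near-optimal-schedule {suc n} {zero}  I π* =
      ≤-trans (*-monoˡ-≤ den (Instances.K≤ I E (Instances.schedule I E) {0} λ _ → z≤n)) z≤n
    near-optimal-schedule {suc n} {suc m} I π* = ratio {K I (Instances.schedule I E)} {K I π*}
      (Instances.Optimum.schedule-≤ I E (s≤s z≤n) π*)

    algorithm : Program
    algorithm = compileAll (program E)

    correct : ∀ n m (I : Instance n m) → Σ[ π ∈ Schedule n m ] Σ[ s ∈ Memory ] Σ[ t ∈ ℕ ]
      ( (⟨ algorithm , initial I ⟩⇓[ t ] s)
      × Outputs s π
      × (∀ (K* : ℕ) → IsOptimalValue I K* → ℕ→ℚ (K I π) ℚ.≤ (1ℚ ℚ.+ ε) ℚ.* ℕ→ℚ K*)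
      × t ≤ timeBound (at constant ε) (at exponentConstant ε) 2 n m ε )
    correct n m I =
      let s , t , run , ended , fast = program-runs (initial I) (matches starts λ _ → refl)
      in Instances.schedule I E , s , t , run ,
         Instances.schedule-outputs I E s (Matches.arraysHold ended) ,
         -- An optimal value is attained by some π*, and the guarantee holds against every schedule.
         (λ { _ ((π* , refl) , _) → ratio-ℚ {K I (Instances.schedule I E)} {K I π*} (near-optimal-schedule I π*) }) ,
         ≤-trans fast bound
      where
      input : ℕ → ℕ
      input = Instances.input I E
      open Execution n m E input using (program-runs; start; cap; 1+resolution≤cap)
      l : ℕ
      l = ⌈log₂ g m ⌉
      starts : ∀ i → reg (initial I) (toℕ i) ≡ lookup start i
      starts zero          = refl
      starts (suc zero)    = refl
      starts (suc (suc i)) = sym (lookup-replicate i 0)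
      lemma : ∀ f g l d → 36 * f * g * l * d ≡ 36 * f * d * g * l
      lemma = solve-∀
      open ≤-Reasoning
      bound : costAll (program E) cap ≤ timeBound (at constant ε) (at exponentConstant ε) 2 n m ε
      bound = begin
        -- `program E` and `program 0` differ in one literal, whose cost is 1, so their costs agree
        -- definitionally.
        costAll (program 0) cap
          ≤⟨ costAll-≤ cap (≤-trans (s≤s z≤n) 1+resolution≤cap) ⟩
        coefficient * cap ^ degree
          ≤⟨ *-monoʳ-≤ coefficient (^-monoˡ-≤ degree (cap-bound n m E (factor ε) (g m) input
               (1≤factor m) (2≤g m) (size-product m) (size-precision m))) ⟩
        coefficient * ((2 ⊔ n) ^ (36 * factor ε ^ 3 * g m * l ^ 2)) ^ degree
          ≡⟨ cong (coefficient *_) (^-*-assoc (2 ⊔ n) (36 * factor ε ^ 3 * g m * l ^ 2) degree) ⟩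
        coefficient * (2 ⊔ n) ^ (36 * factor ε ^ 3 * g m * l ^ 2 * degree)
          ≡⟨ cong (λ x → coefficient * (2 ⊔ n) ^ x) (lemma (factor ε ^ 3) (g m) (l ^ 2) degree) ⟩
        coefficient * (2 ⊔ n) ^ (36 * factor ε ^ 3 * degree * g m * l ^ 2)
          ∎

open Approximation

theorem2 : Σ[ C ∈ HiddenConstant ] Σ[ c ∈ HiddenConstant ] Σ[ d ∈ ℕ ]
    (∀ (ε : ℚ) .{{_ : Positive ε}} →
    Σ[ A ∈ Program ]
    (∀ (n m : ℕ) (I : Instance n m) →
    Σ[ π ∈ Schedule n m ] Σ[ s ∈ Memory ] Σ[ t ∈ ℕ ]
    ( (⟨ A , initial I ⟩⇓[ t ] s)
    × Outputs s π
    × (∀ (K* : ℕ) → IsOptimalValue I K* →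
    ℕ→ℚ (K I π) ℚ.≤ (1ℚ ℚ.+ ε) ℚ.* ℕ→ℚ K*)
    × t ≤ timeBound (at C ε) (at c ε) d n m ε )))
-- The logarithm occurs squared: one factor counts the ℓ doublings of the thresholds, the other is
-- the length of a single digit, measured as an exponent of the base.
theorem2 = constant , exponentConstant , 2 , λ
  { (mkℚ ℤ.+[1+ a ] d c)        → Precision.algorithm a d c , Precision.correct a d c
  ; (mkℚ (ℤ.+ 0) d c) {{pos}}   → ⊥-elim (ℤ.Positive.pos pos)
  ; (mkℚ ℤ.-[1+ a ] d c) {{pos}} → ⊥-elim (ℤ.Positive.pos pos)
  }
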